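{- Let $q=2^n$ with $n\ge 3$, let $h$ be a positive integer with $\gcd(n,h)=1$, and let $\mathcal A\subset \mathrm{PG}(3,q)$ and $G_h$ be the $(q+1)$-arc and its group as defined in the context. Then $G_h$ has exactly five orbits on the points of $\mathrm{PG}(3,q)$: (1) $\mathcal A$, of size $q+1$; (2) $\mathcal O_0$, of size $(q^3-q)/3$, consisting of the points not contained in any osculating plane; (3) $\mathcal O_1$, of size $(q^3-q)/2$, consisting of the points of $\mathrm{PG}(3,q)\setminus\mathcal A$ lying on exactly one osculating plane; (4) $\mathcal O_2=\mathcal Q^+(3,q)\setminus\mathcal A$, of size $q^2+q$, consisting of the points lying on exactly two osculating planes; (5) $\mathcal O_3$, of size $(q^3-q)/6$, consisting of the points lying on exactly three osculating planes.
   Context: Points of $\mathrm{PG}(3,q)$ have homogeneous coordinates $(X_1,X_2,X_3,X_4)$, written as column vectors when acted on by matrices; $U_i$ is the point with $1$ in position $i$ and $0$ elsewhere. $\mathcal A=\{P_t=(1,t,t^{2^h},t^{2^h+1})\mid t\in\mathbb F_q\}\cup\{U_4\}$. $G_h\simeq \mathrm{PGL}(2,q)$ is the group of projectivities of $\mathrm{PG}(3,q)$ stabilizing $\mathcal A$; its elements are represented by the matrices $$M_{a,b,c,d}=\begin{pmatrix} a^{2^h+1}&a^{2^h}b&ab^{2^h}&b^{2^h+1}\\ a^{2^h}c&a^{2^h}d&b^{2^h}c&b^{2^h}d\\ ac^{2^h}&bc^{2^h}&ad^{2^h}&bd^{2^h}\\ c^{2^h+1}&c^{2^h}d&cd^{2^h}&d^{2^h+1}\end{pmatrix},\quad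 a,b,c,d\in\mathbb F_q,\ ad+bc=1.$$ $\mathfrak s$ is the symplectic polarity of $\mathrm{PG}(3,q)$ defined by the alternating form $x_1y_4+x_2y_3+x_3y_2+x_4y_1$. The osculating planes are the $q+1$ planes $P^{\mathfrak s}$, $P\in\mathcal A$: $P_t^{\mathfrak s}: t^{2^h+1}X_1+t^{2^h}X_2+tX_3+X_4=0$ and $U_4^{\mathfrak s}:X_1=0$. $\mathcal Q^+(3,q)$ is the hyperbolic quadric $X_1X_4+X_2X_3=0$. -}

module Defs where

open import Algebra.Apartness.Structures using (IsHeytingField)
open import Algebra.Bundles using (CommutativeRing; Semiring)
import Algebra.Definitions.RawSemiring as RawSemiringDefs
import Algebra.Properties.Semiring.Sum as SemiringSum
open import Data.Bool.Base using (if_then_else_)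
open import Data.Fin.Base using (Fin; zero; suc; opposite)
open import Data.Fin.Patterns using (0F; 1F; 2F; 3F)
open import Data.Fin.Properties using (_≟_; opposite-involutive)
open import Data.Nat.Base as ℕ using (ℕ)
open import Data.Product.Base using (∃; ∃-syntax; _×_; _,_; proj₁; proj₂)
open import Data.Sum.Base using (_⊎_)
open import Data.Vec.Functional using (Vector; []; _∷_)
open import Function.Bundles using (Bijection; _↔_; _⇔_)
open import Level using (0ℓ)
open import Relation.Binary.Bundles using (Setoid)
import Relation.Binary.Construct.On as On
open import Relation.Binary.PropositionalEquality
  using (_≡_; _≢_; refl; sym; trans; cong; cong₂; subst; module ≡-Reasoning)
import Relation.Binary.PropositionalEquality as ≡
open import Relation.Nullary using (¬_; does)
open import Relation.Unary using (Pred; _≐_)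

-- A field with exactly q elements.  With propositional equality and the
-- apartness _≢_, a Heyting field is a commutative ring in which an element
-- is invertible exactly when it is nonzero.
record FiniteField (q : ℕ) : Set₁ where
  infix  8 -_
  infixl 7 _*_
  infixl 6 _+_
  field
    Carrier        : Set
    _+_ _*_        : Carrier → Carrier → Carrier
    -_             : Carrier → Carrier
    0# 1#          : Carrier
    isHeytingField : IsHeytingField _≡_ _≢_ _+_ _*_ -_ 0# 1#
    enumeration    : Fin q ↔ Carrier

  open IsHeytingField isHeytingField public
    using (isCommutativeRing; #⇒invertible; invertible⇒#)

  commutativeRing : CommutativeRing 0ℓ 0ℓ
  commutativeRing = record { isCommutativeRing = isCommutativeRing }

module PG3 {q : ℕ} (F : FiniteField q) where

  open FiniteField F using (Carrier; #⇒invertible; invertible⇒#)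
  private
    R : CommutativeRing 0ℓ 0ℓ
    R = FiniteField.commutativeRing F
  open CommutativeRing R using
    ( _+_; _*_; -_; 0#; 1#; semiring; *-identityˡ; *-identityʳ; *-assoc
    ; *-comm; zeroˡ; zeroʳ; +-identityˡ; +-identityʳ; -‿inverseʳ)
  open RawSemiringDefs (Semiring.rawSemiring semiring) using (_^_)
  open SemiringSum semiring using
    (sum; sum-syntax; sum-cong-≗; sum-replicate-zero; ∑-comm
    ; *-distribˡ-sum; *-distribʳ-sum)

  private
    x-0≡x : ∀ x → x + - 0# ≡ x
    x-0≡x x = trans (cong (x +_) (trans (sym (+-identityˡ (- 0#))) (-‿inverseʳ 0#)))
                    (+-identityʳ x)

    1≢0 : 1# ≢ 0#
    1≢0 = invertible⇒# (1# , trans (*-identityˡ _) (x-0≡x 1#)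
                          , trans (*-identityʳ _) (x-0≡x 1#))

    inverse : ∀ {x} → x ≢ 0# → ∃[ y ] y * x ≡ 1#
    inverse {x} x≢0 with #⇒invertible x≢0
    ... | y , yx≡1 , _ = y , trans (cong (y *_) (sym (x-0≡x x))) yx≡1

  record Point : Set where
    constructor point
    field
      coords  : Vector Carrier 4
      nonzero : ¬ (∀ i → coords i ≡ 0#)
  open Point public

  infix 4 _≈_ _∈ᵖ_

  _≈_ : Point → Point → Set
  P ≈ Q = ∃[ c ] c ≢ 0# × (∀ i → coords P i ≡ c * coords Q i)

  private
    ≈-refl : ∀ {P} → P ≈ P
    ≈-refl = 1# , 1≢0 , λ i → sym (*-identityˡ _)

    ≈-sym : ∀ {P Q} → P ≈ Q → Q ≈ P
    ≈-sym {P} {Q} (c , c≢0 , eq) = d , d≢0 , λ i → begin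
        coords Q i             ≡⟨ *-identityˡ _ ⟨
        1# * coords Q i        ≡⟨ cong (_* coords Q i) dc≡1 ⟨
        d * c * coords Q i     ≡⟨ *-assoc d c _ ⟩
        d * (c * coords Q i)   ≡⟨ cong (d *_) (eq i) ⟨
        d * coords P i         ∎
      where
      open ≡-Reasoning
      d = proj₁ (inverse c≢0)
      dc≡1 = proj₂ (inverse c≢0)
      d≢0 : d ≢ 0#
      d≢0 d≡0 = 1≢0 (trans (sym dc≡1) (trans (cong (_* c) d≡0) (zeroˡ c)))

    ≈-trans : ∀ {P Q S} → P ≈ Q → Q ≈ S → P ≈ S
    ≈-trans {P} {Q} {S} (c , c≢0 , eq) (d , d≢0 , eq′) = c * d , cd≢0 , λ i →
        trans (eq i) (trans (cong (c *_) (eq′ i)) (sym (*-assoc c d _)))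
      where
      cd≢0 : c * d ≢ 0#
      cd≢0 cd≡0 with inverse c≢0
      ... | e , ec≡1 = d≢0 (begin
        d              ≡⟨ *-identityˡ d ⟨
        1# * d         ≡⟨ cong (_* d) ec≡1 ⟨
        e * c * d      ≡⟨ *-assoc e c d ⟩
        e * (c * d)    ≡⟨ cong (e *_) cd≡0 ⟩
        e * 0#         ≡⟨ zeroʳ e ⟩
        0#             ∎)
        where open ≡-Reasoning

  pointSetoid : Setoid 0ℓ 0ℓ
  pointSetoid = record
    { Carrier = Point
    ; _≈_ = _≈_
    ; isEquivalence = record
      { refl  = λ {P} → ≈-refl {P}
      ; sym   = λ {P} {Q} → ≈-sym {P} {Q}
      ; trans = λ {P} {Q} {S} → ≈-trans {P} {Q} {S}
      }
    }

  -- Planes are given by dual homogeneous coordinates: π stands for the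
  -- plane π₁X₁ + π₂X₂ + π₃X₃ + π₄X₄ = 0.
  Plane : Set
  Plane = Point

  _∈ᵖ_ : Point → Plane → Set
  P ∈ᵖ π = ∑[ i < 4 ] (coords π i * coords P i) ≡ 0#

  -- S contains exactly k points (or planes), counted up to proportionality.
  HasSize : Pred Point 0ℓ → ℕ → Set
  HasSize S k =
    Bijection (≡.setoid (Fin k)) (On.setoid pointSetoid (proj₁ {B = S}))

  Matrix : Set
  Matrix = Fin 4 → Fin 4 → Carrier

  _·_ : Matrix → Matrix → Matrix
  (A · B) i k = ∑[ j < 4 ] (A i j * B j k)

  1ᴹ : Matrix
  1ᴹ i j = if does (i ≟ j) then 1# else 0#

  _*ᵥ_ : Matrix → Vector Carrier 4 → Vector Carrier 4
  (A *ᵥ v) i = ∑[ j < 4 ] (A i j * v j)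

  -- An invertible matrix, representing a projectivity; proportional
  -- matrices are not identified, but they act on points in the same way.
  record Projectivity : Set where
    field
      matrix   : Matrix
      inv      : Matrix
      inverseˡ : ∀ i j → (inv · matrix) i j ≡ 1ᴹ i j
      inverseʳ : ∀ i j → (matrix · inv) i j ≡ 1ᴹ i j
  open Projectivity public

  private
    ·-*ᵥ : ∀ A B v i → ((A · B) *ᵥ v) i ≡ (A *ᵥ (B *ᵥ v)) i
    ·-*ᵥ A B v i = begin
      ∑[ k < 4 ] ((A · B) i k * v k)
        ≡⟨ sum-cong-≗ (λ k → *-distribʳ-sum (v k) (λ j → A i j * B j k)) ⟩
      ∑[ k < 4 ] ∑[ j < 4 ] (A i j * B j k * v k)
        ≡⟨ ∑-comm (λ k j → A i j * B j k * v k) ⟩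
      ∑[ j < 4 ] ∑[ k < 4 ] (A i j * B j k * v k)
        ≡⟨ sum-cong-≗ (λ j → sum-cong-≗ (λ k → *-assoc (A i j) (B j k) (v k))) ⟩
      ∑[ j < 4 ] ∑[ k < 4 ] (A i j * (B j k * v k))
        ≡⟨ sum-cong-≗ (λ j → *-distribˡ-sum (A i j) (λ k → B j k * v k)) ⟨
      ∑[ j < 4 ] (A i j * (B *ᵥ v) j)
        ∎
      where open ≡-Reasoning

    *ᵥ-zero : ∀ A v → (∀ i → v i ≡ 0#) → ∀ i → (A *ᵥ v) i ≡ 0#
    *ᵥ-zero A v v≡0 i =
      trans (sum-cong-≗ {4} (λ j → trans (cong (A i j *_) (v≡0 j)) (zeroʳ _)))
            (sum-replicate-zero 4)

    1ᴹ-*ᵥ : ∀ v i → (1ᴹ *ᵥ v) i ≡ v i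
    1ᴹ-*ᵥ v i = lemma i
      where
      one : ∀ {x y z} → x ≡ 1# * y → z ≡ 0# → x + z ≡ y
      one {y = y} p r =
        trans (cong₂ _+_ (trans p (*-identityˡ y)) r) (+-identityʳ y)
      nil : ∀ x {y z} → y ≡ z → 0# * x + y ≡ z
      nil x p = trans (cong₂ _+_ (zeroˡ x) p) (+-identityˡ _)
      lemma : ∀ i → (1ᴹ *ᵥ v) i ≡ v i
      lemma 0F = one refl (nil _ (nil _ (nil _ refl)))
      lemma 1F = nil _ (one refl (nil _ (nil _ refl)))
      lemma 2F = nil _ (nil _ (one refl (nil _ refl)))
      lemma 3F = nil _ (nil _ (nil _ (one refl refl)))

  infixr 7 _•_

  _•_ : Projectivity → Point → Point
  g • P = point (matrix g *ᵥ coords P) λ gP≡0 → nonzero P λ i → begin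
      coords P i                                 ≡⟨ 1ᴹ-*ᵥ (coords P) i ⟨
      (1ᴹ *ᵥ coords P) i
        ≡⟨ sum-cong-≗ {4} (λ j → cong (_* coords P j) (inverseˡ g i j)) ⟨
      ((inv g · matrix g) *ᵥ coords P) i         ≡⟨ ·-*ᵥ (inv g) (matrix g) (coords P) i ⟩
      (inv g *ᵥ (matrix g *ᵥ coords P)) i        ≡⟨ *ᵥ-zero (inv g) _ gP≡0 i ⟩
      0#                                         ∎
    where open ≡-Reasoning

  P[_,_] : ℕ → Carrier → Point
  P[ h , t ] = point
    (1# ∷ t ∷ t ^ (2 ℕ.^ h) ∷ t ^ (2 ℕ.^ h ℕ.+ 1) ∷ [])
    (λ ≡0 → 1≢0 (≡0 0F))

  U₄ : Point
  U₄ = point (0# ∷ 0# ∷ 0# ∷ 1# ∷ []) (λ ≡0 → 1≢0 (≡0 3F))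

  Arc : ℕ → Pred Point 0ℓ
  Arc h P = (∃[ t ] P ≈ P[ h , t ]) ⊎ P ≈ U₄

  -- Points are permuted by g, so the equivalence says that g maps the arc
  -- onto itself.
  G : ℕ → Pred Projectivity 0ℓ
  G h g = ∀ P → Arc h P ⇔ Arc h (g • P)

  Orbit : ℕ → Point → Pred Point 0ℓ
  Orbit h P Q = ∃[ g ] G h g × Q ≈ g • P

  IsOrbit : ℕ → Pred Point 0ℓ → Set
  IsOrbit h S = ∃[ P ] S ≐ Orbit h P

  -- The symplectic polarity of x₁y₄ + x₂y₃ + x₃y₂ + x₄y₁: it sends
  -- (p₁, p₂, p₃, p₄) to the plane p₄X₁ + p₃X₂ + p₂X₃ + p₁X₄ = 0.
  polar : Point → Plane
  polar P = point (λ i → coords P (opposite i)) λ ≡0 → nonzero P λ i →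
    subst (λ j → coords P j ≡ 0#) (opposite-involutive i) (≡0 (opposite i))

  Osculating : ℕ → Pred Plane 0ℓ
  Osculating h π = ∃[ P ] Arc h P × π ≈ polar P

  OnExactly_OsculatingPlanes : ℕ → ℕ → Pred Point 0ℓ
  OnExactly_OsculatingPlanes k h P =
    HasSize (λ π → Osculating h π × P ∈ᵖ π) k

  Quadric : Pred Point 0ℓ
  Quadric P = coords P 0F * coords P 3F + coords P 1F * coords P 2F ≡ 0#

  𝒪₀ 𝒪₁ 𝒪₂ 𝒪₃ : ℕ → Pred Point 0ℓ
  𝒪₀ h P = ∀ π → Osculating h π → ¬ P ∈ᵖ π
  𝒪₁ h P = ¬ Arc h P × OnExactly 1 OsculatingPlanes h P
  𝒪₂ h P = Quadric P × ¬ Arc h P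
  𝒪₃ h   = OnExactly 3 OsculatingPlanes h

  orbits : ℕ → Vector (Pred Point 0ℓ) 5
  orbits h = Arc h ∷ 𝒪₀ h ∷ 𝒪₁ h ∷ 𝒪₂ h ∷ 𝒪₃ h ∷ []

{-# OPTIONS --safe #-}
module Submission where

-- Write σ(t) = t^(2^h) and read a point as a 2 × 2 matrix X = (x₁ x₂ ; x₃ x₄).
-- Then GL(2, q) acts by X ↦ B^σ X Bᵗ; the arc consists of the matrices u^σ uᵗ,
-- the quadric is det X = 0, and the action permutes the osculating planes.  A
-- projectivity that fixes the arc and U₄ also fixes the plane X₁ = 0: the
-- points off this plane lie on planes spanned by U₄ and two points P_s, P_t,
-- while U₂ and U₃ do not.  So all of G_h permutes the osculating planes, and the
-- number k of osculating planes on a point is constant on orbits.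
--
-- A point with k > 0 can be moved into the plane X₁ = 0 and then, because the
-- image of ℘(t) = σ(t) + t has index two in F, to one of U₄, (0, 1, 0, 0),
-- (0, 1, 1, 0) and (0, 1, 1, c₀), where k is 1, 2, 3 and 1.  Counting pairs of a
-- point and an osculating plane on it gives the sizes of these orbits, and
-- the number (q³ − q) / 3 of points with k = 0.
--
-- If k = 0 at X, the matrices B that send X to a multiple of a given Y are, after
-- rescaling, the nonzero elements of an 𝔽₂-space on which det takes only one
-- nonzero value.  There are at most three of them, so the q³ − q elements of
-- PGL(2, q) send X to at least, hence to all of the (q³ − q) / 3 points with k = 0.

-- The condition on n and h enters through a single fact: σ fixes only 0 and 1. It makes the kernel
-- of ℘ as small as possible, it makes v ↦ σ v / v a permutation of the nonzero elements, so that
-- unwanted scalars can be absorbed by rescaling, and it forces the single nonzero value of det on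
-- the space of intertwining matrices. Since `G h` is by definition the whole stabilizer of the arc,
-- the two halves of the argument are asymmetric. Transitivity on each class is obtained with the
-- matrices `M` of GL₂ alone, while invariance of the classes has to be shown for every projectivity
-- that preserves the arc. A point with k = 0 lies on no osculating plane that could be moved to X₁
-- = 0, so the method of normal forms has nothing to start from. This is why transitivity there is
-- deduced from numbers: the bound three on the fibres and the size of the class multiply to exactly
-- q³ - q, which leaves no room for an empty fibre. Counts are kept in the form m l + q = q³ until
-- the end, which avoids truncated subtraction and division.

module Counting where

  open import Data.Bool.Base using (if_then_else_)
  open import Data.Fin.Base using (Fin; zero; suc)
  open import Data.List.Base using (List; []; _∷_; _++_; map; filter; length; lookup; cartesianProduct)
  open import Data.List.Membership.Propositional using (_∈_)
  open import Data.List.Membership.Propositional.Properties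
    using (∈-lookup; ∈-map⁺; ∈-map⁻; ∈-++⁺ˡ; ∈-++⁺ʳ; ∈-cartesianProduct⁺; ∈-filter⁺; ∈-filter⁻)
  open import Data.List.Relation.Unary.All using (All; []; _∷_)
  import Data.List.Relation.Unary.All as All
  open import Data.List.Relation.Unary.Any using (here; there; any?; index; satisfied)
  import Data.List.Relation.Unary.Any as Any
  open import Data.List.Relation.Unary.AllPairs using ([]; _∷_)
  open import Data.List.Relation.Unary.Unique.Propositional using (Unique)
  import Data.List.Relation.Unary.Unique.Propositional.Properties as Unique
  open import Data.Nat.Base using (ℕ; zero; suc; _+_; _*_; _≤_; z≤n; s≤s)
  import Data.Nat.Properties as ℕ
  open import Algebra.Properties.CommutativeSemigroup ℕ.+-commutativeSemigroup using (interchange)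
  open import Data.Product.Base using (∃; ∃-syntax; _×_; _,_; proj₁; proj₂)
  open import Data.Product.Properties using (≡-dec)
  open import Data.Sum.Base using (_⊎_; inj₁; inj₂)
  open import Data.Sum.Properties using (inj₁-injective; inj₂-injective)
  import Data.Sum.Properties as Sum
  open import Data.Unit.Base using (⊤; tt)
  import Data.Unit.Properties as ⊤
  open import Function.Base using (_∘_)
  open import Relation.Binary.Definitions using (DecidableEquality)
  open import Relation.Binary.PropositionalEquality
  open import Relation.Nullary using (¬_; Dec; yes; no; does; contradiction)
  open import Relation.Nullary.Decidable using (_×-dec_)
  open import Relation.Unary using (Pred; Decidable)

  private variable
    A B : Set
    P Q : Set

  -- Finite sums and counting with indicator functions

  ind : Dec P → ℕ
  ind p = if does p then 1 else 0

  ind-yes : (p : Dec P) → P → ind p ≡ 1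
  ind-yes (yes _) _ = refl
  ind-yes (no ¬p) p = contradiction p ¬p

  ind-no : (p : Dec P) → ¬ P → ind p ≡ 0
  ind-no (yes p) ¬p = contradiction p ¬p
  ind-no (no _)  _  = refl

  ind-cong : (p : Dec P) (q : Dec Q) → (P → Q) → (Q → P) → ind p ≡ ind q
  ind-cong (yes p) q f g = sym (ind-yes q (f p))
  ind-cong (no ¬p) q f g = sym (ind-no q (¬p ∘ g))

  ind-× : (p : Dec P) (q : Dec Q) → ind (p ×-dec q) ≡ ind p * ind q
  ind-× (yes _) (yes _) = refl
  ind-× (yes _) (no _)  = refl
  ind-× (no _)  _       = refl

  ∑ : List A → (A → ℕ) → ℕ
  ∑ []       f = 0
  ∑ (x ∷ xs) f = f x + ∑ xs f

  ∑-cong : {f g : A → ℕ} → ∀ xs → (∀ x → f x ≡ g x) → ∑ xs f ≡ ∑ xs g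
  ∑-cong []       f≗g = refl
  ∑-cong (x ∷ xs) f≗g = cong₂ _+_ (f≗g x) (∑-cong xs f≗g)

  ∑-+ : ∀ xs (f g : A → ℕ) → ∑ xs (λ x → f x + g x) ≡ ∑ xs f + ∑ xs g
  ∑-+ []       f g = refl
  ∑-+ (x ∷ xs) f g =
    trans (cong (f x + g x +_) (∑-+ xs f g)) (interchange (f x) (g x) _ _)

  ∑-*ˡ : ∀ xs k (f : A → ℕ) → ∑ xs (λ x → k * f x) ≡ k * ∑ xs f
  ∑-*ˡ []       k f = sym (ℕ.*-zeroʳ k)
  ∑-*ˡ (x ∷ xs) k f =
    trans (cong (k * f x +_) (∑-*ˡ xs k f)) (sym (ℕ.*-distribˡ-+ k (f x) _))

  ∑-const : ∀ (xs : List A) k → ∑ xs (λ _ → k) ≡ length xs * k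
  ∑-const []       k = refl
  ∑-const (x ∷ xs) k = cong (k +_) (∑-const xs k)

  ∑-zero : ∀ (xs : List A) → ∑ xs (λ _ → 0) ≡ 0
  ∑-zero xs = trans (∑-const xs 0) (ℕ.*-zeroʳ (length xs))

  ∑-swap : ∀ (xs : List A) (ys : List B) (f : A → B → ℕ) →
           ∑ xs (λ x → ∑ ys (f x)) ≡ ∑ ys (λ y → ∑ xs (λ x → f x y))
  ∑-swap []       ys f = sym (∑-zero ys)
  ∑-swap (x ∷ xs) ys f =
    trans (cong (∑ ys (f x) +_) (∑-swap xs ys f)) (sym (∑-+ ys (f x) _))

  ∑-++ : ∀ xs ys (f : A → ℕ) → ∑ (xs ++ ys) f ≡ ∑ xs f + ∑ ys f
  ∑-++ []       ys f = refl
  ∑-++ (x ∷ xs) ys f = trans (cong (f x +_) (∑-++ xs ys f)) (sym (ℕ.+-assoc (f x) _ _))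

  ∑-map : ∀ (g : A → B) xs (f : B → ℕ) → ∑ (map g xs) f ≡ ∑ xs (f ∘ g)
  ∑-map g []       f = refl
  ∑-map g (x ∷ xs) f = cong (f (g x) +_) (∑-map g xs f)

  ∑-cartesianProduct : ∀ xs ys (f : A × B → ℕ) →
    ∑ (cartesianProduct xs ys) f ≡ ∑ xs (λ x → ∑ ys (λ y → f (x , y)))
  ∑-cartesianProduct []       ys f = refl
  ∑-cartesianProduct (x ∷ xs) ys f =
    trans (∑-++ (map (x ,_) ys) _ f)
          (cong₂ _+_ (∑-map (x ,_) ys f) (∑-cartesianProduct xs ys f))

  ∑-filter : {P : Pred A _} (P? : Decidable P) → ∀ xs →
             length (filter P? xs) ≡ ∑ xs (ind ∘ P?)
  ∑-filter P? []       = refl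
  ∑-filter P? (x ∷ xs) with P? x
  ... | yes _ = cong suc (∑-filter P? xs)
  ... | no  _ = ∑-filter P? xs

  ∑-≤ : {f g : A → ℕ} → ∀ xs → (∀ x → f x ≤ g x) → ∑ xs f ≤ ∑ xs g
  ∑-≤ []       f≤g = z≤n
  ∑-≤ (x ∷ xs) f≤g = ℕ.+-mono-≤ (f≤g x) (∑-≤ xs f≤g)

  -- No term can fall strictly short, because the other terms cannot make up for it. This squeeze
  -- turns upper bounds on fibre sizes into exact sizes: for injective self-maps, for the cosets of
  -- the image of ℘, and for the images of a point with k = 0.
  ∑-≤-≡ : {f g : A → ℕ} → ∀ {xs} → (∀ x → f x ≤ g x) → ∑ xs f ≡ ∑ xs g →
          ∀ {x} → x ∈ xs → f x ≡ g x
  ∑-≤-≡ {f = f} {g} {x ∷ xs} f≤g eq (here refl) = ℕ.≤-antisym (f≤g x)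
    (ℕ.+-cancelʳ-≤ (∑ xs f) _ _
      (ℕ.≤-trans (ℕ.+-monoʳ-≤ (g x) (∑-≤ xs f≤g)) (ℕ.≤-reflexive (sym eq))))
  ∑-≤-≡ {f = f} {g} {x ∷ xs} f≤g eq (there x∈) = ∑-≤-≡ f≤g (ℕ.≤-antisym (∑-≤ xs f≤g)
    (ℕ.+-cancelˡ-≤ (f x) _ _
      (ℕ.≤-trans (ℕ.+-monoˡ-≤ (∑ xs g) (f≤g x)) (ℕ.≤-reflexive (sym eq))))) x∈

  Unique⇒lookup-injective : {xs : List A} → Unique xs → ∀ {i j} → lookup xs i ≡ lookup xs j → i ≡ j
  Unique⇒lookup-injective (x∉ ∷ u) {zero}  {zero}  eq = refl
  Unique⇒lookup-injective (x∉ ∷ u) {zero}  {suc j} eq =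
    contradiction eq (All.lookup x∉ (∈-lookup j))
  Unique⇒lookup-injective (x∉ ∷ u) {suc i} {zero}  eq =
    contradiction (sym eq) (All.lookup x∉ (∈-lookup i))
  Unique⇒lookup-injective (x∉ ∷ u) {suc i} {suc j} eq =
    cong suc (Unique⇒lookup-injective u eq)

  record Finite (A : Set) : Set where
    field
      elements : List A
      complete : ∀ a → a ∈ elements
      unique   : Unique elements
      _≟_      : DecidableEquality A

    size : ℕ
    size = length elements

    total : (A → ℕ) → ℕ
    total = ∑ elements

    count : {P : Pred A _} → Decidable P → ℕ
    count P? = total (ind ∘ P?)

    search : {P : Pred A _} → Decidable P → ∃ P ⊎ (∀ a → ¬ P a)
    search P? with any? P? elements
    ... | yes p = inj₁ (satisfied p)
    ... | no ¬p = inj₂ λ a pa → ¬p (Any.map (λ { refl → pa }) (complete a))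

    private
      ∑-∉ : ∀ a (f : A → ℕ) {xs} → All (a ≢_) xs → ∑ xs (λ x → ind (a ≟ x) * f x) ≡ 0
      ∑-∉ a f []          = refl
      ∑-∉ a f (_∷_ {x} a≢x a∉xs) =
        cong₂ _+_ (cong (_* f x) (ind-no (a ≟ x) a≢x)) (∑-∉ a f a∉xs)

      ∑-∈ : ∀ {a} (f : A → ℕ) {xs} → a ∈ xs → Unique xs → ∑ xs (λ x → ind (a ≟ x) * f x) ≡ f a
      ∑-∈ {a} f {_ ∷ xs} (here refl) (x∉ ∷ _) = begin
        ind (a ≟ a) * f a + ∑ xs (λ x → ind (a ≟ x) * f x)
          ≡⟨ cong₂ _+_ (cong (_* f a) (ind-yes (a ≟ a) refl)) (∑-∉ a f x∉) ⟩
        1 * f a + 0                ≡⟨ ℕ.+-identityʳ _ ⟩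
        1 * f a                    ≡⟨ ℕ.*-identityˡ _ ⟩
        f a                        ∎
        where open ≡-Reasoning
      ∑-∈ {a} f {x ∷ xs} (there a∈) (x∉ ∷ u) =
        cong₂ _+_ (cong (_* f x) (ind-no (a ≟ x) λ a≡x → All.lookup x∉ a∈ (sym a≡x))) (∑-∈ f a∈ u)

    total-δ : ∀ a (f : A → ℕ) → total (λ x → ind (a ≟ x) * f x) ≡ f a
    total-δ a f = ∑-∈ f (complete a) unique

    count-≡ : ∀ a → count (a ≟_) ≡ 1
    count-≡ a = trans (∑-cong elements λ x → sym (ℕ.*-identityʳ _)) (total-δ a (λ _ → 1))

    count-all : {P : Pred A _} (P? : Decidable P) → (∀ a → P a) → count P? ≡ size
    count-all P? p = trans (∑-cong elements λ x → ind-yes (P? x) (p x))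
                           (trans (∑-const elements 1) (ℕ.*-identityʳ _))

    count-none : {P : Pred A _} (P? : Decidable P) → (∀ a → ¬ P a) → count P? ≡ 0
    count-none P? ¬p = trans (∑-cong elements λ x → ind-no (P? x) (¬p x)) (∑-zero elements)

    count-cong : {P Q : Pred A _} (P? : Decidable P) (Q? : Decidable Q) →
                 (∀ a → P a → Q a) → (∀ a → Q a → P a) → count P? ≡ count Q?
    count-cong P? Q? f g = ∑-cong elements λ x → ind-cong (P? x) (Q? x) (f x) (g x)

    count≢0 : {P : Pred A _} (P? : Decidable P) → count P? ≢ 0 → ∃ P
    count≢0 P? n≢0 with search P?
    ... | inj₁ p  = p
    ... | inj₂ ¬p = contradiction (count-none P? ¬p) n≢0

    count≡0 : {P : Pred A _} (P? : Decidable P) → count P? ≡ 0 → ∀ a → ¬ P a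
    count≡0 P? n≡0 a pa = contradiction (trans (sym (ind-yes (P? a) pa)) ind≡0) λ ()
      where
      ind≡0 : ind (P? a) ≡ 0
      -- The squeeze with the zero function as the lower bound.
      ind≡0 = sym (∑-≤-≡ {f = λ _ → 0} (λ _ → z≤n) (trans (∑-zero elements) (sym n≡0)) (complete a))

    total-const : ∀ k → total (λ _ → k) ≡ size * k
    total-const = ∑-const elements

    total-≤-≡ : {f g : A → ℕ} → (∀ x → f x ≤ g x) → total f ≡ total g → ∀ x → f x ≡ g x
    total-≤-≡ f≤g eq x = ∑-≤-≡ f≤g eq (complete x)

    -- Phrased as the impossibility of four pairwise distinct elements, which is the form in which
    -- `no-four` supplies it.
    count≤3 : {P : Pred A _} (P? : Decidable P) →
              (∀ {a b c d} → P a → P b → P c → P d → a ≢ b → a ≢ c → b ≢ c → a ≢ d → b ≢ d → ¬ c ≢ d) →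
              count P? ≤ 3
    count≤3 {P} P? no4 =
      subst (_≤ 3) (∑-filter P? elements)
            (short (filter P? elements) (Unique.filter⁺ P? unique) (λ x∈ → proj₂ (∈-filter⁻ P? {xs = elements} x∈)))
      where
      short : ∀ xs → Unique xs → (∀ {x} → x ∈ xs → P x) → length xs ≤ 3
      short []                  _ _ = z≤n
      short (_ ∷ [])            _ _ = s≤s z≤n
      short (_ ∷ _ ∷ [])        _ _ = s≤s (s≤s z≤n)
      short (_ ∷ _ ∷ _ ∷ [])    _ _ = s≤s (s≤s (s≤s z≤n))
      short (a ∷ b ∷ c ∷ d ∷ _) ((a≢b ∷ a≢c ∷ a≢d ∷ _) ∷ (b≢c ∷ b≢d ∷ _) ∷ (c≢d ∷ _) ∷ _) p =
        contradiction c≢d (no4 (p (here refl)) (p (there (here refl))) (p (there (there (here refl))))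
          (p (there (there (there (here refl))))) a≢b a≢c b≢c a≢d b≢d)

  open Finite

  -- Fubini for the graph of e: each a lies in exactly one fibre.
  total-fibres : (FA : Finite A) (FB : Finite B) (e : A → B) (f : A → ℕ) →
    total FB (λ b → total FA (λ a → ind (_≟_ FB (e a) b) * f a)) ≡ total FA f
  total-fibres FA FB e f = trans (∑-swap (elements FB) (elements FA) _)
    (∑-cong (elements FA) λ a → total-δ FB (e a) (λ _ → f a))

  -- The sum is spread over the fibres of `e`; there the indicator of `e a ≡ b` is that of
  -- `e⁻¹ b ≡ a`, and it collapses in the variable a instead of b.
  total-reindex : (FA : Finite A) (FB : Finite B) (e : A → B) (e⁻¹ : B → A) →
    (∀ a → e⁻¹ (e a) ≡ a) → (∀ b → e (e⁻¹ b) ≡ b) → (f : B → ℕ) →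
    total FA (f ∘ e) ≡ total FB f
  total-reindex FA FB e e⁻¹ inv inv′ f = begin
    total FA (f ∘ e)
      ≡⟨ total-fibres FA FB e (f ∘ e) ⟨
    total FB (λ b → total FA (λ a → ind (_≟_ FB (e a) b) * f (e a)))
      ≡⟨ ∑-cong (elements FB) (λ b → ∑-cong (elements FA) (λ a → cong (_* f (e a))
           (ind-cong (_≟_ FB (e a) b) (_≟_ FA (e⁻¹ b) a)
             (λ { refl → inv a }) (λ { refl → inv′ b })))) ⟩
    total FB (λ b → total FA (λ a → ind (_≟_ FA (e⁻¹ b) a) * f (e a)))
      ≡⟨ ∑-cong (elements FB) (λ b → total-δ FA (e⁻¹ b) (f ∘ e)) ⟩
    total FB (λ b → f (e (e⁻¹ b)))
      ≡⟨ ∑-cong (elements FB) (λ b → cong f (inv′ b)) ⟩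
    total FB f ∎
    where open ≡-Reasoning

  ⊤-finite : Finite ⊤
  ⊤-finite = record
    { elements = tt ∷ []
    ; complete = λ _ → here refl
    ; unique   = [] ∷ []
    ; _≟_      = ⊤._≟_
    }

  infixr 2 _×-finite_
  infixr 1 _⊎-finite_

  _×-finite_ : Finite A → Finite B → Finite (A × B)
  FA ×-finite FB = record
    { elements = cartesianProduct (elements FA) (elements FB)
    ; complete = λ (a , b) → ∈-cartesianProduct⁺ (complete FA a) (complete FB b)
    ; unique   = Unique.cartesianProduct⁺ (unique FA) (unique FB)
    ; _≟_      = ≡-dec (_≟_ FA) (_≟_ FB)
    }

  _⊎-finite_ : Finite A → Finite B → Finite (A ⊎ B)
  FA ⊎-finite FB = record
    { elements = map inj₁ (elements FA) ++ map inj₂ (elements FB)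
    ; complete = λ { (inj₁ a) → ∈-++⁺ˡ (∈-map⁺ inj₁ (complete FA a))
                   ; (inj₂ b) → ∈-++⁺ʳ _ (∈-map⁺ inj₂ (complete FB b)) }
    ; unique   = Unique.++⁺ (Unique.map⁺ inj₁-injective (unique FA))
                            (Unique.map⁺ inj₂-injective (unique FB))
                            λ (p , q) → case (∈-map⁻ inj₁ p) (∈-map⁻ inj₂ q)
    ; _≟_      = Sum.≡-dec (_≟_ FA) (_≟_ FB)
    }
    where
    case : ∀ {c} → ∃[ a ] a ∈ elements FA × c ≡ inj₁ a → ∃[ b ] b ∈ elements FB × c ≡ inj₂ b → _
    case (_ , _ , refl) (_ , _ , ())

  total-⊎ : (FA : Finite A) (FB : Finite B) (f : A ⊎ B → ℕ) →
            total (FA ⊎-finite FB) f ≡ total FA (f ∘ inj₁) + total FB (f ∘ inj₂)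
  total-⊎ FA FB f =
    trans (∑-++ (map inj₁ (elements FA)) _ f)
          (cong₂ _+_ (∑-map inj₁ (elements FA) f) (∑-map inj₂ (elements FB) f))

  total-× : (FA : Finite A) (FB : Finite B) (f : A × B → ℕ) →
            total (FA ×-finite FB) f ≡ total FA (λ a → total FB (λ b → f (a , b)))
  total-× FA FB = ∑-cartesianProduct (elements FA) (elements FB)

  count≤1 : (FA : Finite A) {P : Pred A _} (P? : Decidable P) →
            (∀ {a b} → P a → P b → a ≡ b) → count FA P? ≤ 1
  count≤1 FA P? one with search FA P?
  ... | inj₂ ¬p = ℕ.≤-trans (ℕ.≤-reflexive (count-none FA P? ¬p)) z≤n
  ... | inj₁ (a , pa) = ℕ.≤-reflexive (trans
    (count-cong FA P? (_≟_ FA a) (λ b → one pa) (λ { _ refl → pa })) (count-≡ FA a))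

  -- Each fibre has at most one element and the fibre sizes add up to the size of A, so by the
  -- squeeze every fibre has exactly one.
  injective⇒surjective : (FA : Finite A) (e : A → A) → (∀ {x y} → e x ≡ e y → x ≡ y) →
                         ∀ b → ∃[ a ] e a ≡ b
  injective⇒surjective FA e inj b = count≢0 FA (λ a → _≟_ FA (e a) b)
    λ fibre≡0 → contradiction (trans (sym fibre≡0) fibre≡1) λ ()
    where
    fibre≡1 : count FA (λ a → _≟_ FA (e a) b) ≡ 1
    fibre≡1 = total-≤-≡ FA
      (λ b → count≤1 FA (λ a → _≟_ FA (e a) b) λ p q → inj (trans p (sym q)))
      (begin
        total FA (λ b → count FA (λ a → _≟_ FA (e a) b))
          ≡⟨ ∑-cong (elements FA) (λ b → ∑-cong (elements FA) λ a → ℕ.*-identityʳ _) ⟨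
        total FA (λ b → total FA (λ a → ind (_≟_ FA (e a) b) * 1))
          ≡⟨ total-fibres FA FA e (λ _ → 1) ⟩
        total FA (λ _ → 1) ∎)
      b
      where open ≡-Reasoning

open import Data.Nat.Base as ℕ using (ℕ; zero; suc; z≤n; s≤s)
open import Data.Nat.GCD using (gcd; GCD; gcd-GCD; module Bézout)
open import Defs
open import Relation.Binary.PropositionalEquality

module Osculating-Orbits (q n h : ℕ) (q≡2^n : q ≡ 2 ℕ.^ n) (3≤n : 3 ℕ.≤ n) (gcd≡1 : gcd n h ≡ 1) (F : FiniteField q) where

  open import Algebra.Bundles using (CommutativeRing; Semiring)
  import Algebra.Definitions.RawSemiring as RawSemiringDefs
  import Algebra.Properties.CommutativeMonoid.Sum as CommutativeMonoidSum
  import Algebra.Properties.CommutativeSemiring.Exp as CommutativeSemiringExp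
  import Algebra.Properties.Semiring.Mult as SemiringMult
  import Algebra.Properties.Semiring.Sum as SemiringSum
  import Algebra.Solver.Ring
  open import Algebra.Solver.Ring.AlmostCommutativeRing using (fromCommutativeRing; _-Raw-AlmostCommutative⟶_; Induced-equivalence)
  open import Data.Bool.Base using (Bool; true; false; if_then_else_)
  import Data.Bool.Properties as Bool
  open import Data.Empty using (⊥)
  open import Data.Fin.Base using (Fin; zero; suc; opposite)
  open import Data.Fin.Patterns using (0F; 1F; 2F; 3F; 4F)
  open import Data.Fin.Permutation using (Permutation; permutation)
  import Data.Fin.Properties as Fin
  open import Data.List.Base using (map; allFin; filter; length; lookup)
  open import Data.List.Membership.Propositional using (_∈_)
  open import Data.List.Membership.Propositional.Properties using (∈-allFin; ∈-map⁺; ∈-filter⁺; ∈-filter⁻; ∈-lookup)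
  import Data.List.Properties as List
  open import Data.List.Relation.Unary.Any using (index)
  open import Data.List.Relation.Unary.Any.Properties using (lookup-index)
  import Data.List.Relation.Unary.Unique.Propositional.Properties as Unique
  import Data.Maybe.Base as Maybe
  import Data.Nat.DivMod as ℕ
  import Data.Nat.Properties as ℕ
  open import Data.Nat.Solver using (module +-*-Solver)
  open import Data.Product.Base using (∃-syntax; _×_; _,_; proj₁; proj₂)
  open import Data.Sum.Base using (_⊎_; inj₁; inj₂)
  open import Data.Unit.Base using (⊤; tt)
  open import Data.Vec.Functional using (Vector; []; _∷_; replicate; removeAt)
  open import Function.Base using (_∘_)
  open import Function.Bundles using (Bijection; Inverse; _⇔_; mk⇔; Equivalence)
  open import Level using (0ℓ)
  open import Relation.Binary.Bundles using (Setoid)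
  open import Relation.Binary.Consequences using (dec⇒weaklyDec)
  open import Relation.Binary.Definitions using (DecidableEquality; WeaklyDecidable)
  open import Relation.Nullary using (¬_; Dec; yes; no; does; contradiction)
  open import Relation.Nullary.Decidable using (¬?; map′; _×-dec_; dec-true; dec-false)
  open import Relation.Unary using (Pred; Decidable; _≐_)
  open Counting
  open Finite
  open FiniteField F using (Carrier; enumeration; #⇒invertible; invertible⇒#)
  open PG3 F

  -- Finite fields of characteristic two

  R : CommutativeRing 0ℓ 0ℓ
  R = FiniteField.commutativeRing F
  open CommutativeRing R using
    ( _+_; _*_; -_; 0#; 1#; semiring; commutativeSemiring; +-commutativeMonoid; *-commutativeMonoid
    ; *-identityˡ; *-identityʳ; *-assoc; *-comm; zeroˡ; zeroʳ; distribˡ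
    ; +-identityˡ; +-identityʳ; +-assoc; +-comm; -‿inverseʳ; -‿inverseˡ)
  open RawSemiringDefs (Semiring.rawSemiring semiring) using (_^_)
  open SemiringMult semiring using (×1-homo-*) renaming (_×_ to _·ℕ_)
  module Exp = CommutativeSemiringExp commutativeSemiring
  module Σ+ = CommutativeMonoidSum +-commutativeMonoid
  module Π* = CommutativeMonoidSum *-commutativeMonoid

  open Inverse enumeration using () renaming (to to elt; from to rank; strictlyInverseˡ to elt-rank; strictlyInverseʳ to rank-elt)

  abstract
    _≟ᶠ_ : DecidableEquality Carrier
    x ≟ᶠ y = map′ (λ eq → trans (sym (elt-rank x)) (trans (cong elt eq) (elt-rank y))) (cong rank)
                  (rank x Fin.≟ rank y)

  field-finite : Finite Carrier
  field-finite = record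
    { elements = map elt (allFin q)
    ; complete = λ x → subst (_∈ map elt (allFin q)) (elt-rank x) (∈-map⁺ elt (∈-allFin (rank x)))
    ; unique   = Unique.map⁺ (λ {i} {j} eq → trans (sym (rank-elt i)) (trans (cong rank eq) (rank-elt j)))
                             (Unique.allFin⁺ q)
    ; _≟_      = _≟ᶠ_
    }

  field-size : size field-finite ≡ q
  field-size = trans (List.length-map elt (allFin q)) (List.length-tabulate {n = q} (λ i → i))

  ∑F : (Carrier → ℕ) → ℕ
  ∑F = total field-finite

  ∑F-cong : ∀ {f g} → (∀ x → f x ≡ g x) → ∑F f ≡ ∑F g
  ∑F-cong = ∑-cong (elements field-finite)

  ∑F-const : ∀ m → ∑F (λ _ → m) ≡ q ℕ.* m
  ∑F-const m = trans (total-const field-finite m) (cong (ℕ._* m) field-size)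

  ∑F-+ : ∀ f g → ∑F (λ x → f x ℕ.+ g x) ≡ ∑F f ℕ.+ ∑F g
  ∑F-+ = ∑-+ (elements field-finite)

  ∑F-* : ∀ m f → ∑F (λ x → m ℕ.* f x) ≡ m ℕ.* ∑F f
  ∑F-* = ∑-*ˡ (elements field-finite)

  private
    x-0≡x : ∀ x → x + - 0# ≡ x
    x-0≡x x = trans (cong (x +_) (trans (sym (+-identityˡ (- 0#))) (-‿inverseʳ 0#))) (+-identityʳ x)

  1≢0 : 1# ≢ 0#
  1≢0 = invertible⇒# (1# , trans (*-identityˡ _) (x-0≡x 1#) , trans (*-identityʳ _) (x-0≡x 1#))

  infix 9 _⁻¹

  abstract
    -- Total, with the default 0 at 0: the map x ↦ σ x · x⁻¹ in `σ-eigen` is then an injective map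
    -- from all of F to itself.
    _⁻¹ : Carrier → Carrier
    x ⁻¹ with x ≟ᶠ 0#
    ... | yes _  = 0#
    ... | no x≢0 = proj₁ (#⇒invertible x≢0)

    ⁻¹-inverseˡ : ∀ {x} → x ≢ 0# → x ⁻¹ * x ≡ 1#
    ⁻¹-inverseˡ {x} x≢0 with x ≟ᶠ 0#
    ... | yes x≡0 = contradiction x≡0 x≢0
    ... | no x≢0′ = trans (cong (proj₁ (#⇒invertible x≢0′) *_) (sym (x-0≡x x))) (proj₁ (proj₂ (#⇒invertible x≢0′)))

    0⁻¹≡0 : 0# ⁻¹ ≡ 0#
    0⁻¹≡0 with 0# ≟ᶠ 0#
    ... | yes _  = refl
    ... | no 0≢0 = contradiction refl 0≢0

  ⁻¹-inverseʳ : ∀ {x} → x ≢ 0# → x * x ⁻¹ ≡ 1#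
  ⁻¹-inverseʳ x≢0 = trans (*-comm _ _) (⁻¹-inverseˡ x≢0)

  *-cancelˡ : ∀ {x y z} → x ≢ 0# → x * y ≡ x * z → y ≡ z
  *-cancelˡ {x} {y} {z} x≢0 eq = begin
    y                ≡⟨ *-identityˡ y ⟨
    1# * y           ≡⟨ cong (_* y) (⁻¹-inverseˡ x≢0) ⟨
    x ⁻¹ * x * y     ≡⟨ *-assoc _ x y ⟩
    x ⁻¹ * (x * y)   ≡⟨ cong (x ⁻¹ *_) eq ⟩
    x ⁻¹ * (x * z)   ≡⟨ *-assoc _ x z ⟨
    x ⁻¹ * x * z     ≡⟨ cong (_* z) (⁻¹-inverseˡ x≢0) ⟩
    1# * z           ≡⟨ *-identityˡ z ⟩
    z                ∎
    where open ≡-Reasoning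

  *-≢0 : ∀ {x y} → x ≢ 0# → y ≢ 0# → x * y ≢ 0#
  *-≢0 {x} x≢0 y≢0 xy≡0 = y≢0 (*-cancelˡ x≢0 (trans xy≡0 (sym (zeroʳ x))))

  *-≡0 : ∀ {x y} → x * y ≡ 0# → x ≡ 0# ⊎ y ≡ 0#
  *-≡0 {x} {y} xy≡0 with x ≟ᶠ 0#
  ... | yes x≡0 = inj₁ x≡0
  ... | no x≢0  = inj₂ (*-cancelˡ x≢0 (trans xy≡0 (sym (zeroʳ x))))

  ≡0-stable : ∀ {x} → ¬ (x ≢ 0#) → x ≡ 0#
  ≡0-stable {x} ¬x≢0 with x ≟ᶠ 0#
  ... | yes x≡0 = x≡0
  ... | no x≢0  = contradiction x≢0 ¬x≢0

  *-≡0ʳ : ∀ {x y} → x ≢ 0# → x * y ≡ 0# → y ≡ 0#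
  *-≡0ʳ {x} x≢0 xy≡0 = *-cancelˡ x≢0 (trans xy≡0 (sym (zeroʳ x)))

  ⁻¹-≢0 : ∀ {x} → x ≢ 0# → x ⁻¹ ≢ 0#
  ⁻¹-≢0 {x} x≢0 eq = 1≢0 (trans (sym (⁻¹-inverseˡ x≢0)) (trans (cong (_* x) eq) (zeroˡ x)))

  -- The multiple 2^k · 1 is the k-th power of 1 + 1, and there are no zero divisors.
  2^k·1≢0 : ∀ k → 1# + 1# ≢ 0# → (2 ℕ.^ k) ·ℕ 1# ≢ 0#
  2^k·1≢0 zero    _ eq = 1≢0 (trans (sym (+-identityʳ 1#)) eq)
  2^k·1≢0 (suc k) 2≢0 eq = *-≢0 (λ e → 2≢0 (trans (cong (1# +_) (sym (+-identityʳ 1#))) e)) (2^k·1≢0 k 2≢0)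
    (trans (sym (×1-homo-* 2 (2 ℕ.^ k))) eq)

  bijection : (f g : Carrier → Carrier) → (∀ x → f (g x) ≡ x) → (∀ x → g (f x) ≡ x) → Permutation q q
  bijection f g fg gf = permutation (rank ∘ f ∘ elt) (rank ∘ g ∘ elt)
    (λ i → trans (cong (rank ∘ f) (elt-rank _)) (trans (cong rank (fg _)) (rank-elt i)))
    (λ i → trans (cong (rank ∘ g) (elt-rank _)) (trans (cong rank (gf _)) (rank-elt i)))

  -- Translation by 1 permutes F, so q · 1 = 0, where q is a power of 2.
  1+1≡0 : 1# + 1# ≡ 0#
  1+1≡0 with (1# + 1#) ≟ᶠ 0#
  ... | yes eq = eq
  ... | no 2≢0 = contradiction q1≡0 (subst (λ m → m ·ℕ 1# ≢ 0#) (sym q≡2^n) (2^k·1≢0 n 2≢0))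
    where
    open ≡-Reasoning
    +1 = bijection (_+ 1#) (_+ - 1#)
      (λ x → trans (+-assoc x _ _) (trans (cong (x +_) (-‿inverseˡ 1#)) (+-identityʳ x)))
      (λ x → trans (+-assoc x _ _) (trans (cong (x +_) (-‿inverseʳ 1#)) (+-identityʳ x)))
    S = Σ+.sum elt
    S≡S+q1 : S ≡ S + q ·ℕ 1#
    S≡S+q1 = begin
      S                                            ≡⟨ Σ+.sum-permute elt +1 ⟩
      Σ+.sum (λ i → elt (rank (elt i + 1#)))       ≡⟨ Σ+.sum-cong-≗ {q} (λ i → elt-rank _) ⟩
      Σ+.sum (λ i → elt i + 1#)                    ≡⟨ Σ+.∑-distrib-+ elt (λ _ → 1#) ⟩
      S + Σ+.sum (replicate q 1#)                  ≡⟨ cong (S +_) (Σ+.sum-replicate q) ⟩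
      S + q ·ℕ 1#                                  ∎
    q1≡0 : q ·ℕ 1# ≡ 0#
    q1≡0 = begin
      q ·ℕ 1#                  ≡⟨ +-identityˡ _ ⟨
      0# + q ·ℕ 1#             ≡⟨ cong (_+ q ·ℕ 1#) (-‿inverseˡ S) ⟨
      (- S + S) + q ·ℕ 1#      ≡⟨ +-assoc (- S) S _ ⟩
      - S + (S + q ·ℕ 1#)      ≡⟨ cong (- S +_) S≡S+q1 ⟨
      - S + S                  ≡⟨ -‿inverseˡ S ⟩
      0#                       ∎

  x+x≡0 : ∀ x → x + x ≡ 0#
  x+x≡0 x = begin
    x + x                ≡⟨ cong₂ _+_ (*-identityʳ x) (*-identityʳ x) ⟨
    x * 1# + x * 1#      ≡⟨ distribˡ x 1# 1# ⟨
    x * (1# + 1#)        ≡⟨ cong (x *_) 1+1≡0 ⟩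
    x * 0#               ≡⟨ zeroʳ x ⟩
    0#                   ∎
    where open ≡-Reasoning

  -x≡x : ∀ x → - x ≡ x
  -x≡x x = begin
    - x              ≡⟨ +-identityʳ _ ⟨
    - x + 0#         ≡⟨ cong (- x +_) (x+x≡0 x) ⟨
    - x + (x + x)    ≡⟨ +-assoc _ x x ⟨
    - x + x + x      ≡⟨ cong (_+ x) (-‿inverseˡ x) ⟩
    0# + x           ≡⟨ +-identityˡ x ⟩
    x                ∎
    where open ≡-Reasoning

  -- Coefficients in 𝔽₂, so that the solver knows that the characteristic is 2.
  ⟦_⟧₂ : Bool → Carrier
  ⟦ b ⟧₂ = if b then 1# else 0#

  𝔽₂-morphism : CommutativeRing.rawRing Bool.xor-∧-commutativeRing -Raw-AlmostCommutative⟶ fromCommutativeRing R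
  𝔽₂-morphism = record
    { ⟦_⟧    = ⟦_⟧₂
    ; +-homo = λ { true true → sym 1+1≡0 ; true false → sym (+-identityʳ _)
                 ; false true → sym (+-identityˡ _) ; false false → sym (+-identityˡ _) }
    ; *-homo = λ { true true → sym (*-identityˡ _) ; true false → sym (zeroʳ _)
                 ; false true → sym (zeroˡ _) ; false false → sym (zeroˡ _) }
    ; -‿homo = λ { true → sym (-x≡x _) ; false → sym (-x≡x _) }
    ; 0-homo = refl
    ; 1-homo = refl
    }

  𝔽₂-≟ : WeaklyDecidable (Induced-equivalence 𝔽₂-morphism)
  𝔽₂-≟ a b = Maybe.map (cong ⟦_⟧₂) (dec⇒weaklyDec Bool._≟_ a b)

  module CharTwoSolver = Algebra.Solver.Ring
    (CommutativeRing.rawRing Bool.xor-∧-commutativeRing) (fromCommutativeRing R) 𝔽₂-morphism 𝔽₂-≟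
  open CharTwoSolver using (_:=_; _:+_; _:*_; con) renaming (solve to solve₂)

  +-≡0⇒≡ : ∀ {x y} → x + y ≡ 0# → x ≡ y
  +-≡0⇒≡ {x} {y} eq = begin
    x            ≡⟨ solve₂ 2 (λ x y → x := (x :+ y) :+ y) refl x y ⟩
    x + y + y    ≡⟨ cong (_+ y) eq ⟩
    0# + y       ≡⟨ +-identityˡ y ⟩
    y            ∎
    where open ≡-Reasoning

  ≡⇒+-≡0 : ∀ {x y} → x ≡ y → x + y ≡ 0#
  ≡⇒+-≡0 refl = x+x≡0 _

  frob : ℕ → Carrier → Carrier
  frob k x = x ^ (2 ℕ.^ k)

  -- Squaring is additive in characteristic two; `frob k` iterates it.
  frob-+ : ∀ k x y → frob k (x + y) ≡ frob k x + frob k y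
  frob-+ zero    x y = solve₂ 2 (λ x y → (x :+ y) :* con true := x :* con true :+ y :* con true) refl x y
  frob-+ (suc k) x y = begin
    (x + y) ^ (2 ℕ.* 2 ℕ.^ k)             ≡⟨ Exp.^-assocʳ (x + y) 2 (2 ℕ.^ k) ⟨
    frob k ((x + y) ^ 2)                   ≡⟨ cong (frob k) (solve₂ 2 (λ x y →
      (x :+ y) :* ((x :+ y) :* con true) := x :* (x :* con true) :+ y :* (y :* con true)) refl x y) ⟩
    frob k (x ^ 2 + y ^ 2)                 ≡⟨ frob-+ k (x ^ 2) (y ^ 2) ⟩
    frob k (x ^ 2) + frob k (y ^ 2)        ≡⟨ cong₂ _+_ (Exp.^-assocʳ x 2 (2 ℕ.^ k)) (Exp.^-assocʳ y 2 (2 ℕ.^ k)) ⟩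
    frob (suc k) x + frob (suc k) y        ∎
    where open ≡-Reasoning

  frob-∘ : ∀ j k x → frob (j ℕ.+ k) x ≡ frob k (frob j x)
  frob-∘ j k x = trans (cong (x ^_) (ℕ.^-distribˡ-+-* 2 j k)) (sym (Exp.^-assocʳ x (2 ℕ.^ j) (2 ℕ.^ k)))

  frob-fixed : ∀ k {x} → frob k x ≡ x → ∀ m → frob (m ℕ.* k) x ≡ x
  frob-fixed k fix zero    = *-identityʳ _
  frob-fixed k fix (suc m) = trans (frob-∘ k (m ℕ.* k) _) (trans (cong (frob (m ℕ.* k)) fix) (frob-fixed k fix m))

  infix 8 _if-zero_else_

  -- Gives the factor at 0 a separate value, so that a product over the nonzero elements can be
  -- taken over the whole enumeration of F.
  _if-zero_else_ : Carrier → Carrier → Carrier → Carrier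
  x if-zero z else y = if does (z ≟ᶠ 0#) then x else y

  if-zero : ∀ {z} x y → z ≡ 0# → x if-zero z else y ≡ x
  if-zero {z} x y z≡0 with z ≟ᶠ 0#
  ... | yes _  = refl
  ... | no z≢0 = contradiction z≡0 z≢0

  if-nonzero : ∀ {z} x y → z ≢ 0# → x if-zero z else y ≡ y
  if-nonzero {z} x y z≢0 with z ≟ᶠ 0#
  ... | yes z≡0 = contradiction z≡0 z≢0
  ... | no _    = refl

  product-δ : ∀ {m} (i₀ : Fin m) (f : Fin m → Carrier) → (∀ i → i ≢ i₀ → f i ≡ 1#) → Π*.sum f ≡ f i₀
  product-δ {suc m} i₀ f others = begin
    Π*.sum f                               ≡⟨ Π*.sum-remove {i = i₀} f ⟩
    f i₀ * Π*.sum (removeAt f i₀)          ≡⟨ cong (f i₀ *_) (Π*.sum-cong-≗ {m} λ j → others _ (Fin.punchInᵢ≢i i₀ j)) ⟩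
    f i₀ * Π*.sum (replicate m 1#)         ≡⟨ cong (f i₀ *_) (Π*.sum-replicate-zero m) ⟩
    f i₀ * 1#                              ≡⟨ *-identityʳ _ ⟩
    f i₀                                   ∎
    where open ≡-Reasoning

  product-≢0 : ∀ {m} (f : Fin m → Carrier) → (∀ i → f i ≢ 0#) → Π*.sum f ≢ 0#
  product-≢0 {zero}  f f≢0 = 1≢0
  product-≢0 {suc m} f f≢0 = *-≢0 (f≢0 zero) (product-≢0 (f ∘ suc) (f≢0 ∘ suc))

  -- Multiplication by a permutes F, so the product W of the nonzero elements
  -- satisfies W = a^(q-1) W.
  x^q≡x : ∀ x → x ^ q ≡ x
  x^q≡x a with a ≟ᶠ 0#
  ... | yes a≡0 = trans (0^q (rank 0#)) (sym a≡0)
    where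
    0^q : ∀ {m} → Fin m → a ^ m ≡ 0#
    0^q {suc m} _ = trans (cong (_* a ^ m) a≡0) (zeroˡ _)
  ... | no a≢0 = begin
    a ^ q                          ≡⟨ Π*.sum-replicate q ⟨
    Π*.sum (replicate q a)         ≡⟨ Π*.sum-cong-≗ {q} (λ i → split (elt i)) ⟨
    -- The factor at the index of 0 is split off: the first product is `a`, the second is a^(q-1).
    Π*.sum (λ i → a if-zero elt i else 1# * 1# if-zero elt i else a)
                                   ≡⟨ Π*.∑-distrib-+ (λ i → a if-zero elt i else 1#) _ ⟩
    Π*.sum (λ i → a if-zero elt i else 1#) * Π*.sum (λ i → 1# if-zero elt i else a)
                                   ≡⟨ cong₂ _*_ product-a product-1 ⟩
    a * 1#                         ≡⟨ *-identityʳ a ⟩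
    a                              ∎
    where
    open ≡-Reasoning
    split : ∀ z → a if-zero z else 1# * 1# if-zero z else a ≡ a
    split z with z ≟ᶠ 0#
    ... | yes _ = *-identityʳ a
    ... | no  _ = *-identityˡ a
    product-a : Π*.sum (λ i → a if-zero elt i else 1#) ≡ a
    product-a = trans
      (product-δ (rank 0#) _ λ i i≢ → if-nonzero a 1# λ eq → i≢ (trans (sym (rank-elt i)) (cong rank eq)))
      (if-zero a 1# (elt-rank 0#))
    a· = bijection (a *_) (a ⁻¹ *_)
      (λ x → trans (sym (*-assoc a _ x)) (trans (cong (_* x) (⁻¹-inverseʳ a≢0)) (*-identityˡ x)))
      (λ x → trans (sym (*-assoc _ a x)) (trans (cong (_* x) (⁻¹-inverseˡ a≢0)) (*-identityˡ x)))
    -- Replacing 0 by 1 makes the product `W` over all of F the product of its nonzero elements.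
    unit : Carrier → Carrier
    unit x = 1# if-zero x else x
    unit-≢0 : ∀ x → unit x ≢ 0#
    unit-≢0 x eq with x ≟ᶠ 0#
    ... | yes _  = 1≢0 eq
    ... | no x≢0 = x≢0 eq
    unit-a· : ∀ x → unit (a * x) ≡ 1# if-zero x else a * unit x
    unit-a· x with x ≟ᶠ 0#
    ... | yes x≡0 = trans (if-zero 1# (a * x) (trans (cong (a *_) x≡0) (zeroʳ a))) (sym (*-identityˡ 1#))
    ... | no x≢0  = if-nonzero 1# (a * x) (*-≢0 a≢0 x≢0)
    W = Π*.sum (unit ∘ elt)
    product-1 : Π*.sum (λ i → 1# if-zero elt i else a) ≡ 1#
    product-1 = *-cancelˡ (product-≢0 (unit ∘ elt) (unit-≢0 ∘ elt)) (begin
      W * Π*.sum (λ i → 1# if-zero elt i else a)          ≡⟨ *-comm W _ ⟩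
      Π*.sum (λ i → 1# if-zero elt i else a) * W          ≡⟨ Π*.∑-distrib-+ (λ i → 1# if-zero elt i else a) (unit ∘ elt) ⟨
      Π*.sum (λ i → 1# if-zero elt i else a * unit (elt i)) ≡⟨ Π*.sum-cong-≗ {q} (λ i → unit-a· (elt i)) ⟨
      Π*.sum (λ i → unit (a * elt i))                     ≡⟨ Π*.sum-cong-≗ {q} (λ i → cong unit (elt-rank _)) ⟨
      Π*.sum (λ i → unit (elt (rank (a * elt i))))        ≡⟨ Π*.sum-permute (unit ∘ elt) a· ⟨
      W                                                   ≡⟨ *-identityʳ W ⟨
      W * 1#                                              ∎)

  -- The automorphism σ

  8≤q : 8 ℕ.≤ q
  8≤q = subst (8 ℕ.≤_) (sym q≡2^n) (ℕ.^-monoʳ-≤ 2 3≤n)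

  abstract
    σ : Carrier → Carrier
    σ = frob h

    σ-def : ∀ x → σ x ≡ frob h x
    σ-def x = refl

    σ-+ : ∀ x y → σ (x + y) ≡ σ x + σ y
    σ-+ = frob-+ h

    σ-* : ∀ x y → σ (x * y) ≡ σ x * σ y
    σ-* x y = Exp.^-distrib-* x y (2 ℕ.^ h)

    σ-1 : σ 1# ≡ 1#
    σ-1 = 1^ (2 ℕ.^ h)
      where
      1^ : ∀ m → 1# ^ m ≡ 1#
      1^ zero    = refl
      1^ (suc m) = trans (*-identityˡ _) (1^ m)

  σ-0 : σ 0# ≡ 0#
  σ-0 = begin
    σ 0#             ≡⟨ cong σ (x+x≡0 0#) ⟨
    σ (0# + 0#)      ≡⟨ σ-+ 0# 0# ⟩
    σ 0# + σ 0#      ≡⟨ x+x≡0 (σ 0#) ⟩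
    0#               ∎
    where open ≡-Reasoning

  σ-≢0 : ∀ {x} → x ≢ 0# → σ x ≢ 0#
  σ-≢0 {x} x≢0 σx≡0 = 1≢0 (begin
    1#                  ≡⟨ σ-1 ⟨
    σ 1#                ≡⟨ cong σ (⁻¹-inverseˡ x≢0) ⟨
    σ (x ⁻¹ * x)        ≡⟨ σ-* (x ⁻¹) x ⟩
    σ (x ⁻¹) * σ x      ≡⟨ cong (σ (x ⁻¹) *_) σx≡0 ⟩
    σ (x ⁻¹) * 0#       ≡⟨ zeroʳ _ ⟩
    0#                  ∎)
    where open ≡-Reasoning

  σ-≡0 : ∀ {x} → σ x ≡ 0# → x ≡ 0#
  σ-≡0 {x} σx≡0 with x ≟ᶠ 0#
  ... | yes x≡0 = x≡0
  ... | no x≢0  = contradiction σx≡0 (σ-≢0 x≢0)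

  σ-injective : ∀ {x y} → σ x ≡ σ y → x ≡ y
  σ-injective {x} {y} eq = +-≡0⇒≡ (σ-≡0 (trans (σ-+ x y) (≡⇒+-≡0 eq)))

  σ-surjective : ∀ y → ∃[ x ] σ x ≡ y
  σ-surjective = injective⇒surjective field-finite σ σ-injective

  -- The fixed field of σ is 𝔽₂: by Bézout, an element fixed by the h-th and the
  -- n-th power of the Frobenius map is fixed by the Frobenius map.
  σ-fixed : ∀ {x} → σ x ≡ x → x ≡ 0# ⊎ x ≡ 1#
  σ-fixed {x} σx≡x with *-≡0 {x} {x + 1#} (trans (solve₂ 1 (λ x → x :* (x :+ con true) := x :* (x :* con true) :+ x) refl x) (≡⇒+-≡0 frob1))
    where
    frobn : frob n x ≡ x
    frobn = trans (cong (x ^_) (sym q≡2^n)) (x^q≡x x)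
    frobh : frob h x ≡ x
    frobh = trans (sym (σ-def x)) σx≡x
    -- Bézout yields a multiple of h and a multiple of n that are consecutive integers; both powers
    -- of Frobenius fix x.
    step : ∀ k → frob k x ≡ x → frob (1 ℕ.+ k) x ≡ x → frob 1 x ≡ x
    step k fk f1k = begin
      frob 1 x               ≡⟨ cong (frob 1) fk ⟨
      frob 1 (frob k x)      ≡⟨ frob-∘ k 1 x ⟨
      frob (k ℕ.+ 1) x       ≡⟨ cong (λ m → frob m x) (ℕ.+-comm k 1) ⟩
      frob (1 ℕ.+ k) x       ≡⟨ f1k ⟩
      x                      ∎
      where open ≡-Reasoning
    frob1 : frob 1 x ≡ x
    frob1 with Bézout.identity (subst (λ d → GCD n h d) gcd≡1 (gcd-GCD n h))
    ... | Bézout.+- a b eq = step (b ℕ.* h) (frob-fixed h frobh b) (trans (cong (λ m → frob m x) eq) (frob-fixed n frobn a))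
    ... | Bézout.-+ a b eq = step (a ℕ.* n) (frob-fixed n frobn a) (trans (cong (λ m → frob m x) eq) (frob-fixed h frobh b))
  ... | inj₁ x≡0   = inj₁ x≡0
  ... | inj₂ x+1≡0 = inj₂ (+-≡0⇒≡ x+1≡0)

  -- The quotient x / y is fixed by σ and nonzero, hence 1.
  σ-proportional : ∀ {x y} → x ≢ 0# → y ≢ 0# → σ x * y ≡ σ y * x → x ≡ y
  σ-proportional {x} {y} x≢0 y≢0 eq = quotient-1 (σ-fixed σw≡w)
    where
    open ≡-Reasoning
    w = x * y ⁻¹
    wy≡x : w * y ≡ x
    wy≡x = trans (*-assoc x _ y) (trans (cong (x *_) (⁻¹-inverseˡ y≢0)) (*-identityʳ x))
    σw≡w : σ w ≡ w
    σw≡w = *-cancelˡ (*-≢0 y≢0 (σ-≢0 y≢0)) (begin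
      y * σ y * σ w        ≡⟨ solve₂ 3 (λ y s t → y :* s :* t := t :* s :* y) refl y (σ y) (σ w) ⟩
      σ w * σ y * y        ≡⟨ cong (_* y) (trans (sym (σ-* w y)) (cong σ wy≡x)) ⟩
      σ x * y              ≡⟨ eq ⟩
      σ y * x              ≡⟨ cong (σ y *_) wy≡x ⟨
      σ y * (w * y)        ≡⟨ solve₂ 3 (λ s w y → s :* (w :* y) := y :* s :* w) refl (σ y) w y ⟩
      y * σ y * w          ∎)
    quotient-1 : w ≡ 0# ⊎ w ≡ 1# → x ≡ y
    quotient-1 (inj₁ w≡0) = contradiction w≡0 (*-≢0 x≢0 (⁻¹-≢0 y≢0))
    quotient-1 (inj₂ w≡1) = trans (sym wy≡x) (trans (cong (_* y) w≡1) (*-identityˡ y))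

  -- Since σ has no nontrivial fixed points, v ↦ σ v / v is injective.
  σ-eigen : ∀ c → c ≢ 0# → ∃[ v ] v ≢ 0# × σ v ≡ c * v
  σ-eigen c c≢0 with injective⇒surjective field-finite ratio ratio-injective c
    where
    ratio : Carrier → Carrier
    ratio x = σ x * x ⁻¹
    ratio-0 : ∀ {x} → x ≡ 0# → ratio x ≡ 0#
    ratio-0 {x} refl = trans (cong (σ 0# *_) 0⁻¹≡0) (zeroʳ _)
    ratio-≢0 : ∀ {x} → x ≢ 0# → ratio x ≢ 0#
    ratio-≢0 x≢0 = *-≢0 (σ-≢0 x≢0) (⁻¹-≢0 x≢0)
    ratio-* : ∀ {x} → x ≢ 0# → ratio x * x ≡ σ x
    ratio-* {x} x≢0 = trans (*-assoc (σ x) _ x) (trans (cong (σ x *_) (⁻¹-inverseˡ x≢0)) (*-identityʳ _))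
    ratio-injective : ∀ {x y} → ratio x ≡ ratio y → x ≡ y
    ratio-injective {x} {y} eq with x ≟ᶠ 0# | y ≟ᶠ 0#
    ... | yes x≡0 | yes y≡0 = trans x≡0 (sym y≡0)
    ... | yes x≡0 | no y≢0  = contradiction (trans (sym eq) (ratio-0 x≡0)) (ratio-≢0 y≢0)
    ... | no x≢0  | yes y≡0 = contradiction (trans eq (ratio-0 y≡0)) (ratio-≢0 x≢0)
    ... | no x≢0  | no y≢0  = σ-proportional x≢0 y≢0 (begin
      σ x * y                ≡⟨ cong (_* y) (ratio-* x≢0) ⟨
      ratio x * x * y        ≡⟨ cong (λ r → r * x * y) eq ⟩
      ratio y * x * y        ≡⟨ solve₂ 3 (λ r x y → r :* x :* y := r :* y :* x) refl (ratio y) x y ⟩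
      ratio y * y * x        ≡⟨ cong (_* x) (ratio-* y≢0) ⟩
      σ y * x                ∎)
      where open ≡-Reasoning
  ... | v , ratio≡c = v , v≢0 , σv≡cv
    where
    v≢0 : v ≢ 0#
    v≢0 refl = c≢0 (trans (sym ratio≡c) (trans (cong (σ 0# *_) 0⁻¹≡0) (zeroʳ _)))
    σv≡cv : σ v ≡ c * v
    σv≡cv = sym (trans (cong (_* v) (sym ratio≡c))
      (trans (*-assoc (σ v) _ v) (trans (cong (σ v *_) (⁻¹-inverseˡ v≢0)) (*-identityʳ _))))

  -- The Artin-Schreier map of σ: additive, with the fixed field of σ as kernel.
  ℘ : Carrier → Carrier
  ℘ t = σ t + t

  ℘-+ : ∀ x y → ℘ (x + y) ≡ ℘ x + ℘ y
  ℘-+ x y = trans (cong (_+ (x + y)) (σ-+ x y))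
    (solve₂ 4 (λ a b x y → (a :+ b) :+ (x :+ y) := (a :+ x) :+ (b :+ y)) refl (σ x) (σ y) x y)

  ℘-fibre : Carrier → ℕ
  ℘-fibre c = count field-finite (λ t → ℘ t ≟ᶠ c)

  ℘-fibre-0 : ∀ {c} → ¬ (∃[ t ] ℘ t ≡ c) → ℘-fibre c ≡ 0
  ℘-fibre-0 {c} c∉ = count-none field-finite (λ t → ℘ t ≟ᶠ c) λ t eq → c∉ (t , eq)

  -- The fibre through t is the coset of t modulo the kernel, that is t and t + 1.
  ℘-fibre-2 : ∀ t → ℘-fibre (℘ t) ≡ 2
  ℘-fibre-2 t = begin
    ∑F (λ s → ind (℘ s ≟ᶠ ℘ t))
      ≡⟨ ∑F-cong two ⟩
    ∑F (λ s → ind (t ≟ᶠ s) ℕ.+ ind ((t + 1#) ≟ᶠ s))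
      ≡⟨ ∑F-+ _ _ ⟩
    count field-finite (t ≟ᶠ_) ℕ.+ count field-finite ((t + 1#) ≟ᶠ_)
      ≡⟨ cong₂ ℕ._+_ (count-≡ field-finite t) (count-≡ field-finite (t + 1#)) ⟩
    2 ∎
    where
    open ≡-Reasoning
    t≢t+1 : t ≢ t + 1#
    t≢t+1 eq = 1≢0 (trans (solve₂ 1 (λ t → con true := t :+ (t :+ con true)) refl t) (≡⇒+-≡0 eq))
    two : ∀ s → ind (℘ s ≟ᶠ ℘ t) ≡ ind (t ≟ᶠ s) ℕ.+ ind ((t + 1#) ≟ᶠ s)
    two s with t ≟ᶠ s
    ... | yes refl = trans (ind-yes (℘ t ≟ᶠ ℘ t) refl) (cong suc (sym (ind-no ((t + 1#) ≟ᶠ t) (t≢t+1 ∘ sym))))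
    ... | no t≢s   = ind-cong (℘ s ≟ᶠ ℘ t) ((t + 1#) ≟ᶠ s) to
                       (λ { refl → trans (℘-+ t 1#) (trans (cong (℘ t +_) (≡⇒+-≡0 σ-1)) (+-identityʳ _)) })
      where
      to : ℘ s ≡ ℘ t → t + 1# ≡ s
      to eq with σ-fixed {s + t} (+-≡0⇒≡ (trans (℘-+ s t) (≡⇒+-≡0 eq)))
      ... | inj₁ s+t≡0 = contradiction (sym (+-≡0⇒≡ s+t≡0)) t≢s
      ... | inj₂ s+t≡1 = trans (cong (t +_) (sym s+t≡1)) (solve₂ 2 (λ s t → t :+ (s :+ t) := s) refl s t)

  total-℘-fibre : ∑F ℘-fibre ≡ q
  total-℘-fibre = begin
    ∑F ℘-fibre
      ≡⟨ ∑F-cong (λ c → ∑F-cong (λ t → ℕ.*-identityʳ _)) ⟨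
    ∑F (λ c → ∑F (λ t → ind (℘ t ≟ᶠ c) ℕ.* 1))
      ≡⟨ total-fibres field-finite field-finite ℘ (λ _ → 1) ⟩
    ∑F (λ _ → 1)
      ≡⟨ trans (total-const field-finite 1) (trans (ℕ.*-identityʳ _) field-size) ⟩
    q ∎
    where open ≡-Reasoning

  2*q≢q : 2 ℕ.* q ≢ q
  2*q≢q 2q≡q = contradiction (subst (8 ℕ.≤_) q≡0 8≤q) λ ()
    where
    q≡0 : q ≡ 0
    q≡0 = ℕ.+-cancelˡ-≡ q q 0 (trans (cong (q ℕ.+_) (sym (ℕ.+-identityʳ q))) (trans 2q≡q (sym (ℕ.+-identityʳ q))))

  in-℘-image? : Decidable (λ c → ∃[ t ] ℘ t ≡ c)
  in-℘-image? c with search field-finite (λ t → ℘ t ≟ᶠ c)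
  ... | inj₁ found = yes found
  ... | inj₂ none  = no λ (t , eq) → none t eq

  -- If ℘ were onto, all q of its fibres would have two elements, although together they only
  -- contain q.
  outside-℘ : ∃[ c ] ¬ (∃[ t ] ℘ t ≡ c)
  outside-℘ with search field-finite (λ c → ¬? (in-℘-image? c))
  ... | inj₁ found = found
  ... | inj₂ none  = contradiction
    (trans (sym (trans (total-const field-finite 2) (trans (cong (ℕ._* 2) field-size) (ℕ.*-comm q 2))))
      (trans (∑F-cong fibre) total-℘-fibre)) 2*q≢q
    where
    fibre : ∀ c → 2 ≡ ℘-fibre c
    fibre c with in-℘-image? c
    ... | yes (t , refl) = sym (℘-fibre-2 t)
    ... | no c∉          = contradiction c∉ (none c)

  c₀ : Carrier
  c₀ = proj₁ outside-℘

  c₀∉℘ : ∀ t → ℘ t ≢ c₀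
  c₀∉℘ t eq = proj₂ outside-℘ (t , eq)

  -- The image of ℘ has index two: the fibres over c and c + c₀ have together at
  -- most two elements, and their average over c is two.
  ℘-index-two : ∀ c → (∃[ t ] ℘ t ≡ c) ⊎ (∃[ t ] ℘ t ≡ c + c₀)
  ℘-index-two c with in-℘-image? c
  ... | yes c∈ = inj₁ c∈
  ... | no c∉  = inj₂ (count≢0 field-finite (λ t → ℘ t ≟ᶠ (c + c₀)) λ fibre≡0 →
    contradiction (trans (sym (pair≡2 c)) (cong₂ ℕ._+_ (℘-fibre-0 c∉) fibre≡0)) λ ())
    where
    pair : Carrier → ℕ
    pair c = ℘-fibre c ℕ.+ ℘-fibre (c + c₀)
    pair≤2 : ∀ c → pair c ℕ.≤ 2
    pair≤2 c with in-℘-image? c | in-℘-image? (c + c₀)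
    -- If both c and c + c₀ lay in the image, so would their sum c₀.
    ... | yes (t , eq) | yes (s , eq′) = contradiction
      (trans (℘-+ t s) (trans (cong₂ _+_ eq eq′) (solve₂ 2 (λ c d → c :+ (c :+ d) := d) refl c c₀))) (c₀∉℘ (t + s))
    ... | yes (t , refl) | no c∉ = ℕ.≤-reflexive (cong₂ ℕ._+_ (℘-fibre-2 t) (℘-fibre-0 c∉))
    ... | no c∉ | yes (t , eq) = ℕ.≤-reflexive (cong₂ ℕ._+_ (℘-fibre-0 c∉)
      (trans (cong ℘-fibre (sym eq)) (℘-fibre-2 t)))
    ... | no c∉ | no c∉′ = ℕ.≤-trans (ℕ.≤-reflexive (cong₂ ℕ._+_ (℘-fibre-0 c∉) (℘-fibre-0 c∉′))) z≤n
    +c₀+c₀ : ∀ c → c + c₀ + c₀ ≡ c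
    +c₀+c₀ c = solve₂ 2 (λ c d → c :+ d :+ d := c) refl c c₀
    pair≡2 : ∀ c → pair c ≡ 2
    pair≡2 = total-≤-≡ field-finite pair≤2 (begin
      ∑F pair
        ≡⟨ ∑F-+ ℘-fibre _ ⟩
      ∑F ℘-fibre ℕ.+ ∑F (λ c → ℘-fibre (c + c₀))
        ≡⟨ cong₂ ℕ._+_ total-℘-fibre (trans (total-reindex field-finite field-finite (_+ c₀) (_+ c₀) +c₀+c₀ +c₀+c₀ ℘-fibre) total-℘-fibre) ⟩
      q ℕ.+ q                       ≡⟨ trans (cong (q ℕ.+_) (sym (ℕ.+-identityʳ q))) (ℕ.*-comm 2 q) ⟩
      q ℕ.* 2                       ≡⟨ cong (ℕ._* 2) field-size ⟨
      size field-finite ℕ.* 2       ≡⟨ total-const field-finite 2 ⟨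
      ∑F (λ _ → 2)  ∎)
      where open ≡-Reasoning

  -- Since q > 2: otherwise all of F would be the fibre of ℘ over 0, which has two elements. It
  -- supplies the β of `secant-plane`.
  not-fixed : ∃[ β ] ℘ β ≢ 0#
  not-fixed with search field-finite (λ β → ¬? (℘ β ≟ᶠ 0#))
  ... | inj₁ found = found
  ... | inj₂ none  = contradiction (trans (sym field-size)
    (trans (sym (count-all field-finite (λ t → ℘ t ≟ᶠ ℘ 0#) all)) (℘-fibre-2 0#))) q≢2
    where
    all : ∀ t → ℘ t ≡ ℘ 0#
    all t with ℘ t ≟ᶠ 0#
    ... | yes eq = trans eq (sym (trans (+-identityʳ _) σ-0))
    ... | no neq = contradiction neq (none t)
    q≢2 : q ≢ 2
    q≢2 q≡2 = contradiction (subst (8 ℕ.≤_) q≡2 8≤q) λ { (s≤s (s≤s ())) }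

  -- Projectivities

  open SemiringSum semiring using (sum; sum-cong-≗; ∑-comm; ∑-distrib-+; *-distribˡ-sum; *-distribʳ-sum)

  ·-*ᵥ : ∀ A B v i → ((A · B) *ᵥ v) i ≡ (A *ᵥ (B *ᵥ v)) i
  ·-*ᵥ A B v i = begin
    sum (λ k → sum (λ j → A i j * B j k) * v k)
      ≡⟨ sum-cong-≗ (λ k → trans (*-distribʳ-sum (v k) (λ j → A i j * B j k))
           (sum-cong-≗ (λ j → *-assoc (A i j) (B j k) (v k)))) ⟩
    sum (λ k → sum (λ j → A i j * (B j k * v k)))
      ≡⟨ ∑-comm (λ k j → A i j * (B j k * v k)) ⟩
    sum (λ j → sum (λ k → A i j * (B j k * v k)))
      ≡⟨ sum-cong-≗ (λ j → *-distribˡ-sum (A i j) (λ k → B j k * v k)) ⟨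
    sum (λ j → A i j * (B *ᵥ v) j) ∎
    where open ≡-Reasoning

  *ᵥ-congʳ : ∀ A {v w : Vector Carrier 4} → (∀ i → v i ≡ w i) → ∀ i → (A *ᵥ v) i ≡ (A *ᵥ w) i
  *ᵥ-congʳ A eq i = sum-cong-≗ {4} (λ j → cong (A i j *_) (eq j))

  *ᵥ-congˡ : ∀ {A B : Matrix} (v : Vector Carrier 4) → (∀ i j → A i j ≡ B i j) → ∀ i → (A *ᵥ v) i ≡ (B *ᵥ v) i
  *ᵥ-congˡ v eq i = sum-cong-≗ {4} (λ j → cong (_* v j) (eq i j))

  *ᵥ-scale : ∀ A c v i → (A *ᵥ (λ j → c * v j)) i ≡ c * (A *ᵥ v) i
  *ᵥ-scale A c v i = trans
    (sum-cong-≗ {4} (λ j → solve₂ 3 (λ a c v → a :* (c :* v) := c :* (a :* v)) refl (A i j) c (v j)))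
    (sym (*-distribˡ-sum c (λ j → A i j * v j)))

  1ᴹ-*ᵥ : ∀ v i → (1ᴹ *ᵥ v) i ≡ v i
  1ᴹ-*ᵥ v 0F = solve₂ 4 (λ a b c d → con true :* a :+ (con false :* b :+ (con false :* c :+ (con false :* d :+ con false))) := a) refl (v 0F) (v 1F) (v 2F) (v 3F)
  1ᴹ-*ᵥ v 1F = solve₂ 4 (λ a b c d → con false :* a :+ (con true :* b :+ (con false :* c :+ (con false :* d :+ con false))) := b) refl (v 0F) (v 1F) (v 2F) (v 3F)
  1ᴹ-*ᵥ v 2F = solve₂ 4 (λ a b c d → con false :* a :+ (con false :* b :+ (con true :* c :+ (con false :* d :+ con false))) := c) refl (v 0F) (v 1F) (v 2F) (v 3F)
  1ᴹ-*ᵥ v 3F = solve₂ 4 (λ a b c d → con false :* a :+ (con false :* b :+ (con false :* c :+ (con true :* d :+ con false))) := d) refl (v 0F) (v 1F) (v 2F) (v 3F)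

  ≈-sym : ∀ {P Q} → P ≈ Q → Q ≈ P
  ≈-sym {P} {Q} = Setoid.sym pointSetoid {P} {Q}

  ≈-trans : ∀ {P Q S} → P ≈ Q → Q ≈ S → P ≈ S
  ≈-trans {P} {Q} {S} = Setoid.trans pointSetoid {P} {Q} {S}

  ≗⇒≈ : ∀ {P Q} → (∀ i → coords P i ≡ coords Q i) → P ≈ Q
  ≗⇒≈ eq = 1# , 1≢0 , λ i → trans (eq i) (sym (*-identityˡ _))

  •-cong : ∀ g {P Q} → P ≈ Q → g • P ≈ g • Q
  •-cong g {P} {Q} (c , c≢0 , eq) = c , c≢0 , λ i →
    trans (*ᵥ-congʳ (matrix g) eq i) (*ᵥ-scale (matrix g) c (coords Q) i)

  infixl 8 _∘ᵖ_

  abstract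
    _∘ᵖ_ : Projectivity → Projectivity → Projectivity
    f ∘ᵖ g = record
      { matrix   = matrix f · matrix g
      ; inv      = inv g · inv f
      ; inverseˡ = cancel (inv g) (inv f) (matrix f) (matrix g) (inverseˡ f) (inverseˡ g)
      ; inverseʳ = cancel (matrix f) (matrix g) (inv g) (inv f) (inverseʳ g) (inverseʳ f)
      }
      where
      cancel : ∀ A B C D → (∀ i j → (B · C) i j ≡ 1ᴹ i j) → (∀ i j → (A · D) i j ≡ 1ᴹ i j) →
               ∀ i j → ((A · B) · (C · D)) i j ≡ 1ᴹ i j
      cancel A B C D BC≡1 AD≡1 i j = begin
        ((A · B) *ᵥ (C *ᵥ Dⱼ)) i        ≡⟨ ·-*ᵥ A B (C *ᵥ Dⱼ) i ⟩
        (A *ᵥ (B *ᵥ (C *ᵥ Dⱼ))) i      ≡⟨ *ᵥ-congʳ A (·-*ᵥ B C Dⱼ) i ⟨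
        (A *ᵥ ((B · C) *ᵥ Dⱼ)) i       ≡⟨ *ᵥ-congʳ A (*ᵥ-congˡ Dⱼ BC≡1) i ⟩
        (A *ᵥ (1ᴹ *ᵥ Dⱼ)) i            ≡⟨ *ᵥ-congʳ A (1ᴹ-*ᵥ Dⱼ) i ⟩
        (A · D) i j                    ≡⟨ AD≡1 i j ⟩
        1ᴹ i j                         ∎
        where
        open ≡-Reasoning
        Dⱼ : Vector Carrier 4
        Dⱼ k = D k j

    ∘ᵖ-• : ∀ f g P → f ∘ᵖ g • P ≈ f • g • P
    ∘ᵖ-• f g P = ≗⇒≈ {f ∘ᵖ g • P} {f • g • P} (·-*ᵥ (matrix f) (matrix g) (coords P))

  _⁻¹ᵖ : Projectivity → Projectivity
  g ⁻¹ᵖ = record { matrix = inv g ; inv = matrix g ; inverseˡ = inverseʳ g ; inverseʳ = inverseˡ g }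

  inv-*ᵥ : ∀ g v i → (inv g *ᵥ (matrix g *ᵥ v)) i ≡ v i
  inv-*ᵥ g v i = trans (sym (·-*ᵥ (inv g) (matrix g) v i))
    (trans (*ᵥ-congˡ v (inverseˡ g) i) (1ᴹ-*ᵥ v i))

  ⁻¹ᵖ-•ˡ : ∀ g P → g ⁻¹ᵖ • g • P ≈ P
  ⁻¹ᵖ-•ˡ g P = ≗⇒≈ {g ⁻¹ᵖ • g • P} {P} (inv-*ᵥ g (coords P))

  ⁻¹ᵖ-•ʳ : ∀ g P → g • g ⁻¹ᵖ • P ≈ P
  ⁻¹ᵖ-•ʳ g = ⁻¹ᵖ-•ˡ (g ⁻¹ᵖ)

  Arc-resp : ∀ {P Q} → P ≈ Q → Arc h P → Arc h Q
  Arc-resp {P} {Q} P≈Q (inj₁ (t , P≈)) = inj₁ (t , ≈-trans {Q} {P} {P[ h , t ]} (≈-sym {P} {Q} P≈Q) P≈)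
  Arc-resp {P} {Q} P≈Q (inj₂ P≈)       = inj₂ (≈-trans {Q} {P} {U₄} (≈-sym {P} {Q} P≈Q) P≈)

  G-∘ : ∀ {f g} → G h f → G h g → G h (f ∘ᵖ g)
  G-∘ {f} {g} f∈G g∈G P = mk⇔
    (λ P∈ → Arc-resp {f • g • P} {f ∘ᵖ g • P} (≈-sym {f ∘ᵖ g • P} {f • g • P} (∘ᵖ-• f g P))
              (Equivalence.to (f∈G (g • P)) (Equivalence.to (g∈G P) P∈)))
    (λ fgP∈ → Equivalence.from (g∈G P) (Equivalence.from (f∈G (g • P))
                (Arc-resp {f ∘ᵖ g • P} {f • g • P} (∘ᵖ-• f g P) fgP∈)))

  G-⁻¹ : ∀ {g} → G h g → G h (g ⁻¹ᵖ)
  G-⁻¹ {g} g∈G P = mk⇔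
    (λ P∈ → Equivalence.from (g∈G (g ⁻¹ᵖ • P))
              (Arc-resp {P} {g • g ⁻¹ᵖ • P} (≈-sym {g • g ⁻¹ᵖ • P} {P} (⁻¹ᵖ-•ʳ g P)) P∈))
    (λ gP∈ → Arc-resp {g • g ⁻¹ᵖ • P} {P} (⁻¹ᵖ-•ʳ g P) (Equivalence.to (g∈G (g ⁻¹ᵖ • P)) gP∈))

  Orbit-sym : ∀ {P Q} → Orbit h P Q → Orbit h Q P
  Orbit-sym {P} {Q} (g , g∈G , Q≈gP) = g ⁻¹ᵖ , G-⁻¹ {g} g∈G ,
    ≈-trans {P} {g ⁻¹ᵖ • g • P} {g ⁻¹ᵖ • Q} (≈-sym {g ⁻¹ᵖ • g • P} {P} (⁻¹ᵖ-•ˡ g P))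
      (•-cong (g ⁻¹ᵖ) {g • P} {Q} (≈-sym {Q} {g • P} Q≈gP))

  Orbit-trans : ∀ {P Q S} → Orbit h P Q → Orbit h Q S → Orbit h P S
  Orbit-trans {P} {Q} {S} (f , f∈G , Q≈fP) (g , g∈G , S≈gQ) = g ∘ᵖ f , G-∘ {g} {f} g∈G f∈G ,
    ≈-trans {S} {g • Q} {g ∘ᵖ f • P} S≈gQ (≈-trans {g • Q} {g • f • P} {g ∘ᵖ f • P}
      (•-cong g {Q} {f • P} Q≈fP) (≈-sym {g ∘ᵖ f • P} {g • f • P} (∘ᵖ-• g f P)))

  -- The binary digits of an index: F⁴ is read as F² ⊗ F², with the σ-twisted factor indexed by `hi`
  -- and the plain one by `lo`.
  hi lo : Fin 4 → Fin 2
  hi 0F = 0F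
  hi 1F = 0F
  hi 2F = 1F
  hi 3F = 1F
  lo 0F = 0F
  lo 1F = 1F
  lo 2F = 0F
  lo 3F = 1F

  V₂ : Set
  V₂ = Vector Carrier 2

  -- u^σ ⊗ u, so that P_t is the image of (1, t).
  veronese : V₂ → Vector Carrier 4
  veronese u i = σ (u (hi i)) * u (lo i)

  record GL₂ : Set where
    constructor gl₂
    field
      a b c d : Carrier
      det≢0   : a * d + b * c ≢ 0#

    ent : Fin 2 → Fin 2 → Carrier
    ent 0F 0F = a
    ent 0F 1F = b
    ent 1F 0F = c
    ent 1F 1F = d

    -- The matrix M_{a,b,c,d} of the paper, without the normalisation of the determinant.
    M : Matrix
    M i j = σ (ent (hi i) (hi j)) * ent (lo i) (lo j)

    det det⁻¹ : Carrier
    det   = a * d + b * c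
    det⁻¹ = det ⁻¹

    act : V₂ → V₂
    act u i = ent i 0F * u 0F + ent i 1F * u 1F

  open GL₂ using (det; det⁻¹; det≢0; ent; M; act)

  inverse₂ : GL₂ → GL₂
  inverse₂ B@(gl₂ a b c d _) = gl₂ (d * det⁻¹ B) (b * det⁻¹ B) (c * det⁻¹ B) (a * det⁻¹ B)
    λ eq → *-≢0 (*-≢0 (⁻¹-≢0 (det≢0 B)) (⁻¹-≢0 (det≢0 B))) (det≢0 B)
      (trans (solve₂ 5 (λ a b c d e → (e :* e) :* (a :* d :+ b :* c) := (d :* e) :* (a :* e) :+ (b :* e) :* (c :* e))
        refl a b c d (det⁻¹ B)) eq)

  δ₂ : Fin 2 → Fin 2 → Carrier
  δ₂ 0F 0F = 1#
  δ₂ 0F 1F = 0#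
  δ₂ 1F 0F = 0#
  δ₂ 1F 1F = 1#

  δ₂-⊗ : ∀ i j → σ (δ₂ (hi i) (hi j)) * δ₂ (lo i) (lo j) ≡ 1ᴹ i j
  δ₂-⊗ i j = lemma i j
    where
    one : σ 1# * 1# ≡ 1#
    one = trans (*-identityʳ _) σ-1
    zeroʳ′ : ∀ {x} → x * 0# ≡ 0#
    zeroʳ′ = zeroʳ _
    zeroˡ′ : ∀ {x} → σ 0# * x ≡ 0#
    zeroˡ′ = trans (cong (_* _) σ-0) (zeroˡ _)
    lemma : ∀ i j → σ (δ₂ (hi i) (hi j)) * δ₂ (lo i) (lo j) ≡ 1ᴹ i j
    lemma 0F 0F = one
    lemma 0F 1F = zeroʳ′
    lemma 0F 2F = zeroˡ′
    lemma 0F 3F = zeroˡ′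
    lemma 1F 0F = zeroʳ′
    lemma 1F 1F = one
    lemma 1F 2F = zeroˡ′
    lemma 1F 3F = zeroˡ′
    lemma 2F 0F = zeroˡ′
    lemma 2F 1F = zeroˡ′
    lemma 2F 2F = one
    lemma 2F 3F = zeroʳ′
    lemma 3F 0F = zeroˡ′
    lemma 3F 1F = zeroˡ′
    lemma 3F 2F = zeroʳ′
    lemma 3F 3F = one

  σ-dot : ∀ a b x y → σ (a * x + b * y) ≡ σ a * σ x + σ b * σ y
  σ-dot a b x y = trans (σ-+ (a * x) (b * y)) (cong₂ _+_ (σ-* a x) (σ-* b y))

  -- The mixed-product rule for Kronecker products, one entry at a time: a sum over four pairs of
  -- indices factors into two sums of two terms.
  tensor : ∀ a b c d w x y z →
    a * b * (w * x) + (a * c * (w * y) + (d * b * (z * x) + (d * c * (z * y) + 0#)))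
      ≡ (a * w + d * z) * (b * x + c * y)
  tensor = solve₂ 8 (λ a b c d w x y z →
    a :* b :* (w :* x) :+ (a :* c :* (w :* y) :+ (d :* b :* (z :* x) :+ (d :* c :* (z :* y) :+ con false)))
      := (a :* w :+ d :* z) :* (b :* x :+ c :* y)) refl

  M-· : ∀ A B → (∀ i j → ent A i 0F * ent B 0F j + ent A i 1F * ent B 1F j ≡ δ₂ i j) →
        ∀ i j → (M A · M B) i j ≡ 1ᴹ i j
  M-· A B AB≡1 i k = begin
    (M A · M B) i k
      ≡⟨ tensor (σ (α (hi i) 0F)) (α (lo i) 0F) (α (lo i) 1F) (σ (α (hi i) 1F)) (σ (β 0F (hi k))) (β 0F (lo k)) (β 1F (lo k)) (σ (β 1F (hi k))) ⟩
    (σ (α (hi i) 0F) * σ (β 0F (hi k)) + σ (α (hi i) 1F) * σ (β 1F (hi k))) * (α (lo i) 0F * β 0F (lo k) + α (lo i) 1F * β 1F (lo k))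
      ≡⟨ cong₂ _*_ (trans (sym (σ-dot (α (hi i) 0F) _ _ _)) (cong σ (AB≡1 (hi i) (hi k)))) (AB≡1 (lo i) (lo k)) ⟩
    σ (δ₂ (hi i) (hi k)) * δ₂ (lo i) (lo k)
      ≡⟨ δ₂-⊗ i k ⟩
    1ᴹ i k ∎
    where
    open ≡-Reasoning
    α = ent A
    β = ent B

  inverse₂ˡ : ∀ B i j → ent (inverse₂ B) i 0F * ent B 0F j + ent (inverse₂ B) i 1F * ent B 1F j ≡ δ₂ i j
  inverse₂ˡ B@(gl₂ a b c d ≢0) 0F 0F = trans (solve₂ 5 (λ a b c d e → d :* e :* a :+ b :* e :* c := e :* (a :* d :+ b :* c)) refl a b c d (det⁻¹ B)) (⁻¹-inverseˡ ≢0)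
  inverse₂ˡ B@(gl₂ a b c d ≢0) 0F 1F = solve₂ 3 (λ b d e → d :* e :* b :+ b :* e :* d := con false) refl b d (det⁻¹ B)
  inverse₂ˡ B@(gl₂ a b c d ≢0) 1F 0F = solve₂ 3 (λ a c e → c :* e :* a :+ a :* e :* c := con false) refl a c (det⁻¹ B)
  inverse₂ˡ B@(gl₂ a b c d ≢0) 1F 1F = trans (solve₂ 5 (λ a b c d e → c :* e :* b :+ a :* e :* d := e :* (a :* d :+ b :* c)) refl a b c d (det⁻¹ B)) (⁻¹-inverseˡ ≢0)

  inverse₂ʳ : ∀ B i j → ent B i 0F * ent (inverse₂ B) 0F j + ent B i 1F * ent (inverse₂ B) 1F j ≡ δ₂ i j
  inverse₂ʳ B@(gl₂ a b c d ≢0) 0F 0F = trans (solve₂ 5 (λ a b c d e → a :* (d :* e) :+ b :* (c :* e) := e :* (a :* d :+ b :* c)) refl a b c d (det⁻¹ B)) (⁻¹-inverseˡ ≢0)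
  inverse₂ʳ B@(gl₂ a b c d ≢0) 0F 1F = solve₂ 3 (λ a b e → a :* (b :* e) :+ b :* (a :* e) := con false) refl a b (det⁻¹ B)
  inverse₂ʳ B@(gl₂ a b c d ≢0) 1F 0F = solve₂ 3 (λ c d e → c :* (d :* e) :+ d :* (c :* e) := con false) refl c d (det⁻¹ B)
  inverse₂ʳ B@(gl₂ a b c d ≢0) 1F 1F = trans (solve₂ 5 (λ a b c d e → c :* (b :* e) :+ d :* (a :* e) := e :* (a :* d :+ b :* c)) refl a b c d (det⁻¹ B)) (⁻¹-inverseˡ ≢0)

  proj : GL₂ → Projectivity
  proj B = record
    { matrix   = M B
    ; inv      = M (inverse₂ B)
    ; inverseˡ = M-· (inverse₂ B) B (inverse₂ˡ B)
    ; inverseʳ = M-· B (inverse₂ B) (inverse₂ʳ B)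
    }

  -- The Kronecker product of B^σ and B acts on the pure tensor u^σ ⊗ u factor by factor. Hence GL₂
  -- moves the arc as it moves the projective line.
  M-veronese : ∀ B u i → (M B *ᵥ veronese u) i ≡ veronese (act B u) i
  M-veronese B u i = trans
    (tensor (σ (β (hi i) 0F)) (β (lo i) 0F) (β (lo i) 1F) (σ (β (hi i) 1F)) (σ (u 0F)) (u 0F) (u 1F) (σ (u 1F)))
    (cong (_* act B u (lo i)) (sym (σ-dot (β (hi i) 0F) (β (hi i) 1F) (u 0F) (u 1F))))
    where β = ent B

  -- The arc and its osculating planes

  PG₁ : Set
  PG₁ = Carrier ⊎ ⊤

  pattern ∞ = inj₂ tt

  PG₁-finite : Finite PG₁
  PG₁-finite = field-finite ⊎-finite ⊤-finite

  line : PG₁ → V₂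
  line (inj₁ t) = 1# ∷ t ∷ []
  line ∞        = 0# ∷ 1# ∷ []

  arcVec : PG₁ → Vector Carrier 4
  arcVec (inj₁ t) = 1# ∷ t ∷ σ t ∷ σ t * t ∷ []
  arcVec ∞        = 0# ∷ 0# ∷ 0# ∷ 1# ∷ []

  arc : PG₁ → Point
  arc (inj₁ t) = point (arcVec (inj₁ t)) λ ≡0 → 1≢0 (≡0 0F)
  arc ∞        = point (arcVec ∞) λ ≡0 → 1≢0 (≡0 3F)

  coords-arc : ∀ t i → coords (arc t) i ≡ arcVec t i
  coords-arc (inj₁ t) i = refl
  coords-arc ∞        i = refl

  veronese-line : ∀ t i → veronese (line t) i ≡ arcVec t i
  veronese-line (inj₁ t) 0F = trans (*-identityʳ _) σ-1
  veronese-line (inj₁ t) 1F = trans (cong (_* t) σ-1) (*-identityˡ t)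
  veronese-line (inj₁ t) 2F = *-identityʳ _
  veronese-line (inj₁ t) 3F = refl
  veronese-line ∞ 0F = zeroʳ _
  veronese-line ∞ 1F = trans (cong (_* 1#) σ-0) (zeroˡ _)
  veronese-line ∞ 2F = zeroʳ _
  veronese-line ∞ 3F = trans (*-identityʳ _) σ-1

  arc-affine : ∀ t → arc (inj₁ t) ≈ P[ h , t ]
  arc-affine t = ≗⇒≈ {arc (inj₁ t)} {P[ h , t ]} λ where
    0F → refl
    1F → refl
    2F → σ-def t
    3F → trans (cong₂ _*_ (σ-def t) (sym (*-identityʳ t))) (sym (Exp.^-homo-* t (2 ℕ.^ h) 1))

  arc-∞ : arc ∞ ≈ U₄
  arc-∞ = ≗⇒≈ {arc ∞} {U₄} λ { 0F → refl ; 1F → refl ; 2F → refl ; 3F → refl }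

  Arc⇒arc : ∀ {P} → Arc h P → ∃[ t ] P ≈ arc t
  Arc⇒arc {P} (inj₁ (t , P≈)) = inj₁ t , ≈-trans {P} {P[ h , t ]} {arc (inj₁ t)} P≈ (≈-sym {arc (inj₁ t)} {P[ h , t ]} (arc-affine t))
  Arc⇒arc {P} (inj₂ P≈)       = ∞ , ≈-trans {P} {U₄} {arc ∞} P≈ (≈-sym {arc ∞} {U₄} arc-∞)

  arc⇒Arc : ∀ {P} t → P ≈ arc t → Arc h P
  arc⇒Arc {P} (inj₁ t) P≈ = inj₁ (t , ≈-trans {P} {arc (inj₁ t)} {P[ h , t ]} P≈ (arc-affine t))
  arc⇒Arc {P} ∞        P≈ = inj₂ (≈-trans {P} {arc ∞} {U₄} P≈ arc-∞)

  arc∈Arc : ∀ t → Arc h (arc t)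
  arc∈Arc t = arc⇒Arc {arc t} t (≗⇒≈ {arc t} {arc t} λ _ → refl)

  arc-injective : ∀ {s t} → arc s ≈ arc t → s ≡ t
  arc-injective {inj₁ s} {inj₁ t} (c , _ , eq) = cong inj₁ (trans (eq 1F) (trans (cong (_* t) c≡1) (*-identityˡ t)))
    where
    c≡1 : c ≡ 1#
    c≡1 = trans (sym (*-identityʳ c)) (sym (eq 0F))
  arc-injective {inj₁ s} {∞} (c , _ , eq) = contradiction (trans (eq 0F) (zeroʳ c)) 1≢0
  arc-injective {∞} {inj₁ t} (c , c≢0 , eq) = contradiction (trans (sym (*-identityʳ c)) (sym (eq 0F))) c≢0
  arc-injective {∞} {∞} _ = refl

  slope : ∀ (u : V₂) → ¬ (u 0F ≡ 0# × u 1F ≡ 0#) → ∃[ t ] ∃[ c ] c ≢ 0# × (∀ i → u i ≡ c * line t i)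
  slope u u≢0 with u 0F ≟ᶠ 0#
  ... | yes u₀≡0 = ∞ , u 1F , (λ u₁≡0 → u≢0 (u₀≡0 , u₁≡0)) ,
    λ { 0F → trans u₀≡0 (sym (zeroʳ _)) ; 1F → sym (*-identityʳ _) }
  ... | no u₀≢0  = inj₁ (u 0F ⁻¹ * u 1F) , u 0F , u₀≢0 ,
    λ { 0F → sym (*-identityʳ _)
      ; 1F → sym (trans (sym (*-assoc _ _ _)) (trans (cong (_* u 1F) (⁻¹-inverseʳ u₀≢0)) (*-identityˡ _))) }

  line-≢0 : ∀ t → ¬ (line t 0F ≡ 0# × line t 1F ≡ 0#)
  line-≢0 (inj₁ t) (eq , _) = 1≢0 eq
  line-≢0 ∞        (_ , eq) = 1≢0 eq

  -- Multiplying `act B u` by the adjugate of B gives back `det B` times u.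
  act-≢0 : ∀ B u → ¬ (u 0F ≡ 0# × u 1F ≡ 0#) → ¬ (act B u 0F ≡ 0# × act B u 1F ≡ 0#)
  act-≢0 B@(gl₂ a b c d ≢0) u u≢0 (eq₀ , eq₁) = u≢0 (cancel (d) b e₀ , cancel c a e₁)
    where
    e₀ : d * (a * u 0F + b * u 1F) + b * (c * u 0F + d * u 1F) ≡ det B * u 0F
    e₀ = solve₂ 6 (λ a b c d u v → d :* (a :* u :+ b :* v) :+ b :* (c :* u :+ d :* v) := (a :* d :+ b :* c) :* u) refl a b c d (u 0F) (u 1F)
    e₁ : c * (a * u 0F + b * u 1F) + a * (c * u 0F + d * u 1F) ≡ det B * u 1F
    e₁ = solve₂ 6 (λ a b c d u v → c :* (a :* u :+ b :* v) :+ a :* (c :* u :+ d :* v) := (a :* d :+ b :* c) :* v) refl a b c d (u 0F) (u 1F)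
    cancel : ∀ x y {z} → x * act B u 0F + y * act B u 1F ≡ det B * z → z ≡ 0#
    cancel x y eq = *-≡0ʳ ≢0 (trans (sym eq) (trans (cong₂ _+_ (trans (cong (x *_) eq₀) (zeroʳ x)) (trans (cong (y *_) eq₁) (zeroʳ y))) (+-identityʳ 0#)))

  moves : ∀ B t → ∃[ t′ ] ∃[ c ] c ≢ 0# × (∀ i → act B (line t) i ≡ c * line t′ i)
  moves B t = slope (act B (line t)) (act-≢0 B (line t) (line-≢0 t))

  veronese-scale : ∀ {u v : V₂} c → (∀ i → u i ≡ c * v i) → ∀ i → veronese u i ≡ σ c * c * veronese v i
  veronese-scale {u} {v} c eq i = begin
    σ (u (hi i)) * u (lo i)                  ≡⟨ cong₂ _*_ (trans (cong σ (eq (hi i))) (σ-* c _)) (eq (lo i)) ⟩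
    σ c * σ (v (hi i)) * (c * v (lo i))      ≡⟨ solve₂ 4 (λ a b c d → a :* b :* (c :* d) := a :* c :* (b :* d)) refl (σ c) _ c _ ⟩
    σ c * c * veronese v i                   ∎
    where open ≡-Reasoning

  proj-arc : ∀ B t → proj B • arc t ≈ arc (proj₁ (moves B t))
  proj-arc B t with moves B t
  ... | t′ , c , c≢0 , eq = σ c * c , *-≢0 (σ-≢0 c≢0) c≢0 , λ i → begin
    (M B *ᵥ coords (arc t)) i           ≡⟨ *ᵥ-congʳ (M B) (λ j → trans (coords-arc t j) (sym (veronese-line t j))) i ⟩
    (M B *ᵥ veronese (line t)) i        ≡⟨ M-veronese B (line t) i ⟩
    veronese (act B (line t)) i         ≡⟨ veronese-scale {v = line t′} c eq i ⟩
    σ c * c * veronese (line t′) i      ≡⟨ cong (σ c * c *_) (trans (veronese-line t′ i) (sym (coords-arc t′ i))) ⟩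
    σ c * c * coords (arc t′) i         ∎
    where open ≡-Reasoning

  proj-Arc : ∀ B P → Arc h P → Arc h (proj B • P)
  proj-Arc B P P∈ with Arc⇒arc {P} P∈
  ... | t , P≈ = arc⇒Arc {proj B • P} (proj₁ (moves B t))
    (≈-trans {proj B • P} {proj B • arc t} {arc (proj₁ (moves B t))} (•-cong (proj B) {P} {arc t} P≈) (proj-arc B t))

  proj∈G : ∀ B → G h (proj B)
  proj∈G B P = mk⇔ (proj-Arc B P) λ BP∈ →
    Arc-resp {proj (inverse₂ B) • proj B • P} {P}
      (≗⇒≈ {proj (inverse₂ B) • proj B • P} {P} (inv-*ᵥ (proj B) (coords P)))
      (proj-Arc (inverse₂ B) (proj B • P) BP∈)

  osc : Vector Carrier 4 → PG₁ → Carrier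
  osc X (inj₁ t) = σ t * t * X 0F + σ t * X 1F + t * X 2F + X 3F
  osc X ∞        = X 0F

  Osc : Point → PG₁ → Set
  Osc P t = osc (coords P) t ≡ 0#

  Osc? : ∀ P → Decidable (Osc P)
  Osc? P t = osc (coords P) t ≟ᶠ 0#

  ∈ᵖ-osc : ∀ P t → sum (λ i → coords (polar (arc t)) i * coords P i) ≡ osc (coords P) t
  ∈ᵖ-osc P (inj₁ t) = solve₂ 6 (λ s t x y z w →
    s :* t :* x :+ (s :* y :+ (t :* z :+ (con true :* w :+ con false))) := s :* t :* x :+ s :* y :+ t :* z :+ w)
    refl (σ t) t (coords P 0F) (coords P 1F) (coords P 2F) (coords P 3F)
  ∈ᵖ-osc P ∞ = solve₂ 4 (λ x y z w →
    con true :* x :+ (con false :* y :+ (con false :* z :+ (con false :* w :+ con false))) := x)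
    refl (coords P 0F) (coords P 1F) (coords P 2F) (coords P 3F)

  -- The alternating form of the polarity evaluated at X and `veronese u`. It is the homogeneous
  -- version of `osc`, so that the parameter ∞ needs no special treatment under `act`.
  form : Vector Carrier 4 → V₂ → Carrier
  form X u = σ (u 1F) * u 1F * X 0F + σ (u 1F) * u 0F * X 1F + σ (u 0F) * u 1F * X 2F + σ (u 0F) * u 0F * X 3F

  form-line : ∀ X t → form X (line t) ≡ osc X t
  form-line X (inj₁ t) = trans
    (cong (λ s → σ t * t * X 0F + σ t * 1# * X 1F + s * t * X 2F + s * 1# * X 3F) σ-1)
    (solve₂ 6 (λ s t x y z w → s :* t :* x :+ s :* con true :* y :+ con true :* t :* z :+ con true :* con true :* w
        := s :* t :* x :+ s :* y :+ t :* z :+ w)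
      refl (σ t) t (X 0F) (X 1F) (X 2F) (X 3F))
  form-line X ∞ = trans
    (cong₂ (λ s r → s * 1# * X 0F + s * 0# * X 1F + r * 1# * X 2F + r * 0# * X 3F) σ-1 σ-0)
    (solve₂ 4 (λ x y z w → con true :* con true :* x :+ con true :* con false :* y :+ con false :* con true :* z :+ con false :* con false :* w := x)
      refl (X 0F) (X 1F) (X 2F) (X 3F))

  form-scale : ∀ X {u v : V₂} c → (∀ i → u i ≡ c * v i) → form X u ≡ σ c * c * form X v
  form-scale X {u} {v} c eq = begin
    ver 3F * X 0F + ver 2F * X 1F + ver 1F * X 2F + ver 0F * X 3F
      ≡⟨ cong₂ _+_ (cong₂ _+_ (cong₂ _+_ (s 3F 0F) (s 2F 1F)) (s 1F 2F)) (s 0F 3F) ⟩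
    e * (ver′ 3F * X 0F) + e * (ver′ 2F * X 1F) + e * (ver′ 1F * X 2F) + e * (ver′ 0F * X 3F)
      ≡⟨ solve₂ 5 (λ e a b c d → e :* a :+ e :* b :+ e :* c :+ e :* d := e :* (a :+ b :+ c :+ d)) refl e _ _ _ _ ⟩
    e * form X v ∎
    where
    open ≡-Reasoning
    e = σ c * c
    ver = veronese u
    ver′ = veronese v
    s : ∀ i j → ver i * X j ≡ e * (ver′ i * X j)
    s i j = trans (cong (_* X j) (veronese-scale {u} {v} c eq i)) (*-assoc e _ _)

  -- The alternating form on F² is the determinant of two vectors, hence is multiplied by the
  -- determinant of the matrix; signs disappear in characteristic two.
  ω-det : ∀ a b c d u v x y →
    (c * u + d * v) * (a * x + b * y) + (a * u + b * v) * (c * x + d * y) ≡ (a * d + b * c) * (v * x + u * y)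
  ω-det = solve₂ 8 (λ a b c d u v x y →
    (c :* u :+ d :* v) :* (a :* x :+ b :* y) :+ (a :* u :+ b :* v) :* (c :* x :+ d :* y)
      := (a :* d :+ b :* c) :* (v :* x :+ u :* y)) refl

  ⊗-row : ∀ e f g h (X : Vector Carrier 4) →
    e * g * X 0F + (e * h * X 1F + (f * g * X 2F + (f * h * X 3F + 0#)))
      ≡ e * (g * X 0F + h * X 1F) + f * (g * X 2F + h * X 3F)
  ⊗-row e f g h X = solve₂ 8 (λ e f g h x y z w →
    e :* g :* x :+ (e :* h :* y :+ (f :* g :* z :+ (f :* h :* w :+ con false)))
      := e :* (g :* x :+ h :* y) :+ f :* (g :* z :+ h :* w)) refl e f g h (X 0F) (X 1F) (X 2F) (X 3F)

  -- The alternating form on F⁴ is the tensor product of the alternating forms on the two factors.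
  -- `ω-det` is applied in the plain factor and then in the twisted one, which produces the scalars
  -- `det B` and `σ (det B)`.
  M-form : ∀ B X u → form (M B *ᵥ X) (act B u) ≡ σ (det B) * det B * form X u
  M-form B@(gl₂ a b c d _) X u = begin
    form (M B *ᵥ X) (act B u)
      ≡⟨ cong₂ (λ s r → s * w₁ * Y 0F + s * w₀ * Y 1F + r * w₁ * Y 2F + r * w₀ * Y 3F)
           (σ-dot c d (u 0F) (u 1F)) (σ-dot a b (u 0F) (u 1F)) ⟩
    s₁ * w₁ * Y 0F + s₁ * w₀ * Y 1F + s₀ * w₁ * Y 2F + s₀ * w₀ * Y 3F
      ≡⟨ cong₂ _+_ (cong₂ _+_ (cong₂ _+_ (row s₁ w₁ (σ a) (σ b) a b) (row s₁ w₀ (σ a) (σ b) c d))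
           (row s₀ w₁ (σ c) (σ d) a b)) (row s₀ w₀ (σ c) (σ d) c d) ⟩
    s₁ * w₁ * (σ a * (a * X 0F + b * X 1F) + σ b * (a * X 2F + b * X 3F)) +
    s₁ * w₀ * (σ a * (c * X 0F + d * X 1F) + σ b * (c * X 2F + d * X 3F)) +
    s₀ * w₁ * (σ c * (a * X 0F + b * X 1F) + σ d * (a * X 2F + b * X 3F)) +
    s₀ * w₀ * (σ c * (c * X 0F + d * X 1F) + σ d * (c * X 2F + d * X 3F))
      ≡⟨ regroup s₁ s₀ w₁ w₀ (σ a) (σ b) (σ c) (σ d) _ _ _ _ ⟩
    s₁ * (σ a * (w₁ * (a * X 0F + b * X 1F) + w₀ * (c * X 0F + d * X 1F))
        + σ b * (w₁ * (a * X 2F + b * X 3F) + w₀ * (c * X 2F + d * X 3F))) +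
    s₀ * (σ c * (w₁ * (a * X 0F + b * X 1F) + w₀ * (c * X 0F + d * X 1F))
        + σ d * (w₁ * (a * X 2F + b * X 3F) + w₀ * (c * X 2F + d * X 3F)))
      ≡⟨ cong₂ (λ x y → s₁ * (σ a * x + σ b * y) + s₀ * (σ c * x + σ d * y))
           (ω-det a b c d (u 0F) (u 1F) (X 0F) (X 1F)) (ω-det a b c d (u 0F) (u 1F) (X 2F) (X 3F)) ⟩
    s₁ * (σ a * (det B * x₀) + σ b * (det B * x₁)) + s₀ * (σ c * (det B * x₀) + σ d * (det B * x₁))
      ≡⟨ ω-det (σ a) (σ b) (σ c) (σ d) (σ (u 0F)) (σ (u 1F)) (det B * x₀) (det B * x₁) ⟩
    (σ a * σ d + σ b * σ c) * (σ (u 1F) * (det B * x₀) + σ (u 0F) * (det B * x₁))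
      ≡⟨ cong (_* (σ (u 1F) * (det B * x₀) + σ (u 0F) * (det B * x₁))) (σ-dot a b d c) ⟨
    σ (det B) * (σ (u 1F) * (det B * x₀) + σ (u 0F) * (det B * x₁))
      ≡⟨ solve₂ 10 (λ e f s r u v x y z w →
           e :* (s :* (f :* (v :* x :+ u :* y)) :+ r :* (f :* (v :* z :+ u :* w)))
             := e :* f :* (s :* v :* x :+ s :* u :* y :+ r :* v :* z :+ r :* u :* w))
           refl (σ (det B)) (det B) (σ (u 1F)) (σ (u 0F)) (u 0F) (u 1F) (X 0F) (X 1F) (X 2F) (X 3F) ⟩
    σ (det B) * det B * form X u ∎
    where
    open ≡-Reasoning
    Y = M B *ᵥ X
    w₀ = act B u 0F
    w₁ = act B u 1F
    s₀ = σ a * σ (u 0F) + σ b * σ (u 1F)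
    s₁ = σ c * σ (u 0F) + σ d * σ (u 1F)
    x₀ = u 1F * X 0F + u 0F * X 1F
    x₁ = u 1F * X 2F + u 0F * X 3F
    row : ∀ s w e f g h → s * w * (e * g * X 0F + (e * h * X 1F + (f * g * X 2F + (f * h * X 3F + 0#))))
                        ≡ s * w * (e * (g * X 0F + h * X 1F) + f * (g * X 2F + h * X 3F))
    row s w e f g h = cong (s * w *_) (⊗-row e f g h X)
    regroup : ∀ s r w v a b c d p₀ p₁ q₀ q₁ →
      s * w * (a * p₀ + b * p₁) + s * v * (a * q₀ + b * q₁) + r * w * (c * p₀ + d * p₁) + r * v * (c * q₀ + d * q₁)
        ≡ s * (a * (w * p₀ + v * q₀) + b * (w * p₁ + v * q₁)) + r * (c * (w * p₀ + v * q₀) + d * (w * p₁ + v * q₁))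
    regroup = solve₂ 12 (λ s r w v a b c d p₀ p₁ q₀ q₁ →
      s :* w :* (a :* p₀ :+ b :* p₁) :+ s :* v :* (a :* q₀ :+ b :* q₁) :+ r :* w :* (c :* p₀ :+ d :* p₁) :+ r :* v :* (c :* q₀ :+ d :* q₁)
        := s :* (a :* (w :* p₀ :+ v :* q₀) :+ b :* (w :* p₁ :+ v :* q₁)) :+ r :* (c :* (w :* p₀ :+ v :* q₀) :+ d :* (w :* p₁ :+ v :* q₁))) refl

  -- The stabilizer of the arc

  *ᵥ-+ : ∀ A (v w : Vector Carrier 4) i → (A *ᵥ (λ j → v j + w j)) i ≡ (A *ᵥ v) i + (A *ᵥ w) i
  *ᵥ-+ A v w i = trans (sum-cong-≗ {4} (λ j → distribˡ (A i j) (v j) (w j)))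
                       (∑-distrib-+ (λ j → A i j * v j) (λ j → A i j * w j))

  combination : Carrier → Carrier → Carrier → (u v w : Vector Carrier 4) → Vector Carrier 4
  combination α β γ u v w i = α * u i + β * v i + γ * w i

  *ᵥ-combination : ∀ A α β γ u v w i →
    (A *ᵥ combination α β γ u v w) i ≡ combination α β γ (A *ᵥ u) (A *ᵥ v) (A *ᵥ w) i
  *ᵥ-combination A α β γ u v w i = begin
    (A *ᵥ combination α β γ u v w) i
      ≡⟨ *ᵥ-+ A (λ j → α * u j + β * v j) (λ j → γ * w j) i ⟩
    (A *ᵥ (λ j → α * u j + β * v j)) i + (A *ᵥ (λ j → γ * w j)) i
      ≡⟨ cong₂ _+_ (trans (*ᵥ-+ A (λ j → α * u j) (λ j → β * v j) i)
           (cong₂ _+_ (*ᵥ-scale A α u i) (*ᵥ-scale A β v i))) (*ᵥ-scale A γ w i) ⟩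
    combination α β γ (A *ᵥ u) (A *ᵥ v) (A *ᵥ w) i ∎
    where open ≡-Reasoning

  image-of-combination : ∀ A {α β γ a b c} {Q u v w u′ v′ w′ : Vector Carrier 4} →
    (∀ i → Q i ≡ combination α β γ u v w i) → (∀ i → (A *ᵥ u) i ≡ a * u′ i) →
    (∀ i → (A *ᵥ v) i ≡ b * v′ i) → (∀ i → (A *ᵥ w) i ≡ c * w′ i) →
    ∀ i → (A *ᵥ Q) i ≡ combination (α * a) (β * b) (γ * c) u′ v′ w′ i
  image-of-combination A {α} {β} {γ} {a} {b} {c} {Q} {u} {v} {w} {u′} {v′} {w′} eq a-eq b-eq c-eq i = begin
    (A *ᵥ Q) i
      ≡⟨ *ᵥ-congʳ A eq i ⟩
    (A *ᵥ combination α β γ u v w) i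
      ≡⟨ *ᵥ-combination A α β γ u v w i ⟩
    combination α β γ (A *ᵥ u) (A *ᵥ v) (A *ᵥ w) i
      ≡⟨ cong₂ _+_ (cong₂ _+_ (cong (α *_) (a-eq i)) (cong (β *_) (b-eq i))) (cong (γ *_) (c-eq i)) ⟩
    α * (a * u′ i) + β * (b * v′ i) + γ * (c * w′ i)
      ≡⟨ cong₂ _+_ (cong₂ _+_ (*-assoc α a _) (*-assoc β b _)) (*-assoc γ c _) ⟨
    combination (α * a) (β * b) (γ * c) u′ v′ w′ i ∎
    where open ≡-Reasoning

  -- For Q = (1, x, y, z): with β ∉ 𝔽₂, α = 1 + β, s = x + β r and t = x + α r,
  -- one has α s + β t = x and α σ(s) + β σ(t) = σ(x) + ℘(β) σ(r), and σ(r) can be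
  -- chosen such that the latter is y.
  secant-plane : ∀ (Q : Vector Carrier 4) → Q 0F ≢ 0# → ∃[ s ] ∃[ t ] ∃[ α ] ∃[ β ] ∃[ γ ]
    (∀ i → Q i ≡ combination α β γ (arcVec (inj₁ s)) (arcVec (inj₁ t)) (arcVec ∞) i)
  secant-plane Q w≢0 = s , t , w * α , w * β , γ , λ where
      0F → solve₂ 3 (λ w b g → w := w :* (con true :+ b) :* con true :+ w :* b :* con true :+ g :* con false) refl w β γ
      1F → trans (sym (w*w⁻¹ (Q 1F)))
             (solve₂ 5 (λ w x b r g → w :* x
               := w :* (con true :+ b) :* (x :+ b :* r) :+ w :* b :* (x :+ (con true :+ b) :* r) :+ g :* con false) refl w x β r γ)
      2F → sym (begin
        w * α * σ s + w * β * σ t + γ * 0#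
          ≡⟨ cong₂ (λ a b → w * α * a + w * β * b + γ * 0#)
               (trans (σ-+ x (β * r)) (cong (σ x +_) (σ-* β r)))
               (trans (σ-+ x (α * r)) (cong (σ x +_) (trans (σ-* α r) (cong (_* σ r) (trans (σ-+ 1# β) (cong (_+ σ β) σ-1)))))) ⟩
        w * α * (σ x + σ β * σ r) + w * β * (σ x + (1# + σ β) * σ r) + γ * 0#
          ≡⟨ solve₂ 6 (λ w b x e r g →
               w :* (con true :+ b) :* (x :+ e :* r) :+ w :* b :* (x :+ (con true :+ e) :* r) :+ g :* con false
                 := w :* (x :+ (e :+ b) :* r)) refl w β (σ x) (σ β) (σ r) γ ⟩
        w * (σ x + ℘ β * σ r)
          ≡⟨ cong (λ z → w * (σ x + z)) (trans (cong (℘ β *_) σr) (trans (sym (*-assoc _ _ _))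
               (trans (cong (_* (y + σ x)) (⁻¹-inverseʳ ℘β≢0)) (*-identityˡ _)))) ⟩
        w * (σ x + (y + σ x))
          ≡⟨ cong (w *_) (solve₂ 2 (λ x y → x :+ (y :+ x) := y) refl (σ x) y) ⟩
        w * y
          ≡⟨ w*w⁻¹ (Q 2F) ⟩
        Q 2F ∎)
      3F → solve₂ 3 (λ a b c → a := b :+ c :+ (a :+ b :+ c) :* con true) refl (Q 3F) (w * α * (σ s * s)) (w * β * (σ t * t))
    where
    open ≡-Reasoning
    w = Q 0F
    x = w ⁻¹ * Q 1F
    y = w ⁻¹ * Q 2F
    β = proj₁ not-fixed
    ℘β≢0 = proj₂ not-fixed
    α = 1# + β
    root = σ-surjective (℘ β ⁻¹ * (y + σ x))
    r = proj₁ root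
    σr = proj₂ root
    s = x + β * r
    t = x + α * r
    -- U₄ contributes to the last coordinate only, so γ absorbs whatever is missing there.
    γ = Q 3F + w * α * (σ s * s) + w * β * (σ t * t)
    w*w⁻¹ : ∀ z → w * (w ⁻¹ * z) ≡ z
    w*w⁻¹ z = trans (sym (*-assoc w _ z)) (trans (cong (_* z) (⁻¹-inverseʳ w≢0)) (*-identityˡ z))

  -- No plane on U₄, P_s and P_t contains U₂ or U₃, as σ is additive and injective.
  chord : ∀ {α β s t} → α + β ≡ 0# → α * s + β * t ≡ 0# → α * σ s + β * σ t ≡ 1# → ⊥
  chord {α} {β} {s} {t} α+β≡0 eq₁ eq₂ with +-≡0⇒≡ α+β≡0
  ... | refl with *-≡0 {α} {s + t} (trans (distribˡ α s t) eq₁)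
  ...   | inj₁ refl = contradiction (trans (sym eq₂) (solve₂ 2 (λ x y → con false :* x :+ con false :* y := con false) refl (σ s) (σ t))) 1≢0
  ...   | inj₂ s+t≡0 with +-≡0⇒≡ s+t≡0
  ...     | refl = contradiction (trans (sym eq₂) (x+x≡0 _)) 1≢0

  chord′ : ∀ {α β s t} → α + β ≡ 0# → α * s + β * t ≡ 1# → α * σ s + β * σ t ≡ 0# → ⊥
  chord′ {α} {β} {s} {t} α+β≡0 eq₁ eq₂ with +-≡0⇒≡ α+β≡0
  ... | refl with *-≡0 {α} {σ s + σ t} (trans (distribˡ α _ _) eq₂)
  ...   | inj₁ refl = contradiction (trans (sym eq₁) (solve₂ 2 (λ x y → con false :* x :+ con false :* y := con false) refl s t)) 1≢0
  ...   | inj₂ eq with σ-injective {s} {t} (+-≡0⇒≡ eq)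
  ...     | refl = contradiction (trans (sym eq₁) (x+x≡0 _)) 1≢0

  abstract
    G-arc : ∀ {g} → G h g → ∀ t → ∃[ t′ ] g • arc t ≈ arc t′
    G-arc {g} g∈G t = Arc⇒arc {g • arc t} (Equivalence.to (g∈G (arc t)) (arc∈Arc t))

    G-arc⁻¹ : ∀ {g s t} → g • arc s ≈ arc t → g ⁻¹ᵖ • arc t ≈ arc s
    G-arc⁻¹ {g} {s} {t} gs≈t = ≈-trans {g ⁻¹ᵖ • arc t} {g ⁻¹ᵖ • g • arc s} {arc s}
      (•-cong (g ⁻¹ᵖ) {arc t} {g • arc s} (≈-sym {g • arc s} {arc t} gs≈t)) (⁻¹ᵖ-•ˡ g (arc s))

  module Fixing-∞ {g} (g∈G : G h g) (g∞≈∞ : g • arc ∞ ≈ arc ∞) where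

    affine-image : ∀ s → ∃[ s′ ] g ⁻¹ᵖ • arc (inj₁ s) ≈ arc (inj₁ s′)
    affine-image s = image (G-arc {g ⁻¹ᵖ} (G-⁻¹ {g} g∈G) (inj₁ s))
      where
      image : ∃[ t ] g ⁻¹ᵖ • arc (inj₁ s) ≈ arc t → ∃[ s′ ] g ⁻¹ᵖ • arc (inj₁ s) ≈ arc (inj₁ s′)
      image (inj₁ s′ , eq) = s′ , eq
      image (∞ , eq) = contradiction s≡∞ λ ()
        where
        s≡∞ : inj₁ s ≡ ∞
        s≡∞ = arc-injective {inj₁ s} {∞} (≈-trans {arc (inj₁ s)} {g • arc ∞} {arc ∞}
          (≈-sym {g • arc ∞} {arc (inj₁ s)} (G-arc⁻¹ {g ⁻¹ᵖ} {inj₁ s} {∞} eq)) g∞≈∞)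

    InChord : Fin 4 → Set
    InChord j = ∃[ s ] ∃[ t ] ∃[ α ] ∃[ β ] ∃[ γ ]
      (∀ i → 1ᴹ i j ≡ combination α β γ (arcVec (inj₁ s)) (arcVec (inj₁ t)) (arcVec ∞) i)

    -- The column is the image of the j-th basis vector. If it is off the plane X₁ = 0, it lies in a
    -- span of U₄ and two affine points of the arc. Applying g⁻¹, which fixes U₄ and keeps affine
    -- points of the arc affine, puts the basis vector itself into such a span.
    column-in-chord : ∀ j → matrix g 0F j ≢ 0# → InChord j
    column-in-chord j ≢0 with secant-plane (λ i → matrix g i j) ≢0
    ... | s , t , α , β , γ , eq = combine (affine-image s) (affine-image t) (G-arc⁻¹ {g} {∞} {∞} g∞≈∞)
      where
      combine : ∃[ s′ ] g ⁻¹ᵖ • arc (inj₁ s) ≈ arc (inj₁ s′) → ∃[ t′ ] g ⁻¹ᵖ • arc (inj₁ t) ≈ arc (inj₁ t′) →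
        g ⁻¹ᵖ • arc ∞ ≈ arc ∞ → InChord j
      combine (s′ , a , _ , a-eq) (t′ , b , _ , b-eq) (c , _ , c-eq) = s′ , t′ , α * a , β * b , γ * c , λ i →
        trans (sym (inverseˡ g i j)) (image-of-combination (inv g) eq a-eq b-eq c-eq i)

    private
      γ-free : ∀ {x y z γ} → x ≡ y + z + γ * 0# → y + z ≡ x
      γ-free {x} {y} {z} {γ} eq = trans (solve₂ 3 (λ y z g → y :+ z := y :+ z :+ g :* con false) refl y z γ) (sym eq)
      units : ∀ {x α β γ} → x ≡ α * 1# + β * 1# + γ * 0# → α + β ≡ x
      units {x} {α} {β} eq = trans (sym (cong₂ _+_ (*-identityʳ α) (*-identityʳ β))) (γ-free eq)

    row-1 : matrix g 0F 1F ≡ 0#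
    row-1 = ≡0-stable λ ≢0 → no-chord (column-in-chord 1F ≢0)
      where
      no-chord : ¬ InChord 1F
      no-chord (_ , _ , _ , _ , _ , eq) = chord′ (units (eq 0F)) (γ-free (eq 1F)) (γ-free (eq 2F))

    row-2 : matrix g 0F 2F ≡ 0#
    row-2 = ≡0-stable λ ≢0 → no-chord (column-in-chord 2F ≢0)
      where
      no-chord : ¬ InChord 2F
      no-chord (_ , _ , _ , _ , _ , eq) = chord (units (eq 0F)) (γ-free (eq 1F)) (γ-free (eq 2F))

    row-3 : matrix g 0F 3F ≡ 0#
    row-3 = trans
      (solve₂ 4 (λ x y z w → w := x :* con false :+ (y :* con false :+ (z :* con false :+ (w :* con true :+ con false)))) refl
        (matrix g 0F 0F) (matrix g 0F 1F) (matrix g 0F 2F) (matrix g 0F 3F))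
      (trans (proj₂ (proj₂ g∞≈∞) 0F) (zeroʳ _))

    Osc-∞ : ∀ P → Osc P ∞ → Osc (g • P) ∞
    Osc-∞ P P₀≡0 = begin
      A 0F 0F * X 0F + (A 0F 1F * X 1F + (A 0F 2F * X 2F + (A 0F 3F * X 3F + 0#)))
        ≡⟨ cong₂ _+_ (cong (A 0F 0F *_) P₀≡0) (cong₂ _+_ (cong (_* X 1F) row-1)
             (cong₂ _+_ (cong (_* X 2F) row-2) (cong (λ z → z * X 3F + 0#) row-3))) ⟩
      A 0F 0F * 0# + (0# * X 1F + (0# * X 2F + (0# * X 3F + 0#)))
        ≡⟨ solve₂ 4 (λ a x y z → a :* con false :+ (con false :* x :+ (con false :* y :+ (con false :* z :+ con false))) := con false)
             refl (A 0F 0F) (X 1F) (X 2F) (X 3F) ⟩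
      0# ∎
      where
      open ≡-Reasoning
      A = matrix g
      X = coords P

  to-line : PG₁ → GL₂
  to-line (inj₁ t) = gl₂ 0# 1# 1# t λ eq → 1≢0 (trans (solve₂ 1 (λ t → con true := con false :* t :+ con true :* con true) refl t) eq)
  to-line ∞        = gl₂ 1# 0# 0# 1# λ eq → 1≢0 (trans (solve₂ 0 (con true := con true :* con true :+ con false :* con false) refl) eq)

  act-to-line : ∀ t i → act (to-line t) (line ∞) i ≡ line t i
  act-to-line (inj₁ t) 0F = solve₂ 0 (con false :* con false :+ con true :* con true := con true) refl
  act-to-line (inj₁ t) 1F = solve₂ 1 (λ t → con true :* con false :+ t :* con true := t) refl t
  act-to-line ∞        0F = solve₂ 0 (con true :* con false :+ con false :* con true := con false) refl
  act-to-line ∞        1F = solve₂ 0 (con false :* con false :+ con true :* con true := con true) refl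

  to-line-arc : ∀ t → proj (to-line t) • arc ∞ ≈ arc t
  to-line-arc t = ≗⇒≈ {proj (to-line t) • arc ∞} {arc t} λ i → begin
    (M B *ᵥ arcVec ∞) i             ≡⟨ *ᵥ-congʳ (M B) (veronese-line ∞) i ⟨
    (M B *ᵥ veronese (line ∞)) i    ≡⟨ M-veronese B (line ∞) i ⟩
    veronese (act B (line ∞)) i     ≡⟨ cong₂ (λ x y → σ x * y) (act-to-line t (hi i)) (act-to-line t (lo i)) ⟩
    veronese (line t) i             ≡⟨ trans (veronese-line t i) (sym (coords-arc t i)) ⟩
    coords (arc t) i                ∎
    where
    open ≡-Reasoning
    B = to-line t

  Osc-moves : ∀ B P {t t′ c} → c ≢ 0# → (∀ i → act B (line t) i ≡ c * line t′ i) → Osc P t ⇔ Osc (proj B • P) t′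
  Osc-moves B P {t} {t′} {c} c≢0 eq = mk⇔
    (λ P∈ → *-≡0ʳ (*-≢0 (σ-≢0 c≢0) c≢0) (trans (sym moved) (trans (cong (σ (det B) * det B *_) P∈) (zeroʳ _))))
    (λ BP∈ → *-≡0ʳ (*-≢0 (σ-≢0 (det≢0 B)) (det≢0 B)) (trans moved (trans (cong (σ c * c *_) BP∈) (zeroʳ _))))
    where
    open ≡-Reasoning
    X = coords P
    moved : σ (det B) * det B * osc X t ≡ σ c * c * osc (M B *ᵥ X) t′
    moved = begin
      σ (det B) * det B * osc X t             ≡⟨ cong (σ (det B) * det B *_) (form-line X t) ⟨
      σ (det B) * det B * form X (line t)     ≡⟨ M-form B X (line t) ⟨
      form (M B *ᵥ X) (act B (line t))        ≡⟨ form-scale (M B *ᵥ X) c eq ⟩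
      σ c * c * form (M B *ᵥ X) (line t′)     ≡⟨ cong (σ c * c *_) (form-line (M B *ᵥ X) t′) ⟩
      σ c * c * osc (M B *ᵥ X) t′             ∎

  Osc-to-line : ∀ P t → Osc P ∞ ⇔ Osc (proj (to-line t) • P) t
  Osc-to-line P t = Osc-moves (to-line t) P {∞} {t} 1≢0 λ i → trans (act-to-line t i) (sym (*-identityˡ _))

  Osc-resp : ∀ {P Q} → P ≈ Q → ∀ t → Osc P t → Osc Q t
  Osc-resp {P} {Q} (c , c≢0 , eq) t P∈ = *-≡0ʳ c≢0 (trans (sym (scale t)) P∈)
    where
    scale : ∀ t → osc (coords P) t ≡ c * osc (coords Q) t
    scale (inj₁ t) = trans
      (cong₂ _+_ (cong₂ _+_ (cong₂ _+_ (cong (σ t * t *_) (eq 0F)) (cong (σ t *_) (eq 1F))) (cong (t *_) (eq 2F))) (eq 3F))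
      (solve₂ 7 (λ c s t x y z w → s :* t :* (c :* x) :+ s :* (c :* y) :+ t :* (c :* z) :+ c :* w
          := c :* (s :* t :* x :+ s :* y :+ t :* z :+ w))
        refl c (σ t) t (coords Q 0F) (coords Q 1F) (coords Q 2F) (coords Q 3F))
    scale ∞ = eq 0F

  -- Conjugating by elements of GL₂ reduces this to the stabilizer of U₄.
  G-Osc : ∀ {g} → G h g → ∀ {P s t} → g • arc s ≈ arc t → Osc P s → Osc (g • P) t
  G-Osc {g} g∈G {P} {s} {t} gs≈t P∈ =
    Osc-resp {proj Bₜ • f • P′} {g • P}
      (≈-trans {proj Bₜ • f • P′} {g • proj Bₛ • P′} {g • P}
        (f-• P′)
        (•-cong g {proj Bₛ • P′} {P} (⁻¹ᵖ-•ʳ (proj Bₛ) P)))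
      t
      (Equivalence.to (Osc-to-line (f • P′) t) (Fixing-∞.Osc-∞ {f} f∈G f∞≈∞ P′
        (Equivalence.from (Osc-to-line P′ s)
          (Osc-resp {P} {proj Bₛ • P′} (≈-sym {proj Bₛ • P′} {P} (⁻¹ᵖ-•ʳ (proj Bₛ) P)) s P∈))))
    where
    Bₛ = to-line s
    Bₜ = to-line t
    f = proj Bₜ ⁻¹ᵖ ∘ᵖ (g ∘ᵖ proj Bₛ)
    P′ = proj Bₛ ⁻¹ᵖ • P
    f∈G : G h f
    f∈G = G-∘ {proj Bₜ ⁻¹ᵖ} {g ∘ᵖ proj Bₛ} (G-⁻¹ {proj Bₜ} (proj∈G Bₜ)) (G-∘ {g} {proj Bₛ} g∈G (proj∈G Bₛ))
    f-≈ : ∀ P → f • P ≈ proj Bₜ ⁻¹ᵖ • g • proj Bₛ • P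
    f-≈ P = ≈-trans {f • P} {proj Bₜ ⁻¹ᵖ • (g ∘ᵖ proj Bₛ) • P} {proj Bₜ ⁻¹ᵖ • g • proj Bₛ • P}
      (∘ᵖ-• (proj Bₜ ⁻¹ᵖ) (g ∘ᵖ proj Bₛ) P)
      (•-cong (proj Bₜ ⁻¹ᵖ) {(g ∘ᵖ proj Bₛ) • P} {g • proj Bₛ • P} (∘ᵖ-• g (proj Bₛ) P))
    f-• : ∀ P → proj Bₜ • f • P ≈ g • proj Bₛ • P
    f-• P = ≈-trans {proj Bₜ • f • P} {proj Bₜ • proj Bₜ ⁻¹ᵖ • g • proj Bₛ • P} {g • proj Bₛ • P}
      (•-cong (proj Bₜ) {f • P} {proj Bₜ ⁻¹ᵖ • g • proj Bₛ • P} (f-≈ P)) (⁻¹ᵖ-•ʳ (proj Bₜ) (g • proj Bₛ • P))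
    f∞≈∞ : f • arc ∞ ≈ arc ∞
    f∞≈∞ = ≈-trans {f • arc ∞} {proj Bₜ ⁻¹ᵖ • g • proj Bₛ • arc ∞} {arc ∞} (f-≈ (arc ∞))
      (≈-trans {proj Bₜ ⁻¹ᵖ • g • proj Bₛ • arc ∞} {proj Bₜ ⁻¹ᵖ • arc t} {arc ∞}
        (•-cong (proj Bₜ ⁻¹ᵖ) {g • proj Bₛ • arc ∞} {arc t}
          (≈-trans {g • proj Bₛ • arc ∞} {g • arc s} {arc t} (•-cong g {proj Bₛ • arc ∞} {arc s} (to-line-arc s)) gs≈t))
        (G-arc⁻¹ {proj Bₜ} {∞} {t} (to-line-arc t)))

  k : Point → ℕ
  k P = count PG₁-finite (Osc? P)

  k-cong : ∀ {P Q} → P ≈ Q → k P ≡ k Q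
  k-cong {P} {Q} P≈Q = count-cong PG₁-finite (Osc? P) (Osc? Q) (Osc-resp {P} {Q} P≈Q) (Osc-resp {Q} {P} (≈-sym {P} {Q} P≈Q))

  -- An element of `G h` permutes the parameters of the arc, and by `G-Osc` incidence with the
  -- osculating planes follows this permutation; the count is reindexed along it.
  k-invariant : ∀ {g} → G h g → ∀ P → k (g • P) ≡ k P
  k-invariant {g} g∈G P = begin
    total PG₁-finite (λ t → ind (Osc? (g • P) t))
      ≡⟨ total-reindex PG₁-finite PG₁-finite π π⁻¹ π⁻¹-π π-π⁻¹ (λ t → ind (Osc? (g • P) t)) ⟨
    total PG₁-finite (λ t → ind (Osc? (g • P) (π t)))
      ≡⟨ ∑-cong (elements PG₁-finite) (λ t → ind-cong (Osc? (g • P) (π t)) (Osc? P t)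
           (λ gP∈ → Osc-resp {g ⁻¹ᵖ • g • P} {P} (⁻¹ᵖ-•ˡ g P) t
             (G-Osc {g ⁻¹ᵖ} g⁻¹∈G {g • P} {π t} {t} (G-arc⁻¹ {g} {t} {π t} (π-• t)) gP∈))
           (G-Osc {g} g∈G {P} {t} {π t} (π-• t))) ⟩
    total PG₁-finite (λ t → ind (Osc? P t)) ∎
    where
    open ≡-Reasoning
    g⁻¹∈G = G-⁻¹ {g} g∈G
    π : PG₁ → PG₁
    π t = proj₁ (G-arc {g} g∈G t)
    π-• : ∀ t → g • arc t ≈ arc (π t)
    π-• t = proj₂ (G-arc {g} g∈G t)
    π⁻¹ : PG₁ → PG₁
    π⁻¹ t = proj₁ (G-arc {g ⁻¹ᵖ} g⁻¹∈G t)
    π⁻¹-• : ∀ t → g ⁻¹ᵖ • arc t ≈ arc (π⁻¹ t)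
    π⁻¹-• t = proj₂ (G-arc {g ⁻¹ᵖ} g⁻¹∈G t)
    π⁻¹-π : ∀ t → π⁻¹ (π t) ≡ t
    π⁻¹-π t = arc-injective (≈-trans {arc (π⁻¹ (π t))} {g ⁻¹ᵖ • arc (π t)} {arc t}
      (≈-sym {g ⁻¹ᵖ • arc (π t)} {arc (π⁻¹ (π t))} (π⁻¹-• (π t))) (G-arc⁻¹ {g} {t} {π t} (π-• t)))
    π-π⁻¹ : ∀ t → π (π⁻¹ t) ≡ t
    π-π⁻¹ t = arc-injective (≈-trans {arc (π (π⁻¹ t))} {g • arc (π⁻¹ t)} {arc t}
      (≈-sym {g • arc (π⁻¹ t)} {arc (π (π⁻¹ t))} (π-• (π⁻¹ t))) (G-arc⁻¹ {g ⁻¹ᵖ} {t} {π⁻¹ t} (π⁻¹-• t)))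

  -- Normal forms of points on osculating planes

  quad : Vector Carrier 4 → Carrier
  quad X = X 0F * X 3F + X 1F * X 2F

  -- Multiplicativity of the 2 × 2 determinant, with the signs gone.
  det-* : ∀ a b c d x y z w →
    (a * x + b * z) * (c * y + d * w) + (a * y + b * w) * (c * x + d * z) ≡ (a * d + b * c) * (x * w + y * z)
  det-* = solve₂ 8 (λ a b c d x y z w →
    (a :* x :+ b :* z) :* (c :* y :+ d :* w) :+ (a :* y :+ b :* w) :* (c :* x :+ d :* z)
      := (a :* d :+ b :* c) :* (x :* w :+ y :* z)) refl

  M-quad : ∀ B X → quad (M B *ᵥ X) ≡ σ (det B) * det B * quad X
  M-quad B@(gl₂ a b c d _) X = begin
    quad (M B *ᵥ X)
      ≡⟨ cong₂ _+_ (cong₂ _*_ (⊗-row (σ a) (σ b) a b X) (⊗-row (σ c) (σ d) c d X))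
           (cong₂ _*_ (⊗-row (σ a) (σ b) c d X) (⊗-row (σ c) (σ d) a b X)) ⟩
    (σ a * x + σ b * z) * (σ c * y + σ d * w) + (σ a * y + σ b * w) * (σ c * x + σ d * z)
      ≡⟨ det-* (σ a) (σ b) (σ c) (σ d) x y z w ⟩
    (σ a * σ d + σ b * σ c) * (x * w + y * z)
      ≡⟨ cong₂ _*_ (sym (σ-dot a b d c)) (solve₂ 8 (λ a b c d x y z w →
           (a :* x :+ b :* y) :* (c :* z :+ d :* w) :+ (c :* x :+ d :* y) :* (a :* z :+ b :* w)
             := (a :* d :+ b :* c) :* (x :* w :+ y :* z)) refl a b c d (X 0F) (X 1F) (X 2F) (X 3F)) ⟩
    σ (det B) * (det B * quad X)
      ≡⟨ *-assoc _ _ _ ⟨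
    σ (det B) * det B * quad X ∎
    where
    open ≡-Reasoning
    x = a * X 0F + b * X 1F
    y = c * X 0F + d * X 1F
    z = a * X 2F + b * X 3F
    w = c * X 2F + d * X 3F

  Quadric-proj : ∀ B P → Quadric (proj B • P) ⇔ Quadric P
  Quadric-proj B P = mk⇔
    (λ BP∈ → *-≡0ʳ (*-≢0 (σ-≢0 (det≢0 B)) (det≢0 B)) (trans (sym (M-quad B (coords P))) BP∈))
    (λ P∈ → trans (M-quad B (coords P)) (trans (cong (σ (det B) * det B *_) P∈) (zeroʳ _)))

  Quadric-resp : ∀ {P Q} → P ≈ Q → Quadric P → Quadric Q
  Quadric-resp {P} {Q} (c , c≢0 , eq) P∈ = *-≡0ʳ (*-≢0 c≢0 c≢0) (begin
    c * c * quad (coords Q)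
      ≡⟨ solve₂ 5 (λ c x y z w → c :* c :* (x :* w :+ y :* z) := c :* x :* (c :* w) :+ c :* y :* (c :* z))
           refl c (coords Q 0F) (coords Q 1F) (coords Q 2F) (coords Q 3F) ⟩
    c * coords Q 0F * (c * coords Q 3F) + c * coords Q 1F * (c * coords Q 2F)
      ≡⟨ cong₂ _+_ (cong₂ _*_ (eq 0F) (eq 3F)) (cong₂ _*_ (eq 1F) (eq 2F)) ⟨
    quad (coords P)
      ≡⟨ P∈ ⟩
    0# ∎)
    where open ≡-Reasoning

  Quadric-arc : ∀ t → Quadric (arc t)
  Quadric-arc (inj₁ t) = solve₂ 2 (λ s t → con true :* (s :* t) :+ t :* s := con false) refl (σ t) t
  Quadric-arc ∞        = solve₂ 0 (con false :* con true :+ con false :* con false := con false) refl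

  Arc⇒Quadric : ∀ {P} → Arc h P → Quadric P
  Arc⇒Quadric {P} P∈ = let t , P≈ = Arc⇒arc {P} P∈ in
    Quadric-resp {arc t} {P} (≈-sym {P} {arc t} P≈) (Quadric-arc t)

  -- A singular matrix with x ≠ 0 has both rows proportional to (1, t) for t = y / x. The equation
  -- of the plane at P_t pairs each row with (1, t) by an alternating form, so it vanishes.
  Quadric⇒Osc : ∀ P → Quadric P → ∃[ t ] Osc P t
  Quadric⇒Osc P P∈ with coords P 0F ≟ᶠ 0#
  ... | yes x≡0 = ∞ , x≡0
  ... | no x≢0  = inj₁ t , *-≡0ʳ x≢0 (begin
    x * (σ t * t * x + σ t * y + t * z + w)
      ≡⟨ solve₂ 6 (λ s t x y z w → x :* (s :* t :* x :+ s :* y :+ t :* z :+ w)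
           := (x :* s) :* (x :* t :+ y) :+ (x :* t) :* z :+ x :* w) refl (σ t) t x y z w ⟩
    x * σ t * (x * t + y) + x * t * z + x * w
      ≡⟨ cong (λ v → x * σ t * (v + y) + v * z + x * w) xt≡y ⟩
    x * σ t * (y + y) + y * z + x * w
      ≡⟨ solve₂ 5 (λ s x y z w → x :* s :* (y :+ y) :+ y :* z :+ x :* w := x :* w :+ y :* z) refl (σ t) x y z w ⟩
    x * w + y * z
      ≡⟨ P∈ ⟩
    0# ∎)
    where
    open ≡-Reasoning
    x = coords P 0F
    y = coords P 1F
    z = coords P 2F
    w = coords P 3F
    t = x ⁻¹ * y
    xt≡y : x * t ≡ y
    xt≡y = trans (sym (*-assoc x _ y)) (trans (cong (_* y) (⁻¹-inverseʳ x≢0)) (*-identityˡ y))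

  mat₂ : Carrier → Carrier → Carrier → Carrier → Fin 2 → Fin 2 → Carrier
  mat₂ a b c d 0F 0F = a
  mat₂ a b c d 0F 1F = b
  mat₂ a b c d 1F 0F = c
  mat₂ a b c d 1F 1F = d

  M-*ᵥ : ∀ B (A : Fin 2 → Fin 2 → Carrier) → (∀ i j → σ (ent B i j) ≡ A i j) → ∀ X i →
         (M B *ᵥ X) i ≡ sum (λ j → A (hi i) (hi j) * ent B (lo i) (lo j) * X j)
  M-*ᵥ B A eq X i = sum-cong-≗ {4} (λ j → cong (λ a → a * ent B (lo i) (lo j) * X j) (eq (hi i) (hi j)))

  -- On the parameters of the arc, this and the next two matrices are t ↦ t + s, t ↦ k t and t ↦ 1 /
  -- t. The first two fix ∞, hence preserve the plane X₁ = 0.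
  translation : Carrier → GL₂
  translation s = gl₂ 1# 0# s 1# λ eq → 1≢0 (trans (solve₂ 1 (λ s → con true := con true :* con true :+ con false :* s) refl s) eq)

  dilation : ∀ k → k ≢ 0# → GL₂
  dilation k k≢0 = gl₂ 1# 0# 0# k λ eq → k≢0 (trans (solve₂ 1 (λ k → k := con true :* k :+ con false :* con false) refl k) eq)

  swap : GL₂
  swap = gl₂ 0# 1# 1# 0# λ eq → 1≢0 (trans (solve₂ 0 (con true := con false :* con false :+ con true :* con true) refl) eq)

  translation-*ᵥ : ∀ s X → X 0F ≡ 0# → ∀ i →
    (M (translation s) *ᵥ X) i ≡ (0# ∷ X 1F ∷ X 2F ∷ σ s * X 1F + s * X 2F + X 3F ∷ []) i
  translation-*ᵥ s X X₀≡0 i = trans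
    (M-*ᵥ (translation s) (mat₂ 1# 0# (σ s) 1#) (λ { 0F 0F → σ-1 ; 0F 1F → σ-0 ; 1F 0F → refl ; 1F 1F → σ-1 }) X i)
    (trans (sum-cong-≗ {4} (λ j → cong (mat₂ 1# 0# (σ s) 1# (hi i) (hi j) * ent (translation s) (lo i) (lo j) *_) (X-eq j))) (expand i))
    where
    X′ : Vector Carrier 4
    X′ = 0# ∷ X 1F ∷ X 2F ∷ X 3F ∷ []
    X-eq : ∀ j → X j ≡ X′ j
    X-eq 0F = X₀≡0
    X-eq 1F = refl
    X-eq 2F = refl
    X-eq 3F = refl
    expand : ∀ i → sum (λ j → mat₂ 1# 0# (σ s) 1# (hi i) (hi j) * ent (translation s) (lo i) (lo j) * X′ j)
               ≡ (0# ∷ X 1F ∷ X 2F ∷ σ s * X 1F + s * X 2F + X 3F ∷ []) i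
    expand 0F = solve₂ 3 (λ x y z → con true :* con true :* con false :+ (con true :* con false :* x :+ (con false :* con true :* y :+ (con false :* con false :* z :+ con false))) := con false) refl (X 1F) (X 2F) (X 3F)
    expand 1F = solve₂ 4 (λ s x y z → con true :* s :* con false :+ (con true :* con true :* x :+ (con false :* s :* y :+ (con false :* con true :* z :+ con false))) := x) refl s (X 1F) (X 2F) (X 3F)
    expand 2F = solve₂ 4 (λ s x y z → s :* con true :* con false :+ (s :* con false :* x :+ (con true :* con true :* y :+ (con true :* con false :* z :+ con false))) := y) refl (σ s) (X 1F) (X 2F) (X 3F)
    expand 3F = solve₂ 5 (λ t s x y z → t :* s :* con false :+ (t :* con true :* x :+ (con true :* s :* y :+ (con true :* con true :* z :+ con false))) := t :* x :+ s :* y :+ z) refl (σ s) s (X 1F) (X 2F) (X 3F)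

  dilation-*ᵥ : ∀ k k≢0 X i →
    (M (dilation k k≢0) *ᵥ X) i ≡ (X 0F ∷ k * X 1F ∷ σ k * X 2F ∷ σ k * k * X 3F ∷ []) i
  dilation-*ᵥ k k≢0 X i = trans
    (M-*ᵥ (dilation k k≢0) (mat₂ 1# 0# 0# (σ k)) (λ { 0F 0F → σ-1 ; 0F 1F → σ-0 ; 1F 0F → σ-0 ; 1F 1F → refl }) X i)
    (expand i)
    where
    expand : ∀ i → sum (λ j → mat₂ 1# 0# 0# (σ k) (hi i) (hi j) * ent (dilation k k≢0) (lo i) (lo j) * X j)
               ≡ (X 0F ∷ k * X 1F ∷ σ k * X 2F ∷ σ k * k * X 3F ∷ []) i
    expand 0F = solve₂ 4 (λ w x y z → con true :* con true :* w :+ (con true :* con false :* x :+ (con false :* con true :* y :+ (con false :* con false :* z :+ con false))) := w) refl (X 0F) (X 1F) (X 2F) (X 3F)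
    expand 1F = solve₂ 5 (λ k w x y z → con true :* con false :* w :+ (con true :* k :* x :+ (con false :* con false :* y :+ (con false :* k :* z :+ con false))) := k :* x) refl k (X 0F) (X 1F) (X 2F) (X 3F)
    expand 2F = solve₂ 5 (λ k w x y z → con false :* con true :* w :+ (con false :* con false :* x :+ (k :* con true :* y :+ (k :* con false :* z :+ con false))) := k :* y) refl (σ k) (X 0F) (X 1F) (X 2F) (X 3F)
    expand 3F = solve₂ 6 (λ t k w x y z → con false :* con false :* w :+ (con false :* k :* x :+ (t :* con false :* y :+ (t :* k :* z :+ con false))) := t :* k :* z) refl (σ k) k (X 0F) (X 1F) (X 2F) (X 3F)

  swap-*ᵥ : ∀ X i → (M swap *ᵥ X) i ≡ (X 3F ∷ X 2F ∷ X 1F ∷ X 0F ∷ []) i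
  swap-*ᵥ X i = trans
    (M-*ᵥ swap (mat₂ 0# 1# 1# 0#) (λ { 0F 0F → σ-0 ; 0F 1F → σ-1 ; 1F 0F → σ-1 ; 1F 1F → σ-0 }) X i)
    (expand i)
    where
    expand : ∀ i → sum (λ j → mat₂ 0# 1# 1# 0# (hi i) (hi j) * ent swap (lo i) (lo j) * X j)
               ≡ (X 3F ∷ X 2F ∷ X 1F ∷ X 0F ∷ []) i
    expand 0F = solve₂ 4 (λ w x y z → con false :* con false :* w :+ (con false :* con true :* x :+ (con true :* con false :* y :+ (con true :* con true :* z :+ con false))) := z) refl (X 0F) (X 1F) (X 2F) (X 3F)
    expand 1F = solve₂ 4 (λ w x y z → con false :* con true :* w :+ (con false :* con false :* x :+ (con true :* con true :* y :+ (con true :* con false :* z :+ con false))) := y) refl (X 0F) (X 1F) (X 2F) (X 3F)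
    expand 2F = solve₂ 4 (λ w x y z → con true :* con false :* w :+ (con true :* con true :* x :+ (con false :* con false :* y :+ (con false :* con true :* z :+ con false))) := x) refl (X 0F) (X 1F) (X 2F) (X 3F)
    expand 3F = solve₂ 4 (λ w x y z → con true :* con true :* w :+ (con true :* con false :* x :+ (con false :* con true :* y :+ (con false :* con false :* z :+ con false))) := w) refl (X 0F) (X 1F) (X 2F) (X 3F)

  Orbit-proj : ∀ B {P Q} → proj B • P ≈ Q → Orbit h P Q
  Orbit-proj B {P} {Q} BP≈Q = proj B , proj∈G B , ≈-sym {proj B • P} {Q} BP≈Q

  Orbit-≈ : ∀ {P Q} → P ≈ Q → Orbit h P Q
  Orbit-≈ {P} {Q} P≈Q = proj B , proj∈G B , ≈-trans {Q} {P} {proj B • P} (≈-sym {P} {Q} P≈Q)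
    (≗⇒≈ {P} {proj B • P} λ i → sym (trans (*ᵥ-congˡ (coords P) (λ i j → trans (cong₂ (λ a b → σ a * b) (B-δ (hi i) (hi j)) (B-δ (lo i) (lo j))) (δ₂-⊗ i j)) i)
      (1ᴹ-*ᵥ (coords P) i)))
    where
    B = to-line ∞
    B-δ : ∀ i j → ent B i j ≡ δ₂ i j
    B-δ 0F 0F = refl
    B-δ 0F 1F = refl
    B-δ 1F 0F = refl
    B-δ 1F 1F = refl

  U₂ : Point
  U₂ = point (0# ∷ 1# ∷ 0# ∷ 0# ∷ []) λ ≡0 → 1≢0 (≡0 1F)

  ⟨0,1,1,_⟩ : Carrier → Point
  ⟨0,1,1, c ⟩ = point (0# ∷ 1# ∷ 1# ∷ c ∷ []) λ ≡0 → 1≢0 (≡0 1F)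

  -- Membership in the quadric is recorded because `~arc` and `~one` have the same number of
  -- osculating planes.
  data Class (P : Point) : Set where
    ~arc       : Quadric P → Orbit h (arc ∞) P → Class P
    ~quadric   : Quadric P → Orbit h U₂ P → Class P
    ~three     : ¬ Quadric P → Orbit h ⟨0,1,1, 0# ⟩ P → Class P
    ~one       : ¬ Quadric P → Orbit h ⟨0,1,1, c₀ ⟩ P → Class P

  classify-∞ : ∀ P → Osc P ∞ → Class P
  classify-∞ P P₀≡0 = cases (y ≟ᶠ 0#) (z ≟ᶠ 0#)
    where
    open ≡-Reasoning
    y = coords P 1F
    z = coords P 2F
    w = coords P 3F

    quad-eq : quad (coords P) ≡ y * z
    quad-eq = trans (cong (λ x → x * w + y * z) P₀≡0) (trans (cong (_+ y * z) (zeroˡ w)) (+-identityˡ _))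

    on-arc-case : y ≡ 0# → z ≡ 0# → P ≈ arc ∞
    on-arc-case y≡0 z≡0 = w , (λ w≡0 → nonzero P λ { 0F → P₀≡0 ; 1F → y≡0 ; 2F → z≡0 ; 3F → w≡0 }) , λ where
      0F → trans P₀≡0 (sym (zeroʳ w))
      1F → trans y≡0 (sym (zeroʳ w))
      2F → trans z≡0 (sym (zeroʳ w))
      3F → sym (*-identityʳ w)

    y-case : y ≢ 0# → z ≡ 0# → Orbit h P U₂
    y-case y≢0 z≡0 = Orbit-proj (translation s) {P} {U₂} (y , y≢0 , λ i → trans (translation-*ᵥ s (coords P) P₀≡0 i) (eq i))
      where
      s = proj₁ (σ-surjective (w * y ⁻¹))
      last : σ s * y + s * z + w ≡ 0#
      last = begin
        σ s * y + s * z + w            ≡⟨ cong₂ (λ a b → a * y + s * b + w) (proj₂ (σ-surjective (w * y ⁻¹))) z≡0 ⟩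
        w * y ⁻¹ * y + s * 0# + w      ≡⟨ solve₂ 4 (λ w i y s → w :* i :* y :+ s :* con false :+ w := w :* (i :* y) :+ w) refl w (y ⁻¹) y s ⟩
        w * (y ⁻¹ * y) + w             ≡⟨ cong (λ e → w * e + w) (⁻¹-inverseˡ y≢0) ⟩
        w * 1# + w                     ≡⟨ ≡⇒+-≡0 (*-identityʳ w) ⟩
        0#                             ∎
      eq : ∀ i → (0# ∷ y ∷ z ∷ σ s * y + s * z + w ∷ []) i ≡ y * coords U₂ i
      eq 0F = sym (zeroʳ y)
      eq 1F = sym (*-identityʳ y)
      eq 2F = trans z≡0 (sym (zeroʳ y))
      eq 3F = trans last (sym (zeroʳ y))

    U₃ : Point
    U₃ = point (0# ∷ 0# ∷ 1# ∷ 0# ∷ []) λ ≡0 → 1≢0 (≡0 2F)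

    z-case : y ≡ 0# → z ≢ 0# → Orbit h P U₂
    z-case y≡0 z≢0 = Orbit-trans {P} {U₃} {U₂}
      (Orbit-proj (translation s) {P} {U₃} (z , z≢0 , λ i → trans (translation-*ᵥ s (coords P) P₀≡0 i) (eq i)))
      (Orbit-proj swap {U₃} {U₂} (≗⇒≈ {proj swap • U₃} {U₂} λ i → trans (swap-*ᵥ (coords U₃) i)
        (U₃-eq i)))
      where
      -- With y = 0 the last coordinate s z + w is linear in s; in `y-case` it is σ s · y + w, which
      -- needs a preimage under σ.
      s = w * z ⁻¹
      last : σ s * y + s * z + w ≡ 0#
      last = begin
        σ s * y + s * z + w            ≡⟨ cong (λ a → σ s * a + s * z + w) y≡0 ⟩
        σ s * 0# + w * z ⁻¹ * z + w    ≡⟨ solve₂ 4 (λ w i z t → t :* con false :+ w :* i :* z :+ w := w :* (i :* z) :+ w) refl w (z ⁻¹) z (σ s) ⟩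
        w * (z ⁻¹ * z) + w             ≡⟨ cong (λ e → w * e + w) (⁻¹-inverseˡ z≢0) ⟩
        w * 1# + w                     ≡⟨ ≡⇒+-≡0 (*-identityʳ w) ⟩
        0#                             ∎
      eq : ∀ i → (0# ∷ y ∷ z ∷ σ s * y + s * z + w ∷ []) i ≡ z * coords U₃ i
      eq 0F = sym (zeroʳ z)
      eq 1F = trans y≡0 (sym (zeroʳ z))
      eq 2F = sym (*-identityʳ z)
      eq 3F = trans last (sym (zeroʳ z))
      U₃-eq : ∀ i → (0# ∷ 1# ∷ 0# ∷ 0# ∷ []) i ≡ coords U₂ i
      U₃-eq 0F = refl
      U₃-eq 1F = refl
      U₃-eq 2F = refl
      U₃-eq 3F = refl

    yz-case : y ≢ 0# → z ≢ 0# → ∃[ c ] Orbit h P ⟨0,1,1, c ⟩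
    yz-case y≢0 z≢0 = c , Orbit-proj (dilation μ μ≢0) {P} {⟨0,1,1, c ⟩}
      (μ * y , μy≢0 , λ i → trans (dilation-*ᵥ μ μ≢0 (coords P) i) (eq i))
      where
      -- The dilation by μ turns y and z into μ y and σ μ · z; these agree when σ μ / μ = y / z.
      eigen = σ-eigen (y * z ⁻¹) (*-≢0 y≢0 (⁻¹-≢0 z≢0))
      μ = proj₁ eigen
      μ≢0 = proj₁ (proj₂ eigen)
      μy≢0 = *-≢0 μ≢0 y≢0
      c = (μ * y) ⁻¹ * (σ μ * μ * w)
      eq : ∀ i → (coords P 0F ∷ μ * y ∷ σ μ * z ∷ σ μ * μ * w ∷ []) i ≡ μ * y * coords ⟨0,1,1, c ⟩ i
      eq 0F = trans P₀≡0 (sym (zeroʳ _))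
      eq 1F = sym (*-identityʳ _)
      eq 2F = begin
        σ μ * z                 ≡⟨ cong (_* z) (proj₂ (proj₂ eigen)) ⟩
        y * z ⁻¹ * μ * z        ≡⟨ solve₂ 4 (λ y i μ z → y :* i :* μ :* z := μ :* y :* (i :* z)) refl y (z ⁻¹) μ z ⟩
        μ * y * (z ⁻¹ * z)      ≡⟨ cong (μ * y *_) (⁻¹-inverseˡ z≢0) ⟩
        μ * y * 1#              ∎
      eq 3F = sym (trans (sym (*-assoc _ _ _)) (trans (cong (_* (σ μ * μ * w)) (⁻¹-inverseʳ μy≢0)) (*-identityˡ _)))

    -- Translation by s adds ℘ s to the last coordinate of (0, 1, 1, c), so only the coset of c
    -- modulo the image of ℘ matters.
    shift : ∀ c d s → ℘ s ≡ c + d → Orbit h ⟨0,1,1, c ⟩ ⟨0,1,1, d ⟩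
    shift c d s ℘s≡ = Orbit-proj (translation s) {⟨0,1,1, c ⟩} {⟨0,1,1, d ⟩}
      (≗⇒≈ {proj (translation s) • ⟨0,1,1, c ⟩} {⟨0,1,1, d ⟩} λ i → trans (translation-*ᵥ s (coords ⟨0,1,1, c ⟩) refl i) (eq i))
      where
      eq : ∀ i → (0# ∷ 1# ∷ 1# ∷ σ s * 1# + s * 1# + c ∷ []) i ≡ coords ⟨0,1,1, d ⟩ i
      eq 0F = refl
      eq 1F = refl
      eq 2F = refl
      eq 3F = begin
        σ s * 1# + s * 1# + c    ≡⟨ solve₂ 3 (λ t s c → t :* con true :+ s :* con true :+ c := (t :+ s) :+ c) refl (σ s) s c ⟩
        ℘ s + c                  ≡⟨ cong (_+ c) ℘s≡ ⟩
        c + d + c                ≡⟨ solve₂ 2 (λ c d → c :+ d :+ c := d) refl c d ⟩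
        d                        ∎

    yz-class : y ≢ 0# → z ≢ 0# → ∃[ c ] Orbit h P ⟨0,1,1, c ⟩ → Class P
    yz-class y≢0 z≢0 (c , P~c) with ℘-index-two c
    ... | inj₁ (s , ℘s≡) = ~three (λ P∈ → *-≢0 y≢0 z≢0 (trans (sym quad-eq) P∈))
      (Orbit-sym {P} {⟨0,1,1, 0# ⟩} (Orbit-trans {P} {⟨0,1,1, c ⟩} {⟨0,1,1, 0# ⟩} P~c (shift c 0# s (trans ℘s≡ (sym (+-identityʳ c))))))
    ... | inj₂ (s , ℘s≡) = ~one (λ P∈ → *-≢0 y≢0 z≢0 (trans (sym quad-eq) P∈))
      (Orbit-sym {P} {⟨0,1,1, c₀ ⟩} (Orbit-trans {P} {⟨0,1,1, c ⟩} {⟨0,1,1, c₀ ⟩} P~c (shift c c₀ s ℘s≡)))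

    cases : Dec (y ≡ 0#) → Dec (z ≡ 0#) → Class P
    cases (yes y≡0) (yes z≡0) = ~arc (trans quad-eq (trans (cong (_* z) y≡0) (zeroˡ z)))
      (Orbit-≈ {arc ∞} {P} (≈-sym {P} {arc ∞} (on-arc-case y≡0 z≡0)))
    cases (yes y≡0) (no z≢0)  = ~quadric (trans quad-eq (trans (cong (_* z) y≡0) (zeroˡ z)))
      (Orbit-sym {P} {U₂} (z-case y≡0 z≢0))
    cases (no y≢0)  (yes z≡0) = ~quadric (trans quad-eq (trans (cong (y *_) z≡0) (zeroʳ y)))
      (Orbit-sym {P} {U₂} (y-case y≢0 z≡0))
    cases (no y≢0)  (no z≢0)  = yz-class y≢0 z≢0 (yz-case y≢0 z≢0)

  classify-Osc : ∀ P t → Osc P t → Class P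
  classify-Osc P t P∈ = transport (classify-∞ P′ (Equivalence.from (Osc-to-line P′ t) (Osc-resp {P} {proj B • P′} P≈BP′ t P∈)))
    where
    B = to-line t
    P′ = proj B ⁻¹ᵖ • P
    P≈BP′ : P ≈ proj B • P′
    P≈BP′ = ≈-sym {proj B • P′} {P} (⁻¹ᵖ-•ʳ (proj B) P)
    P′~P : Orbit h P′ P
    P′~P = proj B , proj∈G B , P≈BP′
    quad-to : Quadric P′ → Quadric P
    quad-to P′∈ = Quadric-resp {proj B • P′} {P} (⁻¹ᵖ-•ʳ (proj B) P) (Equivalence.from (Quadric-proj B P′) P′∈)
    quad-from : Quadric P → Quadric P′
    quad-from P∈Q = Equivalence.to (Quadric-proj B P′) (Quadric-resp {P} {proj B • P′} P≈BP′ P∈Q)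
    transport : Class P′ → Class P
    transport (~arc q o)     = ~arc (quad-to q) (Orbit-trans {arc ∞} {P′} {P} o P′~P)
    transport (~quadric q o) = ~quadric (quad-to q) (Orbit-trans {U₂} {P′} {P} o P′~P)
    transport (~three ¬q o)     = ~three (¬q ∘ quad-from) (Orbit-trans {⟨0,1,1, 0# ⟩} {P′} {P} o P′~P)
    transport (~one ¬q o)       = ~one (¬q ∘ quad-from) (Orbit-trans {⟨0,1,1, c₀ ⟩} {P′} {P} o P′~P)

  classify : ∀ P → k P ≡ 0 ⊎ Class P
  classify P with search PG₁-finite (Osc? P)
  ... | inj₁ (t , P∈) = inj₂ (classify-Osc P t P∈)
  ... | inj₂ none     = inj₁ (count-none PG₁-finite (Osc? P) none)

  k-orbit : ∀ {P Q} → Orbit h P Q → k Q ≡ k P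
  k-orbit {P} {Q} (g , g∈G , Q≈gP) = trans (k-cong {Q} {g • P} Q≈gP) (k-invariant {g} g∈G P)

  k-split : ∀ P → k P ≡ count field-finite (Osc? P ∘ inj₁) ℕ.+ ind (Osc? P ∞)
  k-split P = trans (total-⊎ field-finite ⊤-finite (ind ∘ Osc? P))
    (cong (count field-finite (Osc? P ∘ inj₁) ℕ.+_) (ℕ.+-identityʳ _))

  k-at-∞ : ∀ P m → Osc P ∞ → count field-finite (Osc? P ∘ inj₁) ≡ m → k P ≡ suc m
  k-at-∞ P m P∈ eq = trans (k-split P) (trans (cong₂ ℕ._+_ eq (ind-yes (Osc? P ∞) P∈)) (ℕ.+-comm m 1))

  k-arc : k (arc ∞) ≡ 1
  k-arc = k-at-∞ (arc ∞) 0 refl (count-none field-finite (Osc? (arc ∞) ∘ inj₁) λ t eq → 1≢0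
    (trans (solve₂ 2 (λ s t → con true := s :* t :* con false :+ s :* con false :+ t :* con false :+ con true) refl (σ t) t) eq))

  k-U₂ : k U₂ ≡ 2
  k-U₂ = k-at-∞ U₂ 1 refl (trans
    (count-cong field-finite (Osc? U₂ ∘ inj₁) (0# ≟ᶠ_)
      (λ t eq → sym (σ-≡0 (trans (sym (osc-eq t)) eq)))
      (λ { t refl → trans (osc-eq 0#) σ-0 }))
    (count-≡ field-finite 0#))
    where
    osc-eq : ∀ t → osc (coords U₂) (inj₁ t) ≡ σ t
    osc-eq t = solve₂ 2 (λ s t → s :* t :* con false :+ s :* con true :+ t :* con false :+ con false := s) refl (σ t) t

  -- The plane at P_t contains the point exactly when ℘ t = c; the additional plane is X₁ = 0.
  k-⟨0,1,1,_⟩ : ∀ c → k ⟨0,1,1, c ⟩ ≡ suc (℘-fibre c)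
  k-⟨0,1,1, c ⟩ = k-at-∞ ⟨0,1,1, c ⟩ (℘-fibre c) refl (count-cong field-finite (Osc? ⟨0,1,1, c ⟩ ∘ inj₁) (λ t → ℘ t ≟ᶠ c)
    (λ t eq → +-≡0⇒≡ (trans (sym (osc-eq t)) eq))
    (λ t eq → trans (osc-eq t) (≡⇒+-≡0 eq)))
    where
    osc-eq : ∀ t → osc (coords ⟨0,1,1, c ⟩) (inj₁ t) ≡ ℘ t + c
    osc-eq t = solve₂ 3 (λ s t c → s :* t :* con false :+ s :* con true :+ t :* con true :+ c := s :+ t :+ c) refl (σ t) t c

  k-three : k ⟨0,1,1, 0# ⟩ ≡ 3
  k-three = trans (k-⟨0,1,1, 0# ⟩) (cong suc (trans (cong ℘-fibre (sym (trans (cong (_+ 0#) σ-0) (+-identityʳ 0#)))) (℘-fibre-2 0#)))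

  k-one : k ⟨0,1,1, c₀ ⟩ ≡ 1
  k-one = trans (k-⟨0,1,1, c₀ ⟩) (cong suc (count-none field-finite (λ t → ℘ t ≟ᶠ c₀) c₀∉℘))

  -- Sizes of sets of points

  hasSize : {A : Set} (FA : Finite A) (e : A → Point) → (∀ {a b} → e a ≈ e b → a ≡ b) →
    {S : Pred Point _} (S? : ∀ a → Dec (S (e a))) → (∀ P → S P → ∃[ a ] S (e a) × P ≈ e a) →
    HasSize S (count FA S?)
  hasSize FA e e-injective {S} S? cover = subst (HasSize S) (∑-filter S? (elements FA)) record
    { to        = to
    ; cong      = λ { {i} refl → ≗⇒≈ {proj₁ (to i)} {proj₁ (to i)} λ _ → refl }
    ; bijective = (λ to≈ → Unique⇒lookup-injective (Unique.filter⁺ S? (unique FA)) (e-injective to≈)) , surjective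
    }
    where
    ys = filter S? (elements FA)
    to : Fin (length ys) → ∃[ P ] S P
    to i = e (lookup ys i) , proj₂ (∈-filter⁻ S? {xs = elements FA} (∈-lookup i))
    surjective : ∀ y → ∃[ i ] (∀ {j} → j ≡ i → proj₁ (to j) ≈ proj₁ y)
    surjective (P , P∈) = hit (cover P P∈)
      where
      hit : ∃[ a ] S (e a) × P ≈ e a → ∃[ i ] (∀ {j} → j ≡ i → proj₁ (to j) ≈ P)
      hit (a , ea∈ , P≈) = index a∈ , λ { refl → subst (λ b → e b ≈ P) (lookup-index a∈) (≈-sym {P} {e a} P≈) }
        where a∈ = ∈-filter⁺ S? (complete FA a) ea∈

  hasSize-≤ : ∀ {S m l} → HasSize S m → HasSize S l → m ℕ.≤ l
  hasSize-≤ {S} β γ = Fin.injective⇒≤ {f = f} λ {i} {j} fi≡fj → B.injective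
    (≈-trans {proj₁ (B.to i)} {proj₁ (C.to (f i))} {proj₁ (B.to j)}
      (≈-sym {proj₁ (C.to (f i))} {proj₁ (B.to i)} (f-≈ i))
      (subst (λ x → proj₁ (C.to x) ≈ proj₁ (B.to j)) (sym fi≡fj) (f-≈ j)))
    where
    module B = Bijection β
    module C = Bijection γ
    f : _ → _
    f i = proj₁ (C.surjective (B.to i))
    f-≈ : ∀ i → proj₁ (C.to (f i)) ≈ proj₁ (B.to i)
    f-≈ i = proj₂ (C.surjective (B.to i)) refl

  -- Lets `OnExactly`, which asserts a bijection, be exchanged for an equation on k.
  hasSize-unique : ∀ {S m l} → HasSize S m → HasSize S l → m ≡ l
  hasSize-unique β γ = ℕ.≤-antisym (hasSize-≤ β γ) (hasSize-≤ γ β)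

  hasSize-resp : ∀ {S T m} → S ≐ T → HasSize S m → HasSize T m
  hasSize-resp {S} {T} (S⊆T , T⊆S) β = record
    { to        = λ i → proj₁ (B.to i) , S⊆T (proj₂ (B.to i))
    ; cong      = B.cong
    ; bijective = B.injective , λ (P , P∈) → B.surjective (P , T⊆S P∈)
    }
    where module B = Bijection β

  polar-≈ : ∀ {P Q} → P ≈ Q → polar P ≈ polar Q
  polar-≈ (c , c≢0 , eq) = c , c≢0 , λ i → eq (opposite i)

  polar-≈⁻ : ∀ {P Q} → polar P ≈ polar Q → P ≈ Q
  polar-≈⁻ (c , c≢0 , eq) = c , c≢0 , λ { 0F → eq 3F ; 1F → eq 2F ; 2F → eq 1F ; 3F → eq 0F }

  ∈ᵖ-resp : ∀ {P π ρ} → π ≈ ρ → P ∈ᵖ π → P ∈ᵖ ρ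
  ∈ᵖ-resp {P} {π} {ρ} (c , c≢0 , eq) P∈ = *-≡0ʳ c≢0 (trans (sym scale) P∈)
    where
    scale : sum (λ i → coords π i * coords P i) ≡ c * sum (λ i → coords ρ i * coords P i)
    scale = trans (sum-cong-≗ {4} (λ i → trans (cong (_* coords P i) (eq i)) (*-assoc c _ _)))
                  (sym (*-distribˡ-sum c (λ i → coords ρ i * coords P i)))

  Osc⇒∈ᵖ : ∀ P t → Osc P t → P ∈ᵖ polar (arc t)
  Osc⇒∈ᵖ P t P∈ = trans (∈ᵖ-osc P t) P∈

  ∈ᵖ⇒Osc : ∀ P t → P ∈ᵖ polar (arc t) → Osc P t
  ∈ᵖ⇒Osc P t P∈ = trans (sym (∈ᵖ-osc P t)) P∈

  Osculating-polar : ∀ t → Osculating h (polar (arc t))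
  Osculating-polar t = arc t , arc∈Arc t , ≗⇒≈ {polar (arc t)} {polar (arc t)} λ _ → refl

  Osculating⇒polar : ∀ π → Osculating h π → ∃[ t ] π ≈ polar (arc t)
  Osculating⇒polar π (Q , Q∈ , π≈) = let t , Q≈ = Arc⇒arc {Q} Q∈ in
    t , ≈-trans {π} {polar Q} {polar (arc t)} π≈ (polar-≈ {Q} {arc t} Q≈)

  onExactly-k : ∀ P → OnExactly (k P) OsculatingPlanes h P
  onExactly-k P = subst (λ m → OnExactly m OsculatingPlanes h P)
    (count-cong PG₁-finite on? (Osc? P) (λ t (_ , P∈) → ∈ᵖ⇒Osc P t P∈) (λ t P∈ → Osculating-polar t , Osc⇒∈ᵖ P t P∈))
    (hasSize PG₁-finite (polar ∘ arc) (λ {s} {t} eq → arc-injective (polar-≈⁻ {arc s} {arc t} eq)) on?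
      λ π (π∈ , P∈) → let t , π≈ = Osculating⇒polar π π∈ in
        t , (Osculating-polar t , ∈ᵖ-resp {P} {π} {polar (arc t)} π≈ P∈) , π≈)
    where
    on? : ∀ t → Dec (Osculating h (polar (arc t)) × P ∈ᵖ polar (arc t))
    on? t = map′ (λ P∈ → Osculating-polar t , Osc⇒∈ᵖ P t P∈) (λ (_ , P∈) → ∈ᵖ⇒Osc P t P∈) (Osc? P t)

  onExactly⇔k : ∀ P m → OnExactly m OsculatingPlanes h P ⇔ k P ≡ m
  onExactly⇔k P m = mk⇔ (λ β → hasSize-unique (onExactly-k P) β) λ { refl → onExactly-k P }

  𝒪₀⇔k : ∀ P → 𝒪₀ h P ⇔ k P ≡ 0
  𝒪₀⇔k P = mk⇔
    (λ P∈ → count-none PG₁-finite (Osc? P) λ t P∈t → P∈ (polar (arc t)) (Osculating-polar t) (Osc⇒∈ᵖ P t P∈t))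
    (λ k≡0 π π∈ P∈ → let t , π≈ = Osculating⇒polar π π∈ in
      count≡0 PG₁-finite (Osc? P) k≡0 t (∈ᵖ⇒Osc P t (∈ᵖ-resp {P} {π} {polar (arc t)} π≈ P∈)))

  -- Normalized coordinates and the counting of flags

  NormalPoint : Set
  NormalPoint = (Carrier × Carrier × Carrier) ⊎ (Carrier × Carrier) ⊎ Carrier ⊎ ⊤

  pattern ⟨1,_,_,_⟩ x y z = inj₁ (x , y , z)
  pattern ⟨0,1,_,_⟩ y z   = inj₂ (inj₁ (y , z))
  pattern ⟨0,0,1,_⟩ z     = inj₂ (inj₂ (inj₁ z))
  pattern ⟨0,0,0,1⟩       = inj₂ (inj₂ (inj₂ tt))

  normals : Finite NormalPoint
  normals = field-finite ×-finite field-finite ×-finite field-finite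
    ⊎-finite field-finite ×-finite field-finite ⊎-finite field-finite ⊎-finite ⊤-finite

  pt : NormalPoint → Point
  pt ⟨1, x , y , z ⟩ = point (1# ∷ x ∷ y ∷ z ∷ []) λ ≡0 → 1≢0 (≡0 0F)
  pt ⟨0,1, y , z ⟩   = point (0# ∷ 1# ∷ y ∷ z ∷ []) λ ≡0 → 1≢0 (≡0 1F)
  pt ⟨0,0,1, z ⟩     = point (0# ∷ 0# ∷ 1# ∷ z ∷ []) λ ≡0 → 1≢0 (≡0 2F)
  pt ⟨0,0,0,1⟩       = point (0# ∷ 0# ∷ 0# ∷ 1# ∷ []) λ ≡0 → 1≢0 (≡0 3F)

  pt-injective : ∀ {X Y} → pt X ≈ pt Y → X ≡ Y
  pt-injective {X} {Y} (c , c≢0 , eq) = inj X Y c≢0 eq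
    where
    0≢ : ∀ {c} → c ≢ 0# → 0# ≢ c * 1#
    0≢ c≢0 eq = c≢0 (trans (sym (*-identityʳ _)) (sym eq))
    1≢ : ∀ {c} → 1# ≢ c * 0#
    1≢ eq = 1≢0 (trans eq (zeroʳ _))
    unscale : ∀ {c x y} → 1# ≡ c * 1# → x ≡ c * y → x ≡ y
    unscale {c} {x} {y} 1≡c x≡cy = trans x≡cy (trans (cong (_* y) (trans (sym (*-identityʳ c)) (sym 1≡c))) (*-identityˡ y))
    inj : ∀ X Y {c} → c ≢ 0# → (∀ i → coords (pt X) i ≡ c * coords (pt Y) i) → X ≡ Y
    inj ⟨1, x , y , z ⟩ ⟨1, x′ , y′ , z′ ⟩ _ eq =
      cong₂ (λ x (y , z) → ⟨1, x , y , z ⟩) (unscale (eq 0F) (eq 1F)) (cong₂ _,_ (unscale (eq 0F) (eq 2F)) (unscale (eq 0F) (eq 3F)))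
    inj ⟨0,1, y , z ⟩ ⟨0,1, y′ , z′ ⟩ _ eq =
      cong₂ (λ y z → ⟨0,1, y , z ⟩) (unscale (eq 1F) (eq 2F)) (unscale (eq 1F) (eq 3F))
    inj ⟨0,0,1, z ⟩ ⟨0,0,1, z′ ⟩ _ eq = cong (λ z → ⟨0,0,1, z ⟩) (unscale (eq 2F) (eq 3F))
    inj ⟨0,0,0,1⟩ ⟨0,0,0,1⟩ _ _ = refl
    inj ⟨1, _ , _ , _ ⟩ ⟨0,1, _ , _ ⟩ _ eq = contradiction (eq 0F) 1≢
    inj ⟨1, _ , _ , _ ⟩ ⟨0,0,1, _ ⟩ _ eq = contradiction (eq 0F) 1≢
    inj ⟨1, _ , _ , _ ⟩ ⟨0,0,0,1⟩ _ eq = contradiction (eq 0F) 1≢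
    inj ⟨0,1, _ , _ ⟩ ⟨1, _ , _ , _ ⟩ c≢0 eq = contradiction (eq 0F) (0≢ c≢0)
    inj ⟨0,1, _ , _ ⟩ ⟨0,0,1, _ ⟩ _ eq = contradiction (eq 1F) 1≢
    inj ⟨0,1, _ , _ ⟩ ⟨0,0,0,1⟩ _ eq = contradiction (eq 1F) 1≢
    inj ⟨0,0,1, _ ⟩ ⟨1, _ , _ , _ ⟩ c≢0 eq = contradiction (eq 0F) (0≢ c≢0)
    inj ⟨0,0,1, _ ⟩ ⟨0,1, _ , _ ⟩ c≢0 eq = contradiction (eq 1F) (0≢ c≢0)
    inj ⟨0,0,1, _ ⟩ ⟨0,0,0,1⟩ _ eq = contradiction (eq 2F) 1≢
    inj ⟨0,0,0,1⟩ ⟨1, _ , _ , _ ⟩ c≢0 eq = contradiction (eq 0F) (0≢ c≢0)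
    inj ⟨0,0,0,1⟩ ⟨0,1, _ , _ ⟩ c≢0 eq = contradiction (eq 1F) (0≢ c≢0)
    inj ⟨0,0,0,1⟩ ⟨0,0,1, _ ⟩ c≢0 eq = contradiction (eq 2F) (0≢ c≢0)

  normalize : ∀ P → ∃[ X ] P ≈ pt X
  normalize P = pivot (x ≟ᶠ 0#) (y ≟ᶠ 0#) (z ≟ᶠ 0#)
    where
    x = coords P 0F
    y = coords P 1F
    z = coords P 2F
    w = coords P 3F
    divide : ∀ {c} a → c ≢ 0# → a ≡ c * (c ⁻¹ * a)
    divide {c} a c≢0 = sym (trans (sym (*-assoc c _ a)) (trans (cong (_* a) (⁻¹-inverseʳ c≢0)) (*-identityˡ a)))
    at0 : ∀ {a} c → a ≡ 0# → a ≡ c * 0#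
    at0 c a≡0 = trans a≡0 (sym (zeroʳ c))
    at1 : ∀ c → c ≡ c * 1#
    at1 c = sym (*-identityʳ c)
    pivot : Dec (x ≡ 0#) → Dec (y ≡ 0#) → Dec (z ≡ 0#) → ∃[ X ] P ≈ pt X
    pivot (no x≢0) _ _ = ⟨1, x ⁻¹ * y , x ⁻¹ * z , x ⁻¹ * w ⟩ , x , x≢0 ,
      λ { 0F → at1 x ; 1F → divide y x≢0 ; 2F → divide z x≢0 ; 3F → divide w x≢0 }
    pivot (yes x≡0) (no y≢0) _ = ⟨0,1, y ⁻¹ * z , y ⁻¹ * w ⟩ , y , y≢0 ,
      λ { 0F → at0 y x≡0 ; 1F → at1 y ; 2F → divide z y≢0 ; 3F → divide w y≢0 }
    pivot (yes x≡0) (yes y≡0) (no z≢0) = ⟨0,0,1, z ⁻¹ * w ⟩ , z , z≢0 ,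
      λ { 0F → at0 z x≡0 ; 1F → at0 z y≡0 ; 2F → at1 z ; 3F → divide w z≢0 }
    pivot (yes x≡0) (yes y≡0) (yes z≡0) = ⟨0,0,0,1⟩ , w ,
      (λ w≡0 → nonzero P λ { 0F → x≡0 ; 1F → y≡0 ; 2F → z≡0 ; 3F → w≡0 }) ,
      λ { 0F → at0 w x≡0 ; 1F → at0 w y≡0 ; 2F → at0 w z≡0 ; 3F → at1 w }

  abstract
    norm : Point → NormalPoint
    norm P = proj₁ (normalize P)

    norm-≈ : ∀ P → P ≈ pt (norm P)
    norm-≈ P = proj₂ (normalize P)

  norm-pt : ∀ P X → P ≈ pt X → norm P ≡ X
  norm-pt P X P≈ = pt-injective (≈-trans {pt (norm P)} {P} {pt X} (≈-sym {P} {pt (norm P)} (norm-≈ P)) P≈)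

  hasSize-points : {S : Pred Point _} (S? : Decidable S) → (∀ {P Q} → P ≈ Q → S P → S Q) →
                   HasSize S (count normals (S? ∘ pt))
  hasSize-points S? S-resp = hasSize normals pt pt-injective (S? ∘ pt)
    λ P P∈ → norm P , S-resp {P} {pt (norm P)} (norm-≈ P) P∈ , norm-≈ P

  -- Double counting of flags: a GL₂-invariant set of points meets all the
  -- osculating planes in the same number of points.
  total-flags : {S : Pred Point _} (S? : Decidable S) → (∀ {P Q} → P ≈ Q → S P → S Q) → (∀ B P → S (proj B • P) ⇔ S P) →
    total normals (λ X → ind (S? (pt X)) ℕ.* k (pt X))
      ≡ size PG₁-finite ℕ.* total normals (λ X → ind (S? (pt X)) ℕ.* ind (Osc? (pt X) ∞))
  total-flags {S} S? S-resp S-proj = begin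
    total normals (λ X → ind (S? (pt X)) ℕ.* k (pt X))
      ≡⟨ ∑-cong (elements normals) (λ X → ∑-*ˡ (elements PG₁-finite) (ind (S? (pt X))) (ind ∘ Osc? (pt X))) ⟨
    total normals (λ X → total PG₁-finite (flag X))
      ≡⟨ ∑-swap (elements normals) (elements PG₁-finite) flag ⟩
    total PG₁-finite (λ t → total normals (λ X → flag X t))
      ≡⟨ ∑-cong (elements PG₁-finite) at-∞ ⟩
    total PG₁-finite (λ t → total normals (λ X → flag X ∞))
      ≡⟨ total-const PG₁-finite _ ⟩
    size PG₁-finite ℕ.* total normals (λ X → flag X ∞) ∎
    where
    open ≡-Reasoning
    flag : NormalPoint → PG₁ → ℕ
    flag X t = ind (S? (pt X)) ℕ.* ind (Osc? (pt X) t)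
    at-∞ : ∀ t → total normals (λ X → flag X t) ≡ total normals (λ X → flag X ∞)
    at-∞ t = begin
      total normals (λ X → flag X t)
        ≡⟨ total-reindex normals normals (image g) (image (g ⁻¹ᵖ)) (inverse g (g ⁻¹ᵖ) (⁻¹ᵖ-•ˡ g)) (inverse (g ⁻¹ᵖ) g (⁻¹ᵖ-•ʳ g)) (λ X → flag X t) ⟨
      total normals (λ X → flag (image g X) t)
        ≡⟨ ∑-cong (elements normals) (λ X → cong₂ ℕ._*_
             (ind-cong (S? (pt (image g X))) (S? (pt X))
               (λ gX∈ → Equivalence.to (S-proj B (pt X)) (S-resp {pt (image g X)} {g • pt X} (image-≈ X) gX∈))
               (λ X∈ → S-resp {g • pt X} {pt (image g X)} (norm-≈ (g • pt X)) (Equivalence.from (S-proj B (pt X)) X∈)))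
             (ind-cong (Osc? (pt (image g X)) t) (Osc? (pt X) ∞)
               (λ gX∈ → Equivalence.from (Osc-to-line (pt X) t) (Osc-resp {pt (image g X)} {g • pt X} (image-≈ X) t gX∈))
               (λ X∈ → Osc-resp {g • pt X} {pt (image g X)} (norm-≈ (g • pt X)) t (Equivalence.to (Osc-to-line (pt X) t) X∈)))) ⟩
      total normals (λ X → flag X ∞) ∎
      where
      B = to-line t
      g = proj B
      image : Projectivity → NormalPoint → NormalPoint
      image g X = norm (g • pt X)
      image-≈ : ∀ X → pt (image g X) ≈ g • pt X
      image-≈ X = ≈-sym {g • pt X} {pt (image g X)} (norm-≈ (g • pt X))
      inverse : ∀ f f′ → (∀ P → f′ • f • P ≈ P) → ∀ X → image f′ (image f X) ≡ X
      inverse f f′ f′f X = norm-pt (f′ • pt (image f X)) X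
        (≈-trans {f′ • pt (image f X)} {f′ • f • pt X} {pt X}
          (•-cong f′ {pt (image f X)} {f • pt X} (≈-sym {f • pt X} {pt (image f X)} (norm-≈ (f • pt X)))) (f′f (pt X)))

  open +-*-Solver using ()
    renaming (solve to solveℕ; con to conℕ; _:=_ to _:=ℕ_; _:+_ to _:+ℕ_; _:*_ to _:*ℕ_)

  Quadric? : Decidable Quadric
  Quadric? P = quad (coords P) ≟ᶠ 0#

  -- A decidable form of 𝒪₁, as `𝒪₁⇔` shows: among the points with k = 1, those of the arc are the
  -- ones on the quadric.
  One-plane : Pred Point _
  One-plane P = ¬ Quadric P × k P ≡ 1

  One-plane? : Decidable One-plane
  One-plane? P = ¬? (Quadric? P) ×-dec (k P ℕ.≟ 1)

  k≟ : ∀ m → Decidable (λ P → k P ≡ m)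
  k≟ m P = k P ℕ.≟ m

  -- The numerical content of `classify`: k together with membership in the quadric separates the
  -- five cases.
  data Kind (P : Point) : Set where
    zero-planes : k P ≡ 0 → ¬ Quadric P → Kind P
    on-arc      : k P ≡ 1 → Quadric P → Arc h P → Kind P
    one-plane   : k P ≡ 1 → ¬ Quadric P → Kind P
    two-planes  : k P ≡ 2 → Quadric P → Kind P
    three-planes  : k P ≡ 3 → ¬ Quadric P → Kind P

  Arc-orbit : ∀ {P Q} → Orbit h P Q → Arc h P → Arc h Q
  Arc-orbit {P} {Q} (g , g∈G , Q≈gP) P∈ = Arc-resp {g • P} {Q} (≈-sym {Q} {g • P} Q≈gP) (Equivalence.to (g∈G P) P∈)

  kind : ∀ P → Kind P
  kind P = from-class (classify P)
    where
    from-class : k P ≡ 0 ⊎ Class P → Kind P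
    from-class (inj₁ k≡0) = zero-planes k≡0 λ P∈ →
      let t , P∈t = Quadric⇒Osc P P∈ in count≡0 PG₁-finite (Osc? P) k≡0 t P∈t
    from-class (inj₂ (~arc q o)) = on-arc (trans (k-orbit {arc ∞} {P} o) k-arc) q (Arc-orbit {arc ∞} {P} o (arc∈Arc ∞))
    from-class (inj₂ (~quadric q o)) = two-planes (trans (k-orbit {U₂} {P} o) k-U₂) q
    from-class (inj₂ (~three ¬q o)) = three-planes (trans (k-orbit {⟨0,1,1, 0# ⟩} {P} o) k-three) ¬q
    from-class (inj₂ (~one ¬q o)) = one-plane (trans (k-orbit {⟨0,1,1, c₀ ⟩} {P} o) k-one) ¬q

  k-arc-point : ∀ {P} → Arc h P → k P ≡ 1
  k-arc-point {P} P∈ = let t , P≈ = Arc⇒arc {P} P∈ in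
    trans (k-cong {P} {arc t} P≈) (trans (k-orbit {arc ∞} {arc t} (Orbit-proj (to-line t) {arc ∞} {arc t} (to-line-arc t))) k-arc)

  clash : ∀ {m a b : ℕ} {A : Set} → m ≡ a → m ≡ b → a ≢ b → A
  clash refl refl a≢b = contradiction refl a≢b

  ind-k≢ : ∀ {P m} l → k P ≡ m → m ≢ l → ind (k≟ l P) ≡ 0
  ind-k≢ {P} l k≡m m≢l = ind-no (k≟ l P) λ k≡l → clash k≡m k≡l m≢l

  Arc⇔ : ∀ P → Arc h P ⇔ (Quadric P × k P ≡ 1)
  Arc⇔ P = mk⇔ (λ P∈ → Arc⇒Quadric {P} P∈ , k-arc-point {P} P∈) (λ (q , k≡1) → from-kind q k≡1 (kind P))
    where
    from-kind : Quadric P → k P ≡ 1 → Kind P → Arc h P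
    from-kind _ _ (on-arc _ _ P∈)     = P∈
    from-kind q _ (zero-planes _ ¬q)  = contradiction q ¬q
    from-kind q _ (one-plane _ ¬q)    = contradiction q ¬q
    from-kind q _ (three-planes _ ¬q)   = contradiction q ¬q
    from-kind _ k≡1 (two-planes k≡2 _) = clash k≡1 k≡2 λ ()

  Arc? : Decidable (Arc h)
  Arc? P = map′ (Equivalence.from (Arc⇔ P)) (Equivalence.to (Arc⇔ P)) (Quadric? P ×-dec (k P ℕ.≟ 1))

  PG₁-size : size PG₁-finite ≡ suc q
  PG₁-size = begin
    size PG₁-finite                                ≡⟨ ℕ.*-identityʳ _ ⟨
    size PG₁-finite ℕ.* 1                          ≡⟨ total-const PG₁-finite 1 ⟨
    total PG₁-finite (λ _ → 1)                     ≡⟨ total-⊎ field-finite ⊤-finite (λ _ → 1) ⟩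
    ∑F (λ _ → 1) ℕ.+ 1                             ≡⟨ cong (ℕ._+ 1) (trans (∑F-const 1) (ℕ.*-identityʳ q)) ⟩
    q ℕ.+ 1                                        ≡⟨ ℕ.+-comm q 1 ⟩
    suc q                                          ∎
    where open ≡-Reasoning

  total-normal : ∀ f → total normals f ≡
    ∑F (λ x → ∑F (λ y → ∑F (λ z → f ⟨1, x , y , z ⟩))) ℕ.+
    (∑F (λ y → ∑F (λ z → f ⟨0,1, y , z ⟩)) ℕ.+ (∑F (λ z → f ⟨0,0,1, z ⟩) ℕ.+ f ⟨0,0,0,1⟩))
  total-normal f = begin
    total normals f
      ≡⟨ total-⊎ F³ (F² ⊎-finite field-finite ⊎-finite ⊤-finite) f ⟩
    total F³ (f ∘ inj₁) ℕ.+ total (F² ⊎-finite field-finite ⊎-finite ⊤-finite) (f ∘ inj₂)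
      ≡⟨ cong₂ ℕ._+_
           (trans (total-× field-finite F² (f ∘ inj₁)) (∑F-cong λ x → total-× field-finite field-finite (λ yz → f (inj₁ (x , yz)))))
           (trans (total-⊎ F² (field-finite ⊎-finite ⊤-finite) (f ∘ inj₂))
             (cong₂ ℕ._+_ (total-× field-finite field-finite (f ∘ inj₂ ∘ inj₁))
               (trans (total-⊎ field-finite ⊤-finite (f ∘ inj₂ ∘ inj₂))
                 (cong (∑F (λ z → f ⟨0,0,1, z ⟩) ℕ.+_) (ℕ.+-identityʳ _))))) ⟩
    _ ∎
    where
    open ≡-Reasoning
    F² = field-finite ×-finite field-finite
    F³ = field-finite ×-finite F²

  normal-size : size normals ≡ q ℕ.* (q ℕ.* q) ℕ.+ (q ℕ.* q ℕ.+ (q ℕ.+ 1))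
  normal-size = begin
    size normals                         ≡⟨ ℕ.*-identityʳ _ ⟨
    size normals ℕ.* 1                   ≡⟨ total-const normals 1 ⟨
    total normals (λ _ → 1)              ≡⟨ total-normal (λ _ → 1) ⟩
    ∑F (λ _ → ∑F λ _ → ∑F λ _ → 1) ℕ.+ (∑F (λ _ → ∑F λ _ → 1) ℕ.+ (∑F (λ _ → 1) ℕ.+ 1))
      ≡⟨ cong₂ ℕ._+_ (trans (∑F-cong λ _ → trans (∑F-cong λ _ → one) (∑F-const q)) (∑F-const (q ℕ.* q)))
           (cong₂ ℕ._+_ (trans (∑F-cong λ _ → one) (∑F-const q)) (cong (ℕ._+ 1) one)) ⟩
    q ℕ.* (q ℕ.* q) ℕ.+ (q ℕ.* q ℕ.+ (q ℕ.+ 1)) ∎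
    where
    open ≡-Reasoning
    one : ∑F (λ _ → 1) ≡ q
    one = trans (∑F-const 1) (ℕ.*-identityʳ q)

  -- On (1, x, y, z) the equation determines z, on (0, 1, y, z) it says y = 0, and the remaining
  -- points all satisfy it: q² + q + q + 1.
  quadric-count : count normals (Quadric? ∘ pt) ≡ suc q ℕ.* suc q
  quadric-count = begin
    total normals f
      ≡⟨ total-normal f ⟩
    ∑F (λ x → ∑F (λ y → ∑F (λ z → f ⟨1, x , y , z ⟩))) ℕ.+
    (∑F (λ y → ∑F (λ z → f ⟨0,1, y , z ⟩)) ℕ.+ (∑F (λ z → f ⟨0,0,1, z ⟩) ℕ.+ f ⟨0,0,0,1⟩))
      ≡⟨ cong₂ ℕ._+_
           (trans (∑F-cong λ x → trans (∑F-cong λ y → affine x y) (∑F-const 1)) (∑F-const (q ℕ.* 1)))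
           (cong₂ ℕ._+_
             (trans (∑F-cong λ y → trans (∑F-cong λ z → at-∞ y z) (∑F-const _))
               (trans (∑F-* q (λ y → ind (0# ≟ᶠ y))) (cong (q ℕ.*_) (count-≡ field-finite 0#))))
             (cong₂ ℕ._+_
               (trans (∑F-cong λ z → ind-yes (Quadric? (pt ⟨0,0,1, z ⟩))
                 (solve₂ 1 (λ z → con false :* z :+ con false :* con true := con false) refl z)) (∑F-const 1))
               (ind-yes (Quadric? (pt ⟨0,0,0,1⟩)) (solve₂ 0 (con false :* con true :+ con false :* con false := con false) refl)))) ⟩
    q ℕ.* (q ℕ.* 1) ℕ.+ (q ℕ.* 1 ℕ.+ (q ℕ.* 1 ℕ.+ 1))
      ≡⟨ solveℕ 1 (λ q → q :*ℕ (q :*ℕ conℕ 1) :+ℕ (q :*ℕ conℕ 1 :+ℕ (q :*ℕ conℕ 1 :+ℕ conℕ 1)) :=ℕ (conℕ 1 :+ℕ q) :*ℕ (conℕ 1 :+ℕ q)) refl q ⟩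
    suc q ℕ.* suc q ∎
    where
    open ≡-Reasoning
    f = ind ∘ Quadric? ∘ pt
    affine : ∀ x y → ∑F (λ z → f ⟨1, x , y , z ⟩) ≡ 1
    affine x y = trans
      (count-cong field-finite (λ z → Quadric? (pt ⟨1, x , y , z ⟩)) ((x * y) ≟ᶠ_)
        (λ z eq → sym (+-≡0⇒≡ (trans (sym (quad-eq z)) eq)))
        (λ { z refl → trans (quad-eq z) (x+x≡0 z) }))
      (count-≡ field-finite (x * y))
      where
      quad-eq : ∀ z → 1# * z + x * y ≡ z + x * y
      quad-eq z = cong (_+ x * y) (*-identityˡ z)
    at-∞ : ∀ y z → f ⟨0,1, y , z ⟩ ≡ ind (0# ≟ᶠ y)
    at-∞ y z = ind-cong (Quadric? (pt ⟨0,1, y , z ⟩)) (0# ≟ᶠ y)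
      (λ eq → sym (trans (sym quad-eq) eq)) (λ { refl → quad-eq })
      where
      quad-eq : 0# * z + 1# * y ≡ y
      quad-eq = solve₂ 2 (λ y z → con false :* z :+ con true :* y := y) refl y z

  -- The osculating plane at U₄ contains all the points (0, 1, y, z), z ∈ F, and
  -- the one at P_t exactly one of them.
  ∑-k-at-∞ : ∀ y → ∑F (λ z → k (pt ⟨0,1, y , z ⟩)) ≡ q ℕ.+ q
  ∑-k-at-∞ y = begin
    ∑F (λ z → k (pt ⟨0,1, y , z ⟩))
      ≡⟨ ∑F-cong (λ z → trans (k-split (pt ⟨0,1, y , z ⟩)) (cong₂ ℕ._+_ (roots z) (ind-yes (Osc? (pt ⟨0,1, y , z ⟩) ∞) refl))) ⟩
    ∑F (λ z → ∑F (λ t → ind ((σ t + t * y) ≟ᶠ z) ℕ.* 1) ℕ.+ 1)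
      ≡⟨ ∑F-+ _ (λ _ → 1) ⟩
    ∑F (λ z → ∑F (λ t → ind ((σ t + t * y) ≟ᶠ z) ℕ.* 1)) ℕ.+ ∑F (λ _ → 1)
      ≡⟨ cong (ℕ._+ ∑F (λ _ → 1)) (total-fibres field-finite field-finite (λ t → σ t + t * y) (λ _ → 1)) ⟩
    ∑F (λ _ → 1) ℕ.+ ∑F (λ _ → 1)
      ≡⟨ cong (λ m → m ℕ.+ m) (trans (∑F-const 1) (ℕ.*-identityʳ q)) ⟩
    q ℕ.+ q ∎
    where
    open ≡-Reasoning
    osc-eq : ∀ t z → osc (coords (pt ⟨0,1, y , z ⟩)) (inj₁ t) ≡ σ t + t * y + z
    osc-eq t z = solve₂ 4 (λ s t y z → s :* t :* con false :+ s :* con true :+ t :* y :+ z := s :+ t :* y :+ z) refl (σ t) t y z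
    roots : ∀ z → count field-finite (Osc? (pt ⟨0,1, y , z ⟩) ∘ inj₁) ≡ ∑F (λ t → ind ((σ t + t * y) ≟ᶠ z) ℕ.* 1)
    roots z = ∑F-cong λ t → trans
      (ind-cong (Osc? (pt ⟨0,1, y , z ⟩) (inj₁ t)) ((σ t + t * y) ≟ᶠ z)
        (λ eq → +-≡0⇒≡ (trans (sym (osc-eq t z)) eq)) (λ eq → trans (osc-eq t z) (≡⇒+-≡0 eq)))
      (sym (ℕ.*-identityʳ _))

  Quadric-at-∞ : ∀ y z → quad (coords (pt ⟨0,1, y , z ⟩)) ≡ y
  Quadric-at-∞ y z = solve₂ 2 (λ y z → con false :* z :+ con true :* y := y) refl y z

  -- The difference of the two equations gives 2a = q. Here a and b stand for the numbers of points
  -- with k = 3 and k = 1 among the (0, 1, y, z) for a fixed y ≠ 0.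
  halves : ∀ a b → a ℕ.+ b ≡ q → 3 ℕ.* a ℕ.+ b ≡ q ℕ.+ q → 2 ℕ.* a ≡ q × 2 ℕ.* b ≡ q
  halves a b a+b 3a+b = 2a≡q , ℕ.+-cancelˡ-≡ (2 ℕ.* a) _ _ (begin
      2 ℕ.* a ℕ.+ 2 ℕ.* b      ≡⟨ ℕ.*-distribˡ-+ 2 a b ⟨
      2 ℕ.* (a ℕ.+ b)          ≡⟨ cong (2 ℕ.*_) a+b ⟩
      2 ℕ.* q                  ≡⟨ cong (q ℕ.+_) (ℕ.+-identityʳ q) ⟩
      q ℕ.+ q                  ≡⟨ cong (ℕ._+ q) 2a≡q ⟨
      2 ℕ.* a ℕ.+ q            ∎)
    where
    open ≡-Reasoning
    2a≡q : 2 ℕ.* a ≡ q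
    2a≡q = ℕ.+-cancelʳ-≡ (a ℕ.+ b) _ _ (begin
      2 ℕ.* a ℕ.+ (a ℕ.+ b)    ≡⟨ solveℕ 2 (λ a b → conℕ 2 :*ℕ a :+ℕ (a :+ℕ b) :=ℕ conℕ 3 :*ℕ a :+ℕ b) refl a b ⟩
      3 ℕ.* a ℕ.+ b            ≡⟨ 3a+b ⟩
      q ℕ.+ q                  ≡⟨ cong (q ℕ.+_) a+b ⟨
      q ℕ.+ (a ℕ.+ b)          ∎)

  -- For y ≠ 0 the q points (0, 1, y, z) are off the quadric and on the plane X₁ = 0, so k is 1 or 3
  -- at each; by `∑-k-at-∞` the values of k average to 2.
  half-at-∞ : ∀ y → y ≢ 0# →
    2 ℕ.* ∑F (λ z → ind (k≟ 3 (pt ⟨0,1, y , z ⟩))) ≡ q × 2 ℕ.* ∑F (λ z → ind (One-plane? (pt ⟨0,1, y , z ⟩))) ≡ q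
  half-at-∞ y y≢0 = halves (∑F a) (∑F b)
    (trans (sym (∑F-+ a b)) (trans (∑F-cong λ z → proj₁ (values z)) (trans (∑F-const 1) (ℕ.*-identityʳ q))))
    (trans (cong (ℕ._+ ∑F b) (sym (∑F-* 3 a))) (trans (sym (∑F-+ (λ z → 3 ℕ.* a z) b))
      (trans (∑F-cong λ z → proj₂ (values z)) (∑-k-at-∞ y))))
    where
    a b : Carrier → ℕ
    a z = ind (k≟ 3 (pt ⟨0,1, y , z ⟩))
    b z = ind (One-plane? (pt ⟨0,1, y , z ⟩))
    values : ∀ z → (a z ℕ.+ b z ≡ 1) × (3 ℕ.* a z ℕ.+ b z ≡ k (pt ⟨0,1, y , z ⟩))
    values z = from-kind (kind P)
      where
      P = pt ⟨0,1, y , z ⟩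
      ¬q : ¬ Quadric P
      ¬q eq = y≢0 (trans (sym (Quadric-at-∞ y z)) eq)
      from-kind : Kind P → (a z ℕ.+ b z ≡ 1) × (3 ℕ.* a z ℕ.+ b z ≡ k P)
      from-kind (zero-planes k≡0 _) = contradiction refl (count≡0 PG₁-finite (Osc? P) k≡0 ∞)
      from-kind (on-arc _ q _)      = contradiction q ¬q
      from-kind (two-planes _ q)    = contradiction q ¬q
      from-kind (one-plane k≡1 _)   = cong₂ ℕ._+_ a≡0 b≡1 , trans (cong₂ (λ a b → 3 ℕ.* a ℕ.+ b) a≡0 b≡1) (sym k≡1)
        where
        a≡0 = ind-no (k≟ 3 P) (λ k≡3 → clash k≡1 k≡3 λ ())
        b≡1 = ind-yes (One-plane? P) (¬q , k≡1)
      from-kind (three-planes k≡3 _)  = cong₂ ℕ._+_ a≡1 b≡0 , trans (cong₂ (λ a b → 3 ℕ.* a ℕ.+ b) a≡1 b≡0) (sym k≡3)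
        where
        a≡1 = ind-yes (k≟ 3 P) k≡3
        b≡0 = ind-no (One-plane? P) (λ (_ , k≡1) → clash k≡1 k≡3 λ ())

  -- There are m |S| flags of a point of S and an osculating plane on it, and also q + 1 times the
  -- number of points of S on X₁ = 0. As S avoids the quadric, the latter are q / 2 points for each
  -- of the q - 1 values y ≠ 0. Hence 2 m |S| = q³ - q.
  count-by-flags : ∀ {S : Pred Point _} (S? : Decidable S) → (∀ {P Q} → P ≈ Q → S P → S Q) → (∀ B P → S (proj B • P) ⇔ S P) →
    (∀ P → S P → ¬ Quadric P) → ∀ m → (∀ P → S P → k P ≡ m) →
    (∀ y → y ≢ 0# → 2 ℕ.* ∑F (λ z → ind (S? (pt ⟨0,1, y , z ⟩))) ≡ q) →
    2 ℕ.* (m ℕ.* count normals (S? ∘ pt)) ℕ.+ q ≡ q ℕ.* (q ℕ.* q)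
  -- Adding q² makes both sides multiples of q + 1, namely (q + 1)(2c + q) and (q + 1) q².
  count-by-flags {S} S? S-resp S-proj S⇒¬Quadric m S⇒k half = ℕ.+-cancelʳ-≡ (q ℕ.* q) _ _ (begin
    2 ℕ.* (m ℕ.* count normals (S? ∘ pt)) ℕ.+ q ℕ.+ q ℕ.* q
      ≡⟨ cong (λ c → 2 ℕ.* c ℕ.+ q ℕ.+ q ℕ.* q) flags ⟩
    2 ℕ.* (suc q ℕ.* c) ℕ.+ q ℕ.+ q ℕ.* q
      ≡⟨ solveℕ 2 (λ q c → conℕ 2 :*ℕ ((conℕ 1 :+ℕ q) :*ℕ c) :+ℕ q :+ℕ q :*ℕ q :=ℕ (conℕ 1 :+ℕ q) :*ℕ (conℕ 2 :*ℕ c :+ℕ q)) refl q c ⟩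
    suc q ℕ.* (2 ℕ.* c ℕ.+ q)
      ≡⟨ cong (suc q ℕ.*_) 2c+q ⟩
    suc q ℕ.* (q ℕ.* q)
      ≡⟨ solveℕ 1 (λ q → (conℕ 1 :+ℕ q) :*ℕ (q :*ℕ q) :=ℕ q :*ℕ (q :*ℕ q) :+ℕ q :*ℕ q) refl q ⟩
    q ℕ.* (q ℕ.* q) ℕ.+ q ℕ.* q ∎)
    where
    open ≡-Reasoning
    S₀ : NormalPoint → ℕ
    S₀ X = ind (S? (pt X))
    c = ∑F (λ y → ∑F (λ z → S₀ ⟨0,1, y , z ⟩))
    quadric⇒0 : ∀ X → Quadric (pt X) → S₀ X ≡ 0
    quadric⇒0 X X∈ = ind-no (S? (pt X)) λ s → S⇒¬Quadric (pt X) s X∈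
    ∑F-0 : ∀ {f} → (∀ x → f x ≡ 0) → ∑F f ≡ 0
    ∑F-0 f≡0 = trans (∑F-cong f≡0) (trans (∑F-const 0) (ℕ.*-zeroʳ q))
    on-∞ : total normals (λ X → S₀ X ℕ.* ind (Osc? (pt X) ∞)) ≡ c
    on-∞ = begin
      total normals (λ X → S₀ X ℕ.* ind (Osc? (pt X) ∞))
        ≡⟨ total-normal (λ X → S₀ X ℕ.* ind (Osc? (pt X) ∞)) ⟩
      _ ≡⟨ cong₂ ℕ._+_
             (∑F-0 λ x → ∑F-0 λ y → ∑F-0 λ z →
               trans (cong (S₀ ⟨1, x , y , z ⟩ ℕ.*_) (ind-no (Osc? (pt ⟨1, x , y , z ⟩) ∞) 1≢0)) (ℕ.*-zeroʳ (S₀ ⟨1, x , y , z ⟩)))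
             (cong₂ ℕ._+_
               (∑F-cong λ y → ∑F-cong λ z →
                 trans (cong (S₀ ⟨0,1, y , z ⟩ ℕ.*_) (ind-yes (Osc? (pt ⟨0,1, y , z ⟩) ∞) refl)) (ℕ.*-identityʳ _))
               (cong₂ ℕ._+_
                 (∑F-0 λ z → cong (ℕ._* ind (Osc? (pt ⟨0,0,1, z ⟩) ∞)) (quadric⇒0 ⟨0,0,1, z ⟩
                   (solve₂ 1 (λ z → con false :* z :+ con false :* con true := con false) refl z)))
                 (cong (ℕ._* ind (Osc? (pt ⟨0,0,0,1⟩) ∞)) (quadric⇒0 ⟨0,0,0,1⟩
                   (solve₂ 0 (con false :* con true :+ con false :* con false := con false) refl))))) ⟩
      c ℕ.+ 0 ≡⟨ ℕ.+-identityʳ c ⟩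
      c ∎
    flags : m ℕ.* count normals (S? ∘ pt) ≡ suc q ℕ.* c
    flags = begin
      m ℕ.* total normals S₀
        ≡⟨ ∑-*ˡ (elements normals) m S₀ ⟨
      total normals (λ X → m ℕ.* S₀ X)
        ≡⟨ ∑-cong (elements normals) (λ X → sym (weigh X (S? (pt X)))) ⟩
      total normals (λ X → S₀ X ℕ.* k (pt X))
        ≡⟨ total-flags S? S-resp S-proj ⟩
      size PG₁-finite ℕ.* total normals (λ X → S₀ X ℕ.* ind (Osc? (pt X) ∞))
        ≡⟨ cong₂ ℕ._*_ PG₁-size on-∞ ⟩
      suc q ℕ.* c ∎
      where
      weigh : ∀ X (s : Dec (S (pt X))) → ind s ℕ.* k (pt X) ≡ m ℕ.* ind s
      weigh X (yes s) = trans (ℕ.*-identityˡ _) (trans (S⇒k (pt X) s) (sym (ℕ.*-identityʳ m)))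
      weigh X (no _)  = sym (ℕ.*-zeroʳ m)
    -- The added q is charged to y = 0, where S has no points, so that each of the q values of y
    -- contributes q.
    2c+q : 2 ℕ.* c ℕ.+ q ≡ q ℕ.* q
    2c+q = begin
      2 ℕ.* c ℕ.+ q
        ≡⟨ cong₂ ℕ._+_ (∑F-* 2 (λ y → ∑F (λ z → S₀ ⟨0,1, y , z ⟩)))
             (trans (∑F-* q (λ y → ind (0# ≟ᶠ y))) (trans (cong (q ℕ.*_) (count-≡ field-finite 0#)) (ℕ.*-identityʳ q))) ⟨
      ∑F (λ y → 2 ℕ.* ∑F (λ z → S₀ ⟨0,1, y , z ⟩)) ℕ.+ ∑F (λ y → q ℕ.* ind (0# ≟ᶠ y))
        ≡⟨ ∑F-+ _ _ ⟨
      ∑F (λ y → 2 ℕ.* ∑F (λ z → S₀ ⟨0,1, y , z ⟩) ℕ.+ q ℕ.* ind (0# ≟ᶠ y))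
        ≡⟨ ∑F-cong (λ y → by-cases y (0# ≟ᶠ y)) ⟩
      ∑F (λ _ → q)
        ≡⟨ ∑F-const q ⟩
      q ℕ.* q ∎
      where
      by-cases : ∀ y (d : Dec (0# ≡ y)) → 2 ℕ.* ∑F (λ z → S₀ ⟨0,1, y , z ⟩) ℕ.+ q ℕ.* ind d ≡ q
      by-cases y (yes refl) = cong₂ ℕ._+_
        (cong (2 ℕ.*_) (∑F-0 λ z → quadric⇒0 ⟨0,1, 0# , z ⟩ (Quadric-at-∞ 0# z))) (ℕ.*-identityʳ q)
      by-cases y (no 0≢y) = trans (cong₂ ℕ._+_ (half y (0≢y ∘ sym)) (ℕ.*-zeroʳ q)) (ℕ.+-identityʳ q)

  -- Points on no osculating plane

  at : Vector Carrier 4 → Fin 2 → Fin 2 → Carrier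
  at C = mat₂ (C 0F) (C 1F) (C 2F) (C 3F)

  -- C^σ (X J) = (Y J) C for 2 × 2 matrices, where J exchanges the columns.  As
  -- B J Bᵗ = (det B) J, an invertible B with B^σ X Bᵗ = Y solves this equation up
  -- to a scalar.
  Intertwines : (X Y C : Vector Carrier 4) → Set
  Intertwines X Y C = ∀ i →
    (σ (at C i 0F) * X 1F + σ (at C i 1F) * X 3F ≡ at Y i 1F * C 0F + at Y i 0F * C 2F) ×
    (σ (at C i 0F) * X 0F + σ (at C i 1F) * X 2F ≡ at Y i 1F * C 1F + at Y i 0F * C 3F)

  infixl 6 _⊕_

  _⊕_ : (C D : Vector Carrier 4) → Vector Carrier 4
  (C ⊕ D) i = C i + D i

  -- Both sides of the equation are additive in C. Multiplying C by m scales them by σ m and m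
  -- respectively, so the solutions form a space over 𝔽₂ rather than over F.
  Intertwines-⊕ : ∀ {X Y} C D → Intertwines X Y C → Intertwines X Y D → Intertwines X Y (C ⊕ D)
  Intertwines-⊕ {X} {Y} C D C∈ D∈ i =
    add (proj₁ (C∈ i)) (proj₁ (D∈ i)) , add (proj₂ (C∈ i)) (proj₂ (D∈ i))
    where
    at-⊕ : ∀ j → at (C ⊕ D) i j ≡ at C i j + at D i j
    at-⊕ = lemma i
      where
      lemma : ∀ i j → at (C ⊕ D) i j ≡ at C i j + at D i j
      lemma 0F 0F = refl
      lemma 0F 1F = refl
      lemma 1F 0F = refl
      lemma 1F 1F = refl
    add : ∀ {x z c c′ d d′} →
      σ (at C i 0F) * x + σ (at C i 1F) * z ≡ at Y i 1F * c + at Y i 0F * c′ →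
      σ (at D i 0F) * x + σ (at D i 1F) * z ≡ at Y i 1F * d + at Y i 0F * d′ →
      σ (at (C ⊕ D) i 0F) * x + σ (at (C ⊕ D) i 1F) * z ≡ at Y i 1F * (c + d) + at Y i 0F * (c′ + d′)
    add {x} {z} {c} {c′} {d} {d′} eq₁ eq₂ = begin
      σ (at (C ⊕ D) i 0F) * x + σ (at (C ⊕ D) i 1F) * z
        ≡⟨ cong₂ (λ a b → a * x + b * z) (trans (cong σ (at-⊕ 0F)) (σ-+ _ _)) (trans (cong σ (at-⊕ 1F)) (σ-+ _ _)) ⟩
      (σ (at C i 0F) + σ (at D i 0F)) * x + (σ (at C i 1F) + σ (at D i 1F)) * z
        ≡⟨ solve₂ 6 (λ a b c d x z → (a :+ b) :* x :+ (c :+ d) :* z := (a :* x :+ c :* z) :+ (b :* x :+ d :* z)) refl _ _ _ _ x z ⟩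
      (σ (at C i 0F) * x + σ (at C i 1F) * z) + (σ (at D i 0F) * x + σ (at D i 1F) * z)
        ≡⟨ cong₂ _+_ eq₁ eq₂ ⟩
      (at Y i 1F * c + at Y i 0F * c′) + (at Y i 1F * d + at Y i 0F * d′)
        ≡⟨ solve₂ 6 (λ u v c c′ d d′ → (u :* c :+ v :* c′) :+ (u :* d :+ v :* d′) := u :* (c :+ d) :+ v :* (c′ :+ d′)) refl _ _ c c′ d d′ ⟩
      at Y i 1F * (c + d) + at Y i 0F * (c′ + d′) ∎
      where open ≡-Reasoning

  -- The determinants of both sides of the equation; exchanging columns leaves a determinant
  -- unchanged in characteristic two.
  Intertwines-quad : ∀ {X Y C} → Intertwines X Y C → σ (quad C) * quad X ≡ quad Y * quad C
  Intertwines-quad {X} {Y} {C} C∈ = begin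
    σ (quad C) * quad X
      ≡⟨ cong₂ _*_ (σ-dot (C 0F) (C 1F) (C 3F) (C 2F)) (+-comm _ _) ⟩
    (σ (C 0F) * σ (C 3F) + σ (C 1F) * σ (C 2F)) * (X 1F * X 2F + X 0F * X 3F)
      ≡⟨ det-* (σ (C 0F)) (σ (C 1F)) (σ (C 2F)) (σ (C 3F)) (X 1F) (X 0F) (X 3F) (X 2F) ⟨
    _ ≡⟨ cong₂ _+_ (cong₂ _*_ (proj₁ (C∈ 0F)) (proj₂ (C∈ 1F))) (cong₂ _*_ (proj₂ (C∈ 0F)) (proj₁ (C∈ 1F))) ⟩
    _ ≡⟨ det-* (Y 1F) (Y 0F) (Y 3F) (Y 2F) (C 0F) (C 1F) (C 2F) (C 3F) ⟩
    (Y 1F * Y 2F + Y 0F * Y 3F) * quad C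
      ≡⟨ cong (_* quad C) (+-comm _ _) ⟩
    quad Y * quad C ∎
    where open ≡-Reasoning

  -- The i-th diagonal entry of C^σ X Cᵗ = (det C) Y, which follows from the equation by C J Cᵗ =
  -- (det C) J and J² = 1. The row of C is reversed because `form` pairs X with the coordinates in
  -- reverse order.
  Intertwines-form : ∀ {X Y C} → Intertwines X Y C → ∀ i → form X (at C i 1F ∷ at C i 0F ∷ []) ≡ at Y i i * quad C
  Intertwines-form {X} {Y} {C} C∈ i = begin
    form X (at C i 1F ∷ at C i 0F ∷ [])
      ≡⟨ solve₂ 8 (λ s t b a x y z w → s :* a :* x :+ s :* b :* y :+ t :* a :* z :+ t :* b :* w
           := b :* (s :* y :+ t :* w) :+ a :* (s :* x :+ t :* z))
           refl (σ (at C i 0F)) (σ (at C i 1F)) (at C i 1F) (at C i 0F) (X 0F) (X 1F) (X 2F) (X 3F) ⟩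
    at C i 1F * (σ (at C i 0F) * X 1F + σ (at C i 1F) * X 3F) + at C i 0F * (σ (at C i 0F) * X 0F + σ (at C i 1F) * X 2F)
      ≡⟨ cong₂ (λ u v → at C i 1F * u + at C i 0F * v) (proj₁ (C∈ i)) (proj₂ (C∈ i)) ⟩
    at C i 1F * (at Y i 1F * C 0F + at Y i 0F * C 2F) + at C i 0F * (at Y i 1F * C 1F + at Y i 0F * C 3F)
      ≡⟨ last i ⟩
    at Y i i * quad C ∎
    where
    open ≡-Reasoning
    last : ∀ i → at C i 1F * (at Y i 1F * C 0F + at Y i 0F * C 2F) + at C i 0F * (at Y i 1F * C 1F + at Y i 0F * C 3F)
           ≡ at Y i i * quad C
    last 0F = solve₂ 6 (λ a b c d u v → b :* (v :* a :+ u :* c) :+ a :* (v :* b :+ u :* d) := u :* (a :* d :+ b :* c))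
      refl (C 0F) (C 1F) (C 2F) (C 3F) (Y 0F) (Y 1F)
    last 1F = solve₂ 6 (λ a b c d u v → d :* (v :* a :+ u :* c) :+ c :* (v :* b :+ u :* d) := v :* (a :* d :+ b :* c))
      refl (C 0F) (C 1F) (C 2F) (C 3F) (Y 2F) (Y 3F)

  -- On the 𝔽₂-space of solutions, det is a quadratic form that takes a single
  -- nonzero value at all nonzero vectors; hence three distinct ones sum to zero.
  module Intertwiners (P : Point) (k≡0 : k P ≡ 0) (¬quadric : ¬ Quadric P) (Y : Vector Carrier 4) where

    Solution : Vector Carrier 4 → Set
    Solution = Intertwines (coords P) Y

    Nonzero : Vector Carrier 4 → Set
    Nonzero C = ¬ (∀ i → C i ≡ 0#)

    -- A nonzero zero of the form would be, up to a scalar, the parameter of an osculating plane on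
    -- P.
    form≢0 : ∀ u → form (coords P) u ≡ 0# → u 0F ≡ 0# × u 1F ≡ 0#
    form≢0 u eq = ≡0-stable (λ u₀≢0 → no-root (slope u (u₀≢0 ∘ proj₁))) , ≡0-stable λ u₁≢0 → no-root (slope u (u₁≢0 ∘ proj₂))
      where
      no-root : ∃[ t ] ∃[ c ] c ≢ 0# × (∀ i → u i ≡ c * line t i) → ⊥
      no-root (t , c , c≢0 , u≡) = count≡0 PG₁-finite (Osc? P) k≡0 t (*-≡0ʳ (*-≢0 (σ-≢0 c≢0) c≢0)
        (trans (cong (σ c * c *_) (sym (form-line (coords P) t))) (trans (sym (form-scale (coords P) {u} {line t} c u≡)) eq)))

    -- By `Intertwines-form` the form of P vanishes at both rows of C once det C = 0, and it has no
    -- nonzero zeros. So nonzero solutions are invertible.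
    quad≡0 : ∀ C → Solution C → quad C ≡ 0# → ∀ i → C i ≡ 0#
    quad≡0 C C∈ quad≡0 = λ { 0F → proj₂ (row 0F) ; 1F → proj₁ (row 0F) ; 2F → proj₂ (row 1F) ; 3F → proj₁ (row 1F) }
      where
      row : ∀ i → at C i 1F ≡ 0# × at C i 0F ≡ 0#
      row i = form≢0 (at C i 1F ∷ at C i 0F ∷ [])
        (trans (Intertwines-form {coords P} {Y} {C} C∈ i) (trans (cong (at Y i i *_) quad≡0) (zeroʳ _)))

    -- The ratio σ(det C) / det C equals det Y / det X and does not depend on C; by `σ-proportional`
    -- it determines det C.
    quad-unique : ∀ C D → Solution C → Solution D → Nonzero C → Nonzero D → quad C ≡ quad D
    quad-unique C D C∈ D∈ C≢0 D≢0 = σ-proportional (C≢0 ∘ quad≡0 C C∈) (D≢0 ∘ quad≡0 D D∈) (*-cancelˡ ¬quadric (begin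
      quad X * (σ (quad C) * quad D)    ≡⟨ solve₂ 3 (λ x s d → x :* (s :* d) := s :* x :* d) refl (quad X) (σ (quad C)) (quad D) ⟩
      σ (quad C) * quad X * quad D      ≡⟨ cong (_* quad D) (Intertwines-quad {X} {Y} {C} C∈) ⟩
      quad Y * quad C * quad D          ≡⟨ solve₂ 3 (λ y c d → y :* c :* d := y :* d :* c) refl (quad Y) (quad C) (quad D) ⟩
      quad Y * quad D * quad C          ≡⟨ cong (_* quad C) (Intertwines-quad {X} {Y} {D} D∈) ⟨
      σ (quad D) * quad X * quad C      ≡⟨ solve₂ 3 (λ x s d → s :* x :* d := x :* (s :* d)) refl (quad X) (σ (quad D)) (quad C) ⟩
      quad X * (σ (quad D) * quad C)    ∎))
      where
      open ≡-Reasoning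
      X = coords P

    Distinct : (C D : Vector Carrier 4) → Set
    Distinct C D = ¬ (∀ i → C i ≡ D i)

    ⊕-nonzero : ∀ {C D} → Distinct C D → Nonzero (C ⊕ D)
    ⊕-nonzero C≢D ≡0 = C≢D λ i → +-≡0⇒≡ (≡0 i)

    -- In characteristic two, a quadratic form at A + B + C is the sum of its values at the three
    -- pairwise sums and at A, B and C. Distinctness makes the pairwise sums nonzero, so these are
    -- six equal values, which cancel; a solution with det 0 is zero.
    three-sum : ∀ A B C → Solution A → Solution B → Solution C → Nonzero A → Nonzero B → Nonzero C →
                Distinct A B → Distinct A C → Distinct B C → ∀ i → (A ⊕ B ⊕ C) i ≡ 0#
    three-sum A B C A∈ B∈ C∈ A≢0 B≢0 C≢0 A≢B A≢C B≢C = quad≡0 (A ⊕ B ⊕ C) (sum∈ (A ⊕ B) C (sum∈ A B A∈ B∈) C∈) (begin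
      quad (A ⊕ B ⊕ C)
        ≡⟨ solve₂ 12 (λ a b c d a′ b′ c′ d′ a″ b″ c″ d″ →
             (a :+ a′ :+ a″) :* (d :+ d′ :+ d″) :+ (b :+ b′ :+ b″) :* (c :+ c′ :+ c″) :=
               ((a :+ a′) :* (d :+ d′) :+ (b :+ b′) :* (c :+ c′)) :+ ((a :+ a″) :* (d :+ d″) :+ (b :+ b″) :* (c :+ c″)) :+
               ((a′ :+ a″) :* (d′ :+ d″) :+ (b′ :+ b″) :* (c′ :+ c″)) :+
               ((a :* d :+ b :* c) :+ (a′ :* d′ :+ b′ :* c′) :+ (a″ :* d″ :+ b″ :* c″)))
             refl (A 0F) (A 1F) (A 2F) (A 3F) (B 0F) (B 1F) (B 2F) (B 3F) (C 0F) (C 1F) (C 2F) (C 3F) ⟩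
      quad (A ⊕ B) + quad (A ⊕ C) + quad (B ⊕ C) + (δ + quad B + quad C)
        ≡⟨ cong₂ _+_
             (cong₂ _+_ (cong₂ _+_ (same (A ⊕ B) (sum∈ A B A∈ B∈) (⊕-nonzero A≢B)) (same (A ⊕ C) (sum∈ A C A∈ C∈) (⊕-nonzero A≢C)))
               (same (B ⊕ C) (sum∈ B C B∈ C∈) (⊕-nonzero B≢C)))
             (cong₂ _+_ (cong (δ +_) (same B B∈ B≢0)) (same C C∈ C≢0)) ⟩
      δ + δ + δ + (δ + δ + δ)
        ≡⟨ x+x≡0 (δ + δ + δ) ⟩
      0# ∎)
      where
      open ≡-Reasoning
      δ = quad A
      sum∈ : ∀ C D → Solution C → Solution D → Solution (C ⊕ D)
      sum∈ = Intertwines-⊕ {coords P} {Y}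
      same : ∀ D → Solution D → Nonzero D → quad D ≡ δ
      same D D∈ D≢0 = quad-unique D A D∈ A∈ D≢0 A≢0

    no-four : ∀ A B C D → Solution A → Solution B → Solution C → Solution D →
              Nonzero A → Nonzero B → Nonzero C → Nonzero D →
              Distinct A B → Distinct A C → Distinct B C → Distinct A D → Distinct B D → ¬ Distinct C D
    no-four A B C D A∈ B∈ C∈ D∈ A≢0 B≢0 C≢0 D≢0 A≢B A≢C B≢C A≢D B≢D C≢D = C≢D λ i → begin
      C i                       ≡⟨ +-≡0⇒≡ (three-sum A B C A∈ B∈ C∈ A≢0 B≢0 C≢0 A≢B A≢C B≢C i) ⟨
      A i + B i                 ≡⟨ +-≡0⇒≡ (three-sum A B D A∈ B∈ D∈ A≢0 B≢0 D≢0 A≢B A≢D B≢D i) ⟩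
      D i                       ∎
      where open ≡-Reasoning

  toGL₂ : ∀ B → ¬ Quadric B → GL₂
  toGL₂ B ¬q = gl₂ (coords B 0F) (coords B 1F) (coords B 2F) (coords B 3F) ¬q

  -- Rescale B so that the scalar in the intertwining equation becomes 1.
  intertwiner : ∀ B (¬q : ¬ Quadric B) {X Y : Vector Carrier 4} {l} → l ≢ 0# →
    (∀ i → (M (toGL₂ B ¬q) *ᵥ X) i ≡ l * Y i) →
    ∃[ m ] m ≢ 0# × Intertwines X Y (λ i → m * coords B i)
  intertwiner B ¬q {X} {Y} {l} l≢0 BX≡lY = m , m≢0 , rescaled
    where
    open ≡-Reasoning
    a = coords B 0F
    b = coords B 1F
    c = coords B 2F
    d = coords B 3F
    δ = quad (coords B)
    -- From B^σ X Bᵗ = l Y one gets δ B^σ (X J) = l (Y J) B, so m B is a solution as soon as σ m · l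
    -- = δ m.
    eigen = σ-eigen (δ * l ⁻¹) (*-≢0 ¬q (⁻¹-≢0 l≢0))
    m = proj₁ eigen
    m≢0 = proj₁ (proj₂ eigen)
    lσm≡δm : σ m * l ≡ δ * m
    lσm≡δm = begin
      σ m * l              ≡⟨ cong (_* l) (proj₂ (proj₂ eigen)) ⟩
      δ * l ⁻¹ * m * l     ≡⟨ solve₂ 4 (λ d i m l → d :* i :* m :* l := d :* m :* (i :* l)) refl δ (l ⁻¹) m l ⟩
      δ * m * (l ⁻¹ * l)   ≡⟨ cong (δ * m *_) (⁻¹-inverseˡ l≢0) ⟩
      δ * m * 1#           ≡⟨ *-identityʳ _ ⟩
      δ * m                ∎
    row : Carrier → Carrier → Carrier → Carrier → Carrier
    row e f g h = e * g * X 0F + (e * h * X 1F + (f * g * X 2F + (f * h * X 3F + 0#)))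
    column₀ : ∀ e f → δ * (e * X 1F + f * X 3F) ≡ row e f c d * a + row e f a b * c
    column₀ e f = solve₂ 10 (λ a b c d e f x y z w →
      (a :* d :+ b :* c) :* (e :* y :+ f :* w) :=
        (e :* c :* x :+ (e :* d :* y :+ (f :* c :* z :+ (f :* d :* w :+ con false)))) :* a :+
        (e :* a :* x :+ (e :* b :* y :+ (f :* a :* z :+ (f :* b :* w :+ con false)))) :* c)
      refl a b c d e f (X 0F) (X 1F) (X 2F) (X 3F)
    column₁ : ∀ e f → δ * (e * X 0F + f * X 2F) ≡ row e f c d * b + row e f a b * d
    column₁ e f = solve₂ 10 (λ a b c d e f x y z w →
      (a :* d :+ b :* c) :* (e :* x :+ f :* z) :=
        (e :* c :* x :+ (e :* d :* y :+ (f :* c :* z :+ (f :* d :* w :+ con false)))) :* b :+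
        (e :* a :* x :+ (e :* b :* y :+ (f :* a :* z :+ (f :* b :* w :+ con false)))) :* d)
      refl a b c d e f (X 0F) (X 1F) (X 2F) (X 3F)
    rescale : ∀ {e f x z r r′ y y′ u v} → δ * (e * x + f * z) ≡ r * u + r′ * v → r ≡ l * y → r′ ≡ l * y′ →
      σ m * e * x + σ m * f * z ≡ y * (m * u) + y′ * (m * v)
    rescale {e} {f} {x} {z} {r} {r′} {y} {y′} {u} {v} eq r≡ r′≡ = *-cancelˡ ¬q (begin
      δ * (σ m * e * x + σ m * f * z)
        ≡⟨ solve₂ 6 (λ δ m e f x z → δ :* (m :* e :* x :+ m :* f :* z) := m :* (δ :* (e :* x :+ f :* z))) refl δ (σ m) e f x z ⟩
      σ m * (δ * (e * x + f * z))
        ≡⟨ cong (σ m *_) (trans eq (cong₂ (λ r r′ → r * u + r′ * v) r≡ r′≡)) ⟩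
      σ m * (l * y * u + l * y′ * v)
        ≡⟨ solve₂ 6 (λ m l y y′ u v → m :* (l :* y :* u :+ l :* y′ :* v) := m :* l :* (y :* u :+ y′ :* v)) refl (σ m) l y y′ u v ⟩
      σ m * l * (y * u + y′ * v)
        ≡⟨ cong (_* (y * u + y′ * v)) lσm≡δm ⟩
      δ * m * (y * u + y′ * v)
        ≡⟨ solve₂ 6 (λ δ m y y′ u v → δ :* m :* (y :* u :+ y′ :* v) := δ :* (y :* (m :* u) :+ y′ :* (m :* v))) refl δ m y y′ u v ⟩
      δ * (y * (m * u) + y′ * (m * v)) ∎)
    σ-rescale : ∀ {e f x z w} → σ m * σ e * x + σ m * σ f * z ≡ w → σ (m * e) * x + σ (m * f) * z ≡ w
    σ-rescale {e} {f} {x} {z} eq = trans (cong₂ (λ s t → s * x + t * z) (σ-* m e) (σ-* m f)) eq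
    rescaled : Intertwines X Y (λ i → m * coords B i)
    rescaled 0F = σ-rescale (rescale (column₀ (σ a) (σ b)) (BX≡lY 1F) (BX≡lY 0F)) ,
                  σ-rescale (rescale (column₁ (σ a) (σ b)) (BX≡lY 1F) (BX≡lY 0F))
    rescaled 1F = σ-rescale (rescale (column₀ (σ c) (σ d)) (BX≡lY 3F) (BX≡lY 2F)) ,
                  σ-rescale (rescale (column₁ (σ c) (σ d)) (BX≡lY 3F) (BX≡lY 2F))

  -- The five orbits

  ℕ-cubic : ∀ {m l} → m ℕ.* l ℕ.+ q ≡ q ℕ.* (q ℕ.* q) → .{{_ : ℕ.NonZero m}} → l ≡ (q ℕ.^ 3 ℕ.∸ q) ℕ./ m
  ℕ-cubic {m} {l} eq = sym (begin
    (q ℕ.^ 3 ℕ.∸ q) ℕ./ m                      ≡⟨ cong (λ c → (q ℕ.* (q ℕ.* c) ℕ.∸ q) ℕ./ m) (ℕ.*-identityʳ q) ⟩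
    (q ℕ.* (q ℕ.* q) ℕ.∸ q) ℕ./ m              ≡⟨ cong (λ c → (c ℕ.∸ q) ℕ./ m) eq ⟨
    (m ℕ.* l ℕ.+ q ℕ.∸ q) ℕ./ m                ≡⟨ cong (ℕ._/ m) (ℕ.m+n∸n≡m (m ℕ.* l) q) ⟩
    m ℕ.* l ℕ./ m                              ≡⟨ cong (ℕ._/ m) (ℕ.*-comm m l) ⟩
    l ℕ.* m ℕ./ m                              ≡⟨ ℕ.m*n/n≡m l m ⟩
    l                                          ∎)
    where open ≡-Reasoning

  k-proj : ∀ B P → k (proj B • P) ≡ k P
  k-proj B P = k-invariant {proj B} (proj∈G B) P

  #k : ℕ → ℕ
  #k m = count normals (k≟ m ∘ pt)

  #one : ℕ
  #one = count normals (One-plane? ∘ pt)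

  three-count : 6 ℕ.* #k 3 ℕ.+ q ≡ q ℕ.* (q ℕ.* q)
  three-count = trans (cong (ℕ._+ q) (ℕ.*-assoc 2 3 (#k 3)))
    (count-by-flags (k≟ 3)
      (λ {P} {Q} P≈Q k≡3 → trans (sym (k-cong {P} {Q} P≈Q)) k≡3)
      (λ B P → mk⇔ (trans (sym (k-proj B P))) (trans (k-proj B P)))
      (λ P k≡3 → from-kind k≡3 (kind P)) 3 (λ P k≡3 → k≡3)
      (λ y y≢0 → proj₁ (half-at-∞ y y≢0)))
    where
    from-kind : ∀ {P} → k P ≡ 3 → Kind P → ¬ Quadric P
    from-kind _ (zero-planes _ ¬q)     = ¬q
    from-kind _ (one-plane _ ¬q)       = ¬q
    from-kind _ (three-planes _ ¬q)    = ¬q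
    from-kind k≡3 (on-arc k≡1 _ _)     = clash k≡3 k≡1 λ ()
    from-kind k≡3 (two-planes k≡2 _)   = clash k≡3 k≡2 λ ()

  one-count : 2 ℕ.* #one ℕ.+ q ≡ q ℕ.* (q ℕ.* q)
  one-count = trans (cong (λ c → 2 ℕ.* c ℕ.+ q) (sym (ℕ.*-identityˡ #one)))
    (count-by-flags One-plane?
      (λ {P} {Q} P≈Q (¬q , k≡1) → ¬q ∘ Quadric-resp {Q} {P} (≈-sym {P} {Q} P≈Q) , trans (sym (k-cong {P} {Q} P≈Q)) k≡1)
      (λ B P → mk⇔
        (λ (¬q , k≡1) → ¬q ∘ Equivalence.from (Quadric-proj B P) , trans (sym (k-proj B P)) k≡1)
        (λ (¬q , k≡1) → ¬q ∘ Equivalence.to (Quadric-proj B P) , trans (k-proj B P) k≡1))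
      (λ P → proj₁) 1 (λ P → proj₂)
      (λ y y≢0 → proj₂ (half-at-∞ y y≢0)))

  count-1 : ∀ {f : NormalPoint → ℕ} → (∀ X → f X ≡ 1) → total normals f ≡ q ℕ.* (q ℕ.* q) ℕ.+ (q ℕ.* q ℕ.+ (q ℕ.+ 1))
  count-1 f≡1 = trans (∑-cong (elements normals) f≡1)
    (trans (total-const normals 1) (trans (ℕ.*-identityʳ _) normal-size))

  total-normal-+ : ∀ f g → total normals (λ X → f X ℕ.+ g X) ≡ total normals f ℕ.+ total normals g
  total-normal-+ = ∑-+ (elements normals)

  ind-kinds : ∀ P → ind (k≟ 0 P) ℕ.+ ind (Quadric? P) ℕ.+ ind (One-plane? P) ℕ.+ ind (k≟ 3 P) ≡ 1
  ind-kinds P = from-kind (kind P)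
    where
    sum4 : ∀ {a b c d a′ b′ c′ d′} → a ≡ a′ → b ≡ b′ → c ≡ c′ → d ≡ d′ → a ℕ.+ b ℕ.+ c ℕ.+ d ≡ a′ ℕ.+ b′ ℕ.+ c′ ℕ.+ d′
    sum4 refl refl refl refl = refl
    from-kind : Kind P → ind (k≟ 0 P) ℕ.+ ind (Quadric? P) ℕ.+ ind (One-plane? P) ℕ.+ ind (k≟ 3 P) ≡ 1
    from-kind (zero-planes k≡ ¬q) = sum4 (ind-yes (k≟ 0 P) k≡) (ind-no (Quadric? P) ¬q)
      (ind-no (One-plane? P) λ (_ , k≡1) → clash k≡ k≡1 λ ()) (ind-k≢ {P} 3 k≡ λ ())
    from-kind (on-arc k≡ q _) = sum4 (ind-k≢ {P} 0 k≡ λ ()) (ind-yes (Quadric? P) q)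
      (ind-no (One-plane? P) λ (¬q , _) → ¬q q) (ind-k≢ {P} 3 k≡ λ ())
    from-kind (one-plane k≡ ¬q) = sum4 (ind-k≢ {P} 0 k≡ λ ()) (ind-no (Quadric? P) ¬q)
      (ind-yes (One-plane? P) (¬q , k≡)) (ind-k≢ {P} 3 k≡ λ ())
    from-kind (two-planes k≡ q) = sum4 (ind-k≢ {P} 0 k≡ λ ()) (ind-yes (Quadric? P) q)
      (ind-no (One-plane? P) λ (¬q , _) → ¬q q) (ind-k≢ {P} 3 k≡ λ ())
    from-kind (three-planes k≡ ¬q) = sum4 (ind-k≢ {P} 0 k≡ λ ()) (ind-no (Quadric? P) ¬q)
      (ind-no (One-plane? P) λ (_ , k≡1) → clash k≡ k≡1 λ ()) (ind-yes (k≟ 3 P) k≡)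

  -- There are q³ - q points off the quadric; those with k = 1 and k = 3 take up a half and a sixth
  -- of them, which leaves a third.
  zero-count : 3 ℕ.* #k 0 ℕ.+ q ≡ q ℕ.* (q ℕ.* q)
  zero-count = arith (#k 0) #one (#k 3) all one-count three-count
    where
    all : #k 0 ℕ.+ suc q ℕ.* suc q ℕ.+ #one ℕ.+ #k 3 ≡ q ℕ.* (q ℕ.* q) ℕ.+ (q ℕ.* q ℕ.+ (q ℕ.+ 1))
    all = trans (cong (λ c → #k 0 ℕ.+ c ℕ.+ #one ℕ.+ #k 3) (sym quadric-count))
      (trans (sym (trans (total-normal-+ (λ X → ind (k≟ 0 (pt X)) ℕ.+ ind (Quadric? (pt X)) ℕ.+ ind (One-plane? (pt X))) (λ X → ind (k≟ 3 (pt X))))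
        (cong (ℕ._+ #k 3) (trans (total-normal-+ (λ X → ind (k≟ 0 (pt X)) ℕ.+ ind (Quadric? (pt X))) (λ X → ind (One-plane? (pt X))))
          (cong (ℕ._+ #one) (total-normal-+ (λ X → ind (k≟ 0 (pt X))) (λ X → ind (Quadric? (pt X)))))))))
        (count-1 (ind-kinds ∘ pt)))
    arith : ∀ a b c → a ℕ.+ suc q ℕ.* suc q ℕ.+ b ℕ.+ c ≡ q ℕ.* (q ℕ.* q) ℕ.+ (q ℕ.* q ℕ.+ (q ℕ.+ 1)) →
            2 ℕ.* b ℕ.+ q ≡ q ℕ.* (q ℕ.* q) → 6 ℕ.* c ℕ.+ q ≡ q ℕ.* (q ℕ.* q) → 3 ℕ.* a ℕ.+ q ≡ q ℕ.* (q ℕ.* q)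
    -- The count of all points is multiplied by 6 to clear denominators, and the known classes are
    -- carried along in `rest` instead of being subtracted.
    arith a b c eq eb ec = ℕ.*-cancelˡ-≡ _ _ 2 (ℕ.+-cancelʳ-≡ rest _ _ (begin
      2 ℕ.* (3 ℕ.* a ℕ.+ q) ℕ.+ rest
        ≡⟨ solveℕ 4 (λ q a b c →
             conℕ 2 :*ℕ (conℕ 3 :*ℕ a :+ℕ q) :+ℕ (conℕ 6 :*ℕ ((conℕ 1 :+ℕ q) :*ℕ (conℕ 1 :+ℕ q)) :+ℕ conℕ 3 :*ℕ (conℕ 2 :*ℕ b :+ℕ q) :+ℕ (conℕ 6 :*ℕ c :+ℕ q)) :=ℕ
             conℕ 6 :*ℕ (a :+ℕ (conℕ 1 :+ℕ q) :*ℕ (conℕ 1 :+ℕ q) :+ℕ b :+ℕ c) :+ℕ conℕ 6 :*ℕ q) refl q a b c ⟩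
      6 ℕ.* (a ℕ.+ suc q ℕ.* suc q ℕ.+ b ℕ.+ c) ℕ.+ 6 ℕ.* q
        ≡⟨ cong (λ s → 6 ℕ.* s ℕ.+ 6 ℕ.* q) eq ⟩
      6 ℕ.* (q³ ℕ.+ (q ℕ.* q ℕ.+ (q ℕ.+ 1))) ℕ.+ 6 ℕ.* q
        ≡⟨ solveℕ 2 (λ q c → conℕ 6 :*ℕ (c :+ℕ (q :*ℕ q :+ℕ (q :+ℕ conℕ 1))) :+ℕ conℕ 6 :*ℕ q :=ℕ
             conℕ 2 :*ℕ c :+ℕ (conℕ 6 :*ℕ ((conℕ 1 :+ℕ q) :*ℕ (conℕ 1 :+ℕ q)) :+ℕ conℕ 3 :*ℕ c :+ℕ c)) refl q q³ ⟩
      2 ℕ.* q³ ℕ.+ (6 ℕ.* (suc q ℕ.* suc q) ℕ.+ 3 ℕ.* q³ ℕ.+ q³)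
        ≡⟨ cong₂ (λ x y → 2 ℕ.* q³ ℕ.+ (6 ℕ.* (suc q ℕ.* suc q) ℕ.+ 3 ℕ.* x ℕ.+ y)) eb ec ⟨
      2 ℕ.* q³ ℕ.+ rest ∎))
      where
      open ≡-Reasoning
      q³ = q ℕ.* (q ℕ.* q)
      rest = 6 ℕ.* (suc q ℕ.* suc q) ℕ.+ 3 ℕ.* (2 ℕ.* b ℕ.+ q) ℕ.+ (6 ℕ.* c ℕ.+ q)

  non-quadric-count : count normals (¬? ∘ Quadric? ∘ pt) ℕ.+ q ≡ q ℕ.* (q ℕ.* q)
  non-quadric-count = ℕ.+-cancelˡ-≡ (suc q ℕ.* suc q) _ _ (begin
    suc q ℕ.* suc q ℕ.+ (c ℕ.+ q)                               ≡⟨ ℕ.+-assoc (suc q ℕ.* suc q) c q ⟨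
    suc q ℕ.* suc q ℕ.+ c ℕ.+ q                                 ≡⟨ cong (λ d → d ℕ.+ c ℕ.+ q) quadric-count ⟨
    count normals (Quadric? ∘ pt) ℕ.+ c ℕ.+ q             ≡⟨ cong (ℕ._+ q) (total-normal-+ (ind ∘ Quadric? ∘ pt) (ind ∘ ¬? ∘ Quadric? ∘ pt)) ⟨
    total normals (λ X → ind (Quadric? (pt X)) ℕ.+ ind (¬? (Quadric? (pt X)))) ℕ.+ q
      ≡⟨ cong (ℕ._+ q) (count-1 (λ X → complement (Quadric? (pt X)))) ⟩
    q ℕ.* (q ℕ.* q) ℕ.+ (q ℕ.* q ℕ.+ (q ℕ.+ 1)) ℕ.+ q
      ≡⟨ solveℕ 2 (λ q c → c :+ℕ (q :*ℕ q :+ℕ (q :+ℕ conℕ 1)) :+ℕ q :=ℕ (conℕ 1 :+ℕ q) :*ℕ (conℕ 1 :+ℕ q) :+ℕ c) refl q (q ℕ.* (q ℕ.* q)) ⟩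
    suc q ℕ.* suc q ℕ.+ q ℕ.* (q ℕ.* q)                         ∎)
    where
    open ≡-Reasoning
    c = count normals (¬? ∘ Quadric? ∘ pt)
    complement : ∀ {A : Set} (d : Dec A) → ind d ℕ.+ ind (¬? d) ≡ 1
    complement (yes _) = refl
    complement (no _)  = refl

  Arc-size : HasSize (Arc h) (q ℕ.+ 1)
  Arc-size = subst (HasSize (Arc h))
    (trans (count-all PG₁-finite arc? arc∈Arc) (trans PG₁-size (ℕ.+-comm 1 q)))
    (hasSize PG₁-finite arc arc-injective arc? λ P P∈ → let t , P≈ = Arc⇒arc {P} P∈ in t , arc∈Arc t , P≈)
    where
    arc? : ∀ t → Dec (Arc h (arc t))
    arc? t = yes (arc∈Arc t)

  -- The quadric is the union of the arc and the points with k = 2, and (q + 1)² - (q + 1) = q² + q.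
  two-count : #k 2 ≡ q ℕ.^ 2 ℕ.+ q
  two-count = ℕ.+-cancelˡ-≡ (q ℕ.+ 1) _ _ (begin
    q ℕ.+ 1 ℕ.+ #k 2
      ≡⟨ cong (ℕ._+ #k 2) (hasSize-unique Arc-size (hasSize-points Arc? λ {P} {Q} → Arc-resp {P} {Q})) ⟩
    count normals (Arc? ∘ pt) ℕ.+ #k 2
      ≡⟨ total-normal-+ (ind ∘ Arc? ∘ pt) (ind ∘ k≟ 2 ∘ pt) ⟨
    total normals (λ X → ind (Arc? (pt X)) ℕ.+ ind (k≟ 2 (pt X)))
      ≡⟨ ∑-cong (elements normals) (λ X → split (pt X) (kind (pt X))) ⟩
    count normals (Quadric? ∘ pt)
      ≡⟨ quadric-count ⟩
    suc q ℕ.* suc q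
      ≡⟨ solveℕ 1 (λ q → (conℕ 1 :+ℕ q) :*ℕ (conℕ 1 :+ℕ q) :=ℕ q :+ℕ conℕ 1 :+ℕ (q :*ℕ (q :*ℕ conℕ 1) :+ℕ q)) refl q ⟩
    q ℕ.+ 1 ℕ.+ (q ℕ.^ 2 ℕ.+ q) ∎)
    where
    open ≡-Reasoning
    split : ∀ P → Kind P → ind (Arc? P) ℕ.+ ind (k≟ 2 P) ≡ ind (Quadric? P)
    split P (zero-planes k≡ ¬q) = trans (cong₂ ℕ._+_ (ind-no (Arc? P) (¬q ∘ Arc⇒Quadric {P})) (ind-k≢ {P} 2 k≡ λ ()))
      (sym (ind-no (Quadric? P) ¬q))
    split P (on-arc k≡ q P∈) = trans (cong₂ ℕ._+_ (ind-yes (Arc? P) P∈) (ind-k≢ {P} 2 k≡ λ ()))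
      (sym (ind-yes (Quadric? P) q))
    split P (one-plane k≡ ¬q) = trans (cong₂ ℕ._+_ (ind-no (Arc? P) (¬q ∘ Arc⇒Quadric {P})) (ind-k≢ {P} 2 k≡ λ ()))
      (sym (ind-no (Quadric? P) ¬q))
    split P (two-planes k≡ q) = trans (cong₂ ℕ._+_ (ind-no (Arc? P) λ P∈ → clash k≡ (k-arc-point {P} P∈) λ ()) (ind-yes (k≟ 2 P) k≡))
      (sym (ind-yes (Quadric? P) q))
    split P (three-planes k≡ ¬q) = trans (cong₂ ℕ._+_ (ind-no (Arc? P) (¬q ∘ Arc⇒Quadric {P})) (ind-k≢ {P} 2 k≡ λ ()))
      (sym (ind-no (Quadric? P) ¬q))

  -- Were there no such point, `zero-count` would read q = q³.
  zero-exists : ∃[ P ] k P ≡ 0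
  zero-exists = let X , k≡0 = count≢0 normals (k≟ 0 ∘ pt) #≢0 in pt X , k≡0
    where
    instance
      q-nonZero : ℕ.NonZero q
      q-nonZero = ℕ.>-nonZero (ℕ.≤-trans (s≤s z≤n) 8≤q)
    #≢0 : #k 0 ≢ 0
    #≢0 #≡0 = contradiction (subst (64 ℕ.≤_) q²≡1 (ℕ.*-mono-≤ 8≤q 8≤q)) λ { (s≤s ()) }
      where
      q²≡1 : q ℕ.* q ≡ 1
      q²≡1 = ℕ.*-cancelˡ-≡ _ _ q (trans (sym zero-count) (trans (cong (λ c → 3 ℕ.* c ℕ.+ q) #≡0) (sym (ℕ.*-identityʳ q))))

  -- The points off the quadric, read as 2 × 2 matrices, form PGL(2, q), of order
  -- q³ − q, and at most three of them map P to a given point.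
  module Images (P : Point) (k≡0 : k P ≡ 0) where

    ¬quadric : ¬ Quadric P
    ¬quadric P∈ = let t , P∈t = Quadric⇒Osc P P∈ in count≡0 PG₁-finite (Osc? P) k≡0 t P∈t

    -- Points of the quadric are singular matrices and give no projectivity; their placeholder value
    -- `norm P` is discarded by the second component of `Hits`.
    imageOf : ∀ B → Dec (Quadric (pt B)) → NormalPoint
    imageOf B (yes _) = norm P
    imageOf B (no ¬q) = norm (proj (toGL₂ (pt B) ¬q) • P)

    image : NormalPoint → NormalPoint
    image B = imageOf B (Quadric? (pt B))

    Hits : NormalPoint → NormalPoint → Set
    Hits Y B = image B ≡ Y × ¬ Quadric (pt B)

    _≟ᴺ_ : DecidableEquality NormalPoint
    _≟ᴺ_ = _≟_ normals

    hits? : ∀ Y → Decidable (Hits Y)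
    hits? Y B = (image B ≟ᴺ Y) ×-dec ¬? (Quadric? (pt B))

    hits-≈ : ∀ {Y B} → Hits Y B → ∃[ ¬q ] proj (toGL₂ (pt B) ¬q) • P ≈ pt Y
    hits-≈ {Y} {B} (eq , ¬q) = by-cases (Quadric? (pt B)) eq
      where
      by-cases : (d : Dec (Quadric (pt B))) → imageOf B d ≡ Y → ∃[ ¬q ] proj (toGL₂ (pt B) ¬q) • P ≈ pt Y
      by-cases (yes q)  _    = contradiction q ¬q
      by-cases (no ¬q′) refl = ¬q′ , norm-≈ (proj (toGL₂ (pt B) ¬q′) • P)

    hits-k : ∀ {Y B} → Hits Y B → k (pt Y) ≡ 0
    hits-k {Y} {B} hit = let ¬q , BP≈Y = hits-≈ {Y} {B} hit in
      trans (sym (k-cong {proj (toGL₂ (pt B) ¬q) • P} {pt Y} BP≈Y)) (trans (k-proj (toGL₂ (pt B) ¬q) P) k≡0)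

    module Fibre (Y : NormalPoint) where
      open Intertwiners P k≡0 ¬quadric (coords (pt Y))

      Rescaled : NormalPoint → Set
      Rescaled B = ∃[ m ] m ≢ 0# × Solution (λ i → m * coords (pt B) i)

      rescaled : ∀ {B} → Hits Y B → Rescaled B
      rescaled {B} hit = let ¬q , l , l≢0 , eq = hits-≈ {Y} {B} hit in intertwiner (pt B) ¬q {coords P} {coords (pt Y)} l≢0 eq

      vector : ∀ B → Rescaled B → Vector Carrier 4
      vector B (m , _) i = m * coords (pt B) i

      vector-nonzero : ∀ B (r : Rescaled B) → Nonzero (vector B r)
      vector-nonzero B (m , m≢0 , _) ≡0 = nonzero (pt B) λ i → *-≡0ʳ m≢0 (≡0 i)

      vector-distinct : ∀ B C (r : Rescaled B) (s : Rescaled C) → B ≢ C → Distinct (vector B r) (vector C s)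
      vector-distinct B C (m , m≢0 , _) (l , l≢0 , _) B≢C eq = B≢C (pt-injective {B} {C}
        (m ⁻¹ * l , *-≢0 (⁻¹-≢0 m≢0) l≢0 , λ i → *-cancelˡ m≢0 (trans (eq i) (begin
          l * coords (pt C) i                 ≡⟨ *-identityˡ _ ⟨
          1# * (l * coords (pt C) i)          ≡⟨ cong (_* (l * coords (pt C) i)) (⁻¹-inverseʳ m≢0) ⟨
          m * m ⁻¹ * (l * coords (pt C) i)    ≡⟨ solve₂ 4 (λ m i l c → m :* i :* (l :* c) := m :* (i :* l :* c)) refl m (m ⁻¹) l (coords (pt C) i) ⟩
          m * (m ⁻¹ * l * coords (pt C) i)    ∎))))
        where open ≡-Reasoning

      fibre≤3 : count normals (hits? Y) ℕ.≤ 3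
      fibre≤3 = count≤3 normals (hits? Y) λ {a} {b} {c} {d} ha hb hc hd a≢b a≢c b≢c a≢d b≢d c≢d →
        let ra = rescaled {a} ha ; rb = rescaled {b} hb ; rc = rescaled {c} hc ; rd = rescaled {d} hd in
        no-four (vector a ra) (vector b rb) (vector c rc) (vector d rd)
          (proj₂ (proj₂ ra)) (proj₂ (proj₂ rb)) (proj₂ (proj₂ rc)) (proj₂ (proj₂ rd))
          (vector-nonzero a ra) (vector-nonzero b rb) (vector-nonzero c rc) (vector-nonzero d rd)
          (vector-distinct a b ra rb a≢b) (vector-distinct a c ra rc a≢c) (vector-distinct b c rb rc b≢c)
          (vector-distinct a d ra rd a≢d) (vector-distinct b d rb rd b≢d) (vector-distinct c d rc rd c≢d)

    fibre : NormalPoint → ℕ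
    fibre Y = count normals (hits? Y)

    -- Images of P again have k = 0, so the fibres over all other points are empty.
    fibre≤ : ∀ Y → fibre Y ℕ.≤ 3 ℕ.* ind (k≟ 0 (pt Y))
    fibre≤ Y = by-cases (k≟ 0 (pt Y))
      where
      by-cases : (d : Dec (k (pt Y) ≡ 0)) → fibre Y ℕ.≤ 3 ℕ.* ind d
      by-cases (yes _) = Fibre.fibre≤3 Y
      by-cases (no ≢0) = ℕ.≤-reflexive (count-none normals (hits? Y) λ B hit → ≢0 (hits-k {Y} {B} hit))

    -- Both totals are q³ - q: each point off the quadric lies in one fibre, and the points with k =
    -- 0 number (q³ - q) / 3. Together with `fibre≤` this makes every fibre over such a point have
    -- exactly three elements.
    total-fibre : total normals fibre ≡ total normals (λ Y → 3 ℕ.* ind (k≟ 0 (pt Y)))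
    total-fibre = begin
      total normals fibre
        ≡⟨ ∑-cong (elements normals) (λ Y → ∑-cong (elements normals) (λ B → ind-× (image B ≟ᴺ Y) (¬? (Quadric? (pt B))))) ⟩
      total normals (λ Y → total normals (λ B → ind (image B ≟ᴺ Y) ℕ.* ind (¬? (Quadric? (pt B)))))
        ≡⟨ total-fibres normals normals image (λ B → ind (¬? (Quadric? (pt B)))) ⟩
      count normals (¬? ∘ Quadric? ∘ pt)
        ≡⟨ ℕ.+-cancelʳ-≡ q _ _ (trans non-quadric-count (sym zero-count)) ⟩
      3 ℕ.* #k 0
        ≡⟨ ∑-*ˡ (elements normals) 3 (λ Y → ind (k≟ 0 (pt Y))) ⟨
      total normals (λ Y → 3 ℕ.* ind (k≟ 0 (pt Y))) ∎
      where open ≡-Reasoning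

    reaches : ∀ Q → k Q ≡ 0 → Orbit h P Q
    reaches Q kQ≡0 = reach (count≢0 normals (hits? Y) fibre≢0)
      where
      Y = norm Q
      Q≈Y = norm-≈ Q
      kY≡0 : k (pt Y) ≡ 0
      kY≡0 = trans (sym (k-cong {Q} {pt Y} Q≈Y)) kQ≡0
      fibre≢0 : fibre Y ≢ 0
      fibre≢0 fibre≡0 = contradiction (trans (sym (total-≤-≡ normals fibre≤ total-fibre Y)) fibre≡0)
        (subst (λ c → 3 ℕ.* c ≢ 0) (sym (ind-yes (k≟ 0 (pt Y)) kY≡0)) λ ())
      reach : ∃[ B ] Hits Y B → Orbit h P Q
      reach (B , hit) = let ¬q , BP≈Y = hits-≈ {Y} {B} hit in
        Orbit-proj (toGL₂ (pt B) ¬q) {P} {Q} (≈-trans {proj (toGL₂ (pt B) ¬q) • P} {pt Y} {Q} BP≈Y (≈-sym {Q} {pt Y} Q≈Y))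

  𝒪₁⇔ : ∀ P → 𝒪₁ h P ⇔ One-plane P
  𝒪₁⇔ P = mk⇔
    (λ (¬arc , one) → let k≡1 = Equivalence.to (onExactly⇔k P 1) one in
      (λ q → ¬arc (Equivalence.from (Arc⇔ P) (q , k≡1))) , k≡1)
    (λ (¬q , k≡1) → ¬q ∘ Arc⇒Quadric {P} , Equivalence.from (onExactly⇔k P 1) k≡1)

  𝒪₂⇔k : ∀ P → 𝒪₂ h P ⇔ k P ≡ 2
  𝒪₂⇔k P = mk⇔ (λ (q , ¬arc) → to q ¬arc (kind P))
    (λ k≡2 → from k≡2 (kind P) , λ P∈ → clash k≡2 (k-arc-point {P} P∈) λ ())
    where
    to : Quadric P → ¬ Arc h P → Kind P → k P ≡ 2
    to q _ (zero-planes _ ¬q)     = contradiction q ¬q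
    to q _ (one-plane _ ¬q)       = contradiction q ¬q
    to q _ (three-planes _ ¬q)    = contradiction q ¬q
    to _ ¬arc (on-arc _ _ P∈)     = contradiction P∈ ¬arc
    to _ _ (two-planes k≡2 _)     = k≡2
    from : k P ≡ 2 → Kind P → Quadric P
    from _ (on-arc _ q _)          = q
    from _ (two-planes _ q)        = q
    from k≡2 (zero-planes k≡0 _)   = clash k≡2 k≡0 λ ()
    from k≡2 (one-plane k≡1 _)     = clash k≡2 k≡1 λ ()
    from k≡2 (three-planes k≡3 _)  = clash k≡2 k≡3 λ ()

  𝒪₃⇔k : ∀ P → 𝒪₃ h P ⇔ k P ≡ 3
  𝒪₃⇔k P = onExactly⇔k P 3

  -- The partition of the points into the five classes

  O : Fin 5 → Pred Point _
  O = orbits h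

  O-invariant : ∀ i {P Q} → Orbit h P Q → O i P → O i Q
  O-invariant 0F {P} {Q} o P∈ = Arc-orbit {P} {Q} o P∈
  O-invariant 1F {P} {Q} o P∈ = Equivalence.from (𝒪₀⇔k Q) (trans (k-orbit {P} {Q} o) (Equivalence.to (𝒪₀⇔k P) P∈))
  O-invariant 2F {P} {Q} o (¬arc , one) =
    ¬arc ∘ Arc-orbit {Q} {P} (Orbit-sym {P} {Q} o) ,
    Equivalence.from (onExactly⇔k Q 1) (trans (k-orbit {P} {Q} o) (Equivalence.to (onExactly⇔k P 1) one))
  O-invariant 3F {P} {Q} o P∈ = Equivalence.from (𝒪₂⇔k Q) (trans (k-orbit {P} {Q} o) (Equivalence.to (𝒪₂⇔k P) P∈))
  O-invariant 4F {P} {Q} o P∈ = Equivalence.from (𝒪₃⇔k Q) (trans (k-orbit {P} {Q} o) (Equivalence.to (𝒪₃⇔k P) P∈))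

  base : Fin 5 → Point
  base 0F = arc ∞
  base 1F = proj₁ zero-exists
  base 2F = ⟨0,1,1, c₀ ⟩
  base 3F = U₂
  base 4F = ⟨0,1,1, 0# ⟩

  base∈ : ∀ i → O i (base i)
  base∈ 0F = arc∈Arc ∞
  base∈ 1F = Equivalence.from (𝒪₀⇔k (base 1F)) (proj₂ zero-exists)
  base∈ 2F = Equivalence.from (𝒪₁⇔ (base 2F)) ((λ eq → 1≢0 (trans
    (solve₂ 1 (λ c → con true := con false :* c :+ con true :* con true) refl c₀) eq)) , k-one)
  base∈ 3F = Equivalence.from (𝒪₂⇔k (base 3F)) k-U₂
  base∈ 4F = Equivalence.from (𝒪₃⇔k (base 4F)) k-three

  base-orbit : ∀ P → ∃[ i ] Orbit h (base i) P
  base-orbit P = from-class (classify P)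
    where
    from-class : k P ≡ 0 ⊎ Class P → ∃[ i ] Orbit h (base i) P
    from-class (inj₁ k≡0)            = 1F , Images.reaches (base 1F) (proj₂ zero-exists) P k≡0
    from-class (inj₂ (~arc _ o))     = 0F , o
    from-class (inj₂ (~one _ o))     = 2F , o
    from-class (inj₂ (~quadric _ o)) = 3F , o
    from-class (inj₂ (~three _ o))   = 4F , o

  -- Recovers the index of a class from k and membership in the arc, so that disjointness of the
  -- five classes is transitivity of equality. The last clause serves k = 3, as larger values do not
  -- occur.
  O-index : ℕ → Bool → Fin 5
  O-index 0 _     = 1F
  O-index 1 true  = 0F
  O-index 1 false = 2F
  O-index 2 _     = 3F
  O-index _ _     = 4F

  O⇒index : ∀ i P → O i P → i ≡ O-index (k P) (does (Arc? P))
  O⇒index 0F P P∈ = sym (cong₂ O-index (k-arc-point {P} P∈) (dec-true (Arc? P) P∈))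
  O⇒index 1F P P∈ = sym (cong (λ m → O-index m (does (Arc? P))) (Equivalence.to (𝒪₀⇔k P) P∈))
  O⇒index 2F P P∈ = sym (cong₂ O-index (proj₂ (Equivalence.to (𝒪₁⇔ P) P∈)) (dec-false (Arc? P) (proj₁ P∈)))
  O⇒index 3F P P∈ = sym (cong (λ m → O-index m (does (Arc? P))) (Equivalence.to (𝒪₂⇔k P) P∈))
  O⇒index 4F P P∈ = sym (cong (λ m → O-index m (does (Arc? P))) (Equivalence.to (𝒪₃⇔k P) P∈))

  O-disjoint : ∀ i j P → O i P → O j P → i ≡ j
  O-disjoint i j P P∈i P∈j = trans (O⇒index i P P∈i) (sym (O⇒index j P P∈j))

  -- P lies in the orbit of some `base j`, hence in `O j` by invariance; disjointness then gives j =
  -- i.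
  O-from-base : ∀ i P → O i P → Orbit h (base i) P
  O-from-base i P P∈ = let j , o = base-orbit P in
    subst (λ i → Orbit h (base i) P) (O-disjoint j i P (O-invariant j {base j} {P} o (base∈ j)) P∈) o

  O-isOrbit : ∀ i → IsOrbit h (O i)
  O-isOrbit i = base i , (λ {Q} Q∈ → O-from-base i Q Q∈) , λ {Q} o → O-invariant i {base i} {Q} o (base∈ i)

  O-distinct : ∀ i j → O i ≐ O j → i ≡ j
  O-distinct i j (Oᵢ⊆Oⱼ , _) = O-disjoint i j (base i) (base∈ i) (Oᵢ⊆Oⱼ {base i} (base∈ i))

  O-exhaustive : ∀ S → IsOrbit h S → ∃[ i ] S ≐ O i
  O-exhaustive S (P , S⊆ , ⊆S) = let i , o = base-orbit P in
    i , (λ {Q} Q∈ → O-invariant i {base i} {Q} (Orbit-trans {base i} {P} {Q} o (S⊆ Q∈)) (base∈ i)) ,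
    λ {Q} Q∈ → ⊆S (Orbit-trans {P} {base i} {Q} (Orbit-sym {base i} {P} o) (O-from-base i Q Q∈))

  hasSize-k : ∀ {S} m → (∀ P → S P ⇔ k P ≡ m) → HasSize S (#k m)
  hasSize-k m S⇔k = hasSize-resp ((λ {P} → Equivalence.from (S⇔k P)) , λ {P} → Equivalence.to (S⇔k P))
    (hasSize-points (k≟ m) λ {P} {Q} P≈Q k≡ → trans (sym (k-cong {P} {Q} P≈Q)) k≡)

  𝒪₀-size : HasSize (𝒪₀ h) ((q ℕ.^ 3 ℕ.∸ q) ℕ./ 3)
  𝒪₀-size = subst (HasSize (𝒪₀ h)) (ℕ-cubic zero-count) (hasSize-k 0 𝒪₀⇔k)

  𝒪₁-size : HasSize (𝒪₁ h) ((q ℕ.^ 3 ℕ.∸ q) ℕ./ 2)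
  𝒪₁-size = subst (HasSize (𝒪₁ h)) (ℕ-cubic one-count)
    (hasSize-resp ((λ {P} → Equivalence.from (𝒪₁⇔ P)) , λ {P} → Equivalence.to (𝒪₁⇔ P))
      (hasSize-points One-plane? λ {P} {Q} P≈Q (¬q , k≡1) →
        ¬q ∘ Quadric-resp {Q} {P} (≈-sym {P} {Q} P≈Q) , trans (sym (k-cong {P} {Q} P≈Q)) k≡1))

  𝒪₂-size : HasSize (𝒪₂ h) (q ℕ.^ 2 ℕ.+ q)
  𝒪₂-size = subst (HasSize (𝒪₂ h)) two-count (hasSize-k 2 𝒪₂⇔k)

  𝒪₂-planes : 𝒪₂ h ≐ OnExactly 2 OsculatingPlanes h
  𝒪₂-planes = (λ {P} → Equivalence.from (onExactly⇔k P 2) ∘ Equivalence.to (𝒪₂⇔k P)) ,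
               λ {P} → Equivalence.from (𝒪₂⇔k P) ∘ Equivalence.to (onExactly⇔k P 2)

  𝒪₃-size : HasSize (𝒪₃ h) ((q ℕ.^ 3 ℕ.∸ q) ℕ./ 6)
  𝒪₃-size = subst (HasSize (𝒪₃ h)) (ℕ-cubic three-count) (hasSize-k 3 𝒪₃⇔k)

open import Data.Nat.Base using (_+_; _∸_; _^_; _/_; _≤_)
open import Data.Product.Base using (_×_; _,_; ∃-syntax)
open import Relation.Unary using (_≐_)

proposition3p2 : (q n h : ℕ) → q ≡ 2 ^ n → 3 ≤ n → 1 ≤ h → gcd n h ≡ 1 →
    (F : FiniteField q) →
    let open PG3 F in
    (∀ i → IsOrbit h (orbits h i)) ×
    (∀ i j → orbits h i ≐ orbits h j → i ≡ j) ×
    (∀ S → IsOrbit h S → ∃[ i ] S ≐ orbits h i) ×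
    HasSize (Arc h) (q + 1) ×
    HasSize (𝒪₀ h) ((q ^ 3 ∸ q) / 3) ×
    HasSize (𝒪₁ h) ((q ^ 3 ∸ q) / 2) ×
    HasSize (𝒪₂ h) (q ^ 2 + q) ×
    (𝒪₂ h ≐ OnExactly 2 OsculatingPlanes h) ×
    HasSize (𝒪₃ h) ((q ^ 3 ∸ q) / 6)
proposition3p2 q n h q≡2^n 3≤n _ gcd≡1 F =
  O-isOrbit , O-distinct , O-exhaustive , Arc-size , 𝒪₀-size , 𝒪₁-size , 𝒪₂-size , 𝒪₂-planes , 𝒪₃-size
  where open Osculating-Orbits q n h q≡2^n 3≤n gcd≡1 F
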